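{- Let $\nu$ be a positive integer and, for $k=1,\dots,\nu$, let $N_k=n_k+n_{k+1}+\dots+n_\nu$. Then for every non-negative integer $M$, \begin{align*} \sum_{\substack{i,m,n_1,\dots,n_\nu\geq 0,\\ i+m \equiv N_1+N_2+\dots + N_\nu \ (\mathrm{mod}\ 2)}} &q^{\frac{m^2+3(i^2+N_1^2+N_2^2+\dots + N_\nu^2)}{2}} {M \brack i}_{q^3}{3n_\nu\brack m}_{q}\\ &\times {2n_\nu + \frac{i-N_1-N_2-\dots-N_\nu-m}{2}\brack 2n_\nu}_{q^3} \prod_{j=1}^{\nu-1} {i- \sum_{k=1}^j N_k+n_j \brack n_j}_{q^3}\\ &= \sum_{j=-\infty} ^\infty q^{3\binom{\nu+2}{2}j^2+j} {2M\brack M+(\nu+1)j}_{q^3}. \end{align*}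
   Context: For a variable $x$ and integer $n\ge 0$, $(x;x)_n=\prod_{k=1}^n(1-x^k)$. For integers $A,B$, ${A\brack B}_x=\frac{(x;x)_A}{(x;x)_B(x;x)_{A-B}}$ if $B\ge 0$ and $A-B\ge 0$, and $0$ otherwise. An empty product equals $1$. -}

module Defs where

open import Data.Nat as ℕ using (ℕ; zero; suc; _≡ᵇ_)
open import Data.Nat.Combinatorics using (_C_)
open import Data.Integer as ℤ using (ℤ; +_; -[1+_])
open import Data.Integer.DivMod using () renaming (_/_ to _/ℤ_)
open import Data.List using (List; []; _∷_; map; upTo; foldr; concatMap; take; length; zipWith; _++_)
open import Data.Bool using (Bool; if_then_else_)
open import Relation.Nullary.Decidable using (⌊_⌋)
open import Data.Nat.ListAction using () renaming (sum to sumℕ)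

-- Formal power series in one variable with integer coefficients:
-- a series is its coefficient sequence.

Series : Set
Series = ℕ → ℤ

0S : Series
0S _ = + 0

1S : Series
1S zero    = + 1
1S (suc _) = + 0

_⊕_ : Series → Series → Series
(a ⊕ b) n = a n ℤ.+ b n

sumℤ : List ℤ → ℤ
sumℤ = foldr ℤ._+_ (+ 0)

_⊗_ : Series → Series → Series
(a ⊗ b) n = sumℤ (map (λ k → a k ℤ.* b (n ℕ.∸ k)) (upTo (suc n)))

sumS : List Series → Series
sumS = foldr _⊕_ 0S

prodS : List Series → Series
prodS = foldr _⊗_ 1S

mono : ℕ → Series
mono e n = if e ≡ᵇ n then + 1 else + 0

-- monomial x^z for an integer exponent z (only used with z ≥ 0;
-- it is the zero series if z < 0)
monoℤ : ℤ → Series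
monoℤ z n = if ⌊ z ℤ.≟ + n ⌋ then + 1 else + 0

at3 : Series → Series
at3 a n = if (n ℕ.% 3) ≡ᵇ 0 then a (n ℕ./ 3) else + 0

-- multiplicative inverse of a series with constant term 1:
-- b_0 = 1, b_n = - Σ_{k=1}^{n} a_k b_{n-k}.
-- invRev a n is the list [b_n, b_{n-1}, …, b_0].
invRev : Series → ℕ → List ℤ
invRev a zero    = + 1 ∷ []
invRev a (suc n) =
  let bs = invRev a n in
  ℤ.- sumℤ (zipWith (λ k b → a k ℤ.* b) (map suc (upTo (suc n))) bs) ∷ bs

headℤ : List ℤ → ℤ
headℤ []      = + 0
headℤ (x ∷ _) = x

inv : Series → Series
inv a n = headℤ (invRev a n)

poch : ℕ → Series
poch n = prodS (map (λ k → 1S ⊕ (λ t → ℤ.- mono (suc k) t)) (upTo n))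

gauss : ℤ → ℤ → Series
gauss A B with B | A ℤ.- B
... | + b | + c = poch (b ℕ.+ c) ⊗ (inv (poch b) ⊗ inv (poch c))
... | _   | _   = 0S

-- The left-hand side.  A tuple (n_1,…,n_ν) is a list of length ν.

Ns : List ℕ → List ℕ
Ns []       = []
Ns (x ∷ xs) = (x ℕ.+ sumℕ xs) ∷ Ns xs

lookupℕ : List ℕ → ℕ → ℕ
lookupℕ []       _       = 0
lookupℕ (x ∷ _)  zero    = x
lookupℕ (_ ∷ xs) (suc k) = lookupℕ xs k

-- last entry n_ν (list assumed nonempty)
lastℕ : List ℕ → ℕ
lastℕ []           = 0
lastℕ (x ∷ [])     = x
lastℕ (_ ∷ y ∷ ys) = lastℕ (y ∷ ys)

sq : ℕ → ℕ
sq x = x ℕ.* x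

-- the summand for (i, m, n_1..n_ν), M fixed, when i+m ≡ ΣN_k (mod 2)
lhsTerm : ℕ → ℕ → ℕ → List ℕ → Series
lhsTerm M i m ns =
  mono ((sq m ℕ.+ 3 ℕ.* (sq i ℕ.+ sumℕ (map sq N))) ℕ./ 2)
  ⊗ (at3 (gauss (+ M) (+ i))
  ⊗ (gauss (+ (3 ℕ.* nν)) (+ m)
  ⊗ (at3 (gauss (+ (2 ℕ.* nν) ℤ.+ ((+ i ℤ.- + S ℤ.- + m) /ℤ + 2)) (+ (2 ℕ.* nν)))
  ⊗ prodS (map (λ j → at3 (gauss (+ i ℤ.- + sumℕ (take j N) ℤ.+ + lookupℕ ns (j ℕ.∸ 1))
                                  (+ lookupℕ ns (j ℕ.∸ 1))))
               (map suc (upTo (length ns ℕ.∸ 1)))))))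
  where
  N  = Ns ns
  S  = sumℕ N
  nν = lastℕ ns

lhsSummand : ℕ → ℕ → ℕ → List ℕ → Series
lhsSummand M i m ns =
  if ((i ℕ.+ m) ℕ.% 2) ≡ᵇ (sumℕ (Ns ns) ℕ.% 2)
  then lhsTerm M i m ns else 0S

boxes : ℕ → ℕ → List (List ℕ)
boxes zero    B = [] ∷ []
boxes (suc ν) B = concatMap (λ x → map (x ∷_) (boxes ν B)) (upTo (suc B))

lhsPartial : ℕ → ℕ → ℕ → Series
lhsPartial ν M B =
  sumS (concatMap (λ i → concatMap (λ m → map (lhsSummand M i m) (boxes ν B))
                                     (upTo (suc B)))
                  (upTo (suc B)))

rhsTerm : ℕ → ℕ → ℤ → Series
rhsTerm ν M j =
  monoℤ (+ (3 ℕ.* ((ν ℕ.+ 2) C 2)) ℤ.* j ℤ.* j ℤ.+ j)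
  ⊗ at3 (gauss (+ (2 ℕ.* M)) (+ M ℤ.+ + (ν ℕ.+ 1) ℤ.* j))

intRange : ℕ → List ℤ
intRange B = map +_ (upTo (suc B)) ++ map -[1+_] (upTo B)

rhsPartial : ℕ → ℕ → ℕ → Series
rhsPartial ν M B = sumS (map (rhsTerm ν M) (intRange B))

{-# OPTIONS --safe #-}

-- Both sides are polynomials in q with non-negative coefficients, so it is enough to compare their
-- values at the squares q = t², t ≥ 1; then all half-integer powers of q are powers of t.
--
-- Put h = t³ and p = h² = q³.  The sum over m is the z-expansion of (-zt;q)_{3n} / (z²;p)_{2n+1};
-- splitting the numerator into residue classes of exponents modulo 3 and applying the q-Pfaff–Saalschütz
-- sum turns it into Σ_j q^(3j²/2+j) T(L,n,j,j), where T is Warnaar's refined q-trinomial coefficient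
-- with base p.  Each of the ν - 1 sums over N_ν, …, N_2 is an instance of Warnaar's invariance property
--   Σ_i p^(i²/2) [L+M-i, L] T(L-i,i,a,b) = p^(b²/2) T(L,M,a+b,b),
-- which for 0 ≤ b ≤ a follows from three q-Pfaff–Saalschütz sums.  The remaining sum over N_1
-- is the case M → ∞ of this property, and q-Vandermonde sums over i to give [2M, M+(ν+1)j].
module Submission where

open import Defs
open import Algebra.Bundles using (CommutativeRing)
import Algebra.Properties.Ring as RingProperties
import Algebra.Solver.CommutativeMonoid as CommutativeMonoidSolver
open import Algebra.Structures using (IsCommutativeRing)
open import Data.Bool using (true; false; if_then_else_)
open import Data.Integer as ℤ using (ℤ; -[1+_]) renaming (+_ to infix 8 ⁺_)
open import Data.Integer.DivMod using ([n/d]*d≤n) renaming (_/_ to _/ℤ_)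
import Data.Integer.Properties as ℤ
import Data.Integer.Tactic.RingSolver as ℤSolver
open import Data.List using (List; []; _∷_; _++_; _∷ʳ_; map; upTo; applyUpTo; zipWith; concatMap; length; take)
open import Data.List.Properties using (map-upTo; map-++; upTo-∷ʳ)
open import Data.Nat
open import Data.Nat.Combinatorics using (_C_; nC1≡n; nCk+nC[k+1]≡[n+1]C[k+1])
open import Data.Nat.DivMod using (m<n⇒m%n≡m; [m+kn]%n≡m%n; m/n≡1+[m∸n]/n; m*n/n≡m)
open import Data.Nat.ListAction using () renaming (sum to sumℕ)
open import Data.Nat.Properties
open import Data.Nat.Tactic.RingSolver using (solve-∀)
open import Data.Product using (∃; ∃-syntax; _×_; _,_; proj₁)
open import Data.Sum using (_⊎_; inj₁; inj₂)
open import Level using (0ℓ)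
open import Relation.Binary using (IsEquivalence)
open import Relation.Binary.PropositionalEquality
import Relation.Binary.Reasoning.Setoid as SetoidReasoning
open import Relation.Nullary using (yes; no)
open ≡-Reasoning

-- The values live in ℕ, so every formula is arranged without subtraction or division: quotients
-- become cancellations of positive factors, and a truncated difference such as `b ∸ δ` stands in an
-- exponent only next to a Gaussian factor that vanishes when the true difference would be negative.
-- This is why so many steps split on `G-split`.
--
-- T(L,M,a,b) does not change under (a,b) ↦ (-a,-b), so the indices j and -j share one coefficient
-- and are merged into the weight `v j`; hence only 0 ≤ b ≤ a is ever met. Each invariance step
-- keeps b = j and raises a by j: a starts at j, is νj after the ν - 1 steps, and the limiting step
-- leads to (ν+1)j. Each of these ν steps costs a factor h^(j²), and the last sum, over i, yields
-- h^(a²) with a = (ν+1)j. Since 1 + ν + (ν+1)² = (ν+1)(ν+2), the total power of q is 3 binom(ν+2,2)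
-- j² + j.
--
-- The sums are finite because a non-zero summand forces i ≤ M and i = N₁+...+N_ν + m + 2k for some
-- k ≥ 0. The box of size M therefore contains the whole support.

-- Finite sums

-- Σ⁺ n f = Σ_{i+j=n} f i j and Σ² n f = Σ_{m+2c=n} f m c.
Σ⁺ Σ² : ℕ → (ℕ → ℕ → ℕ) → ℕ
Σ⁺ zero    f = f 0 0
Σ⁺ (suc n) f = f 0 (suc n) + Σ⁺ n (λ i j → f (suc i) j)
Σ² zero          f = f 0 0
Σ² (suc zero)    f = f 1 0
Σ² (suc (suc n)) f = f (2 + n) 0 + Σ² n (λ m c → f m (suc c))

-- The coefficient of z^n in z^a times the generating function of `g`. Unlike `g (n ∸ a)` it is zero
-- for n < a, as the ranges of summation require.
shift : ℕ → ℕ → (ℕ → ℕ) → ℕ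
shift zero    n       g = g n
shift (suc a) zero    g = 0
shift (suc a) (suc n) g = shift a n g

Σ< : ℕ → (ℕ → ℕ) → ℕ
Σ< zero    f = 0
Σ< (suc n) f = f 0 + Σ< n (λ k → f (suc k))

+-interchange : ∀ a b c d → (a + b) + (c + d) ≡ (a + c) + (b + d)
+-interchange = solve-∀

Σ⁺-cong : ∀ n {f g} → (∀ i j → i + j ≡ n → f i j ≡ g i j) → Σ⁺ n f ≡ Σ⁺ n g
Σ⁺-cong zero    e = e 0 0 refl
Σ⁺-cong (suc n) e = cong₂ _+_ (e 0 (suc n) refl)
                              (Σ⁺-cong n λ i j p → e (suc i) j (cong suc p))

Σ⁺-zero : ∀ n {f} → (∀ i j → i + j ≡ n → f i j ≡ 0) → Σ⁺ n f ≡ 0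
Σ⁺-zero zero    e = e 0 0 refl
Σ⁺-zero (suc n) e = cong₂ _+_ (e 0 (suc n) refl)
                              (Σ⁺-zero n λ i j p → e (suc i) j (cong suc p))

Σ⁺-+ : ∀ n f g → Σ⁺ n (λ i j → f i j + g i j) ≡ Σ⁺ n f + Σ⁺ n g
Σ⁺-+ zero    f g = refl
Σ⁺-+ (suc n) f g = trans (cong (f 0 (suc n) + g 0 (suc n) +_) (Σ⁺-+ n _ _))
                         (+-interchange (f 0 (suc n)) _ _ _)

Σ⁺-* : ∀ n c f → Σ⁺ n (λ i j → c * f i j) ≡ c * Σ⁺ n f
Σ⁺-* zero    c f = refl
Σ⁺-* (suc n) c f = trans (cong (c * f 0 (suc n) +_) (Σ⁺-* n c _))
                         (sym (*-distribˡ-+ c (f 0 (suc n)) _))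

Σ⁺-last : ∀ n f → Σ⁺ (suc n) f ≡ Σ⁺ n (λ i j → f i (suc j)) + f (suc n) 0
Σ⁺-last zero    f = refl
Σ⁺-last (suc n) f = trans (cong (f 0 (2 + n) +_) (Σ⁺-last n λ i j → f (suc i) j))
                          (sym (+-assoc (f 0 (2 + n)) _ _))

Σ⁺-swap : ∀ n f → Σ⁺ n f ≡ Σ⁺ n (λ i j → f j i)
Σ⁺-swap zero    f = refl
Σ⁺-swap (suc n) f = begin
  f 0 (suc n) + Σ⁺ n (λ i j → f (suc i) j)  ≡⟨ +-comm (f 0 (suc n)) _ ⟩
  Σ⁺ n (λ i j → f (suc i) j) + f 0 (suc n)  ≡⟨ cong (_+ f 0 (suc n)) (Σ⁺-swap n _) ⟩
  Σ⁺ n (λ i j → f (suc j) i) + f 0 (suc n)  ≡⟨ Σ⁺-last n (λ i j → f j i) ⟨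
  Σ⁺ (suc n) (λ i j → f j i)                ∎

Σ⁺-assoc : ∀ n (f : ℕ → ℕ → ℕ → ℕ) →
  Σ⁺ n (λ i m → Σ⁺ m (f i)) ≡ Σ⁺ n (λ m k → Σ⁺ m (λ i j → f i j k))
Σ⁺-assoc zero    f = refl
Σ⁺-assoc (suc n) f = begin
  (f 0 0 (suc n) + Σ⁺ n (λ j k → f 0 (suc j) k)) + Σ⁺ n (λ i m → Σ⁺ m (f (suc i)))
    ≡⟨ +-assoc (f 0 0 (suc n)) _ _ ⟩
  f 0 0 (suc n) + (Σ⁺ n (λ j k → f 0 (suc j) k) + Σ⁺ n (λ i m → Σ⁺ m (f (suc i))))
    ≡⟨ cong (λ x → f 0 0 (suc n) + (Σ⁺ n (λ j k → f 0 (suc j) k) + x)) (Σ⁺-assoc n _) ⟩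
  f 0 0 (suc n) + (Σ⁺ n (λ j k → f 0 (suc j) k)
                   + Σ⁺ n (λ m k → Σ⁺ m (λ i j → f (suc i) j k)))
    ≡⟨ cong (f 0 0 (suc n) +_) (Σ⁺-+ n _ _) ⟨
  f 0 0 (suc n) + Σ⁺ n (λ m k → f 0 (suc m) k + Σ⁺ m (λ i j → f (suc i) j k)) ∎

shift-cong : ∀ a n {f g} → (∀ k → a + k ≡ n → f k ≡ g k) → shift a n f ≡ shift a n g
shift-cong zero    n       e = e n refl
shift-cong (suc a) zero    e = refl
shift-cong (suc a) (suc n) e = shift-cong a n λ k p → e k (cong suc p)

shift-zero : ∀ a n f → n < a → shift a n f ≡ 0
shift-zero (suc a) zero    f _       = refl
shift-zero (suc a) (suc n) f (s≤s p) = shift-zero a n f p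

shift-* : ∀ a n c f → shift a n (λ k → c * f k) ≡ c * shift a n f
shift-* zero    n       c f = refl
shift-* (suc a) zero    c f = sym (*-zeroʳ c)
shift-* (suc a) (suc n) c f = shift-* a n c f

shift-shift : ∀ a b n f → shift a n (λ k → shift b k f) ≡ shift (a + b) n f
shift-shift zero    b n       f = refl
shift-shift (suc a) b zero    f = refl
shift-shift (suc a) b (suc n) f = shift-shift a b n f

Σ⁺-shiftʳ : ∀ n a f → Σ⁺ n (λ i m → shift a m (f i)) ≡ shift a n (λ k → Σ⁺ k f)
Σ⁺-shiftʳ n       zero    f = refl
Σ⁺-shiftʳ zero    (suc a) f = refl
Σ⁺-shiftʳ (suc n) (suc a) f = begin
  Σ⁺ (suc n) (λ i m → shift (suc a) m (f i))
    ≡⟨ Σ⁺-last n (λ i m → shift (suc a) m (f i)) ⟩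
  Σ⁺ n (λ i m → shift a m (f i)) + 0
    ≡⟨ +-identityʳ _ ⟩
  Σ⁺ n (λ i m → shift a m (f i))
    ≡⟨ Σ⁺-shiftʳ n a f ⟩
  shift a n (λ k → Σ⁺ k f) ∎

Σ⁺-drop : ∀ a n f → (∀ i j → i < a → f i j ≡ 0) →
  Σ⁺ n f ≡ shift a n (λ k → Σ⁺ k (λ i j → f (a + i) j))
Σ⁺-drop zero    n       f z = refl
Σ⁺-drop (suc a) zero    f z = z 0 0 (s≤s z≤n)
Σ⁺-drop (suc a) (suc n) f z = trans
  (cong (_+ Σ⁺ n (λ i j → f (suc i) j)) (z 0 (suc n) (s≤s z≤n)))
  (Σ⁺-drop a n (λ i j → f (suc i) j) λ i j p → z (suc i) j (s≤s p))

Σ²-cong : ∀ n {f g} → (∀ m c → m + 2 * c ≡ n → f m c ≡ g m c) → Σ² n f ≡ Σ² n g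
Σ²-cong zero          e = e 0 0 refl
Σ²-cong (suc zero)    e = e 1 0 refl
Σ²-cong (suc (suc n)) e = cong₂ _+_ (e (2 + n) 0 (+-identityʳ _))
  (Σ²-cong n λ m c p → e m (suc c) (trans (aux m c) (cong (2 +_) p)))
  where
  aux : ∀ m c → m + 2 * suc c ≡ 2 + (m + 2 * c)
  aux = solve-∀

Σ²-+ : ∀ n f g → Σ² n (λ i j → f i j + g i j) ≡ Σ² n f + Σ² n g
Σ²-+ zero          f g = refl
Σ²-+ (suc zero)    f g = refl
Σ²-+ (suc (suc n)) f g = trans (cong (f (2 + n) 0 + g (2 + n) 0 +_) (Σ²-+ n _ _))
                               (+-interchange (f (2 + n) 0) _ _ _)

Σ²-* : ∀ n c f → Σ² n (λ i j → c * f i j) ≡ c * Σ² n f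
Σ²-* zero          c f = refl
Σ²-* (suc zero)    c f = refl
Σ²-* (suc (suc n)) c f = trans (cong (c * f (2 + n) 0 +_) (Σ²-* n c _))
                               (sym (*-distribˡ-+ c (f (2 + n) 0) _))

Σ²-unfold : ∀ n f →
  Σ² n f ≡ f n 0 + shift 2 n (λ k → Σ² k (λ m c → f m (suc c)))
Σ²-unfold zero          f = sym (+-identityʳ _)
Σ²-unfold (suc zero)    f = sym (+-identityʳ _)
Σ²-unfold (suc (suc n)) f = refl

-- `Σ²` lowers its range by two and `shift` by one, so `step` peels off a single unit of the shift
-- by a recursion on `n` in steps of two.
Σ²-shift : ∀ n a (f : ℕ → ℕ → ℕ) →
  Σ² n (λ m c → shift a m (λ k → f k c)) ≡ shift a n (λ k → Σ² k f)
Σ²-shift n zero f = refl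
Σ²-shift n (suc a) f = trans (step n f) (lift n)
  where
  lower : ∀ n → shift 1 n (λ k → Σ² k (λ m c → shift a m (λ l → f l c)))
              ≡ shift 1 n (λ k → shift a k (λ l → Σ² l f))
  lower n = shift-cong 1 n λ k _ → Σ²-shift k a f
  lift : ∀ n → shift 1 n (λ k → Σ² k (λ m c → shift a m (λ l → f l c)))
             ≡ shift (suc a) n (λ k → Σ² k f)
  lift n = trans (lower n) (shift-shift 1 a n _)
  step : ∀ n (f : ℕ → ℕ → ℕ) → Σ² n (λ m c → shift (suc a) m (λ k → f k c))
           ≡ shift 1 n (λ k → Σ² k (λ m c → shift a m (λ l → f l c)))
  step zero                f = refl
  step (suc zero)          f = refl
  step (suc (suc zero))    f = +-identityʳ _
  step (suc (suc (suc n))) f =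
    cong (shift a (2 + n) (λ k → f k 0) +_) (step (suc n) (λ k c → f k (suc c)))

Σ⁺Σ² : ∀ n (f : ℕ → ℕ → ℕ → ℕ) →
  Σ⁺ n (λ k w → Σ² w (f k)) ≡ Σ² n (λ m r → Σ⁺ m (λ k j → f k j r))
Σ⁺Σ² zero          f = refl
Σ⁺Σ² (suc zero)    f = refl
Σ⁺Σ² (suc (suc n)) f = begin
  Σ⁺ (2 + n) (λ k w → Σ² w (f k))
    ≡⟨ Σ⁺-cong (2 + n) (λ k w _ → Σ²-unfold w (f k)) ⟩
  Σ⁺ (2 + n) (λ k w → f k w 0 + shift 2 w (λ v → Σ² v (λ m c → f k m (suc c))))
    ≡⟨ Σ⁺-+ (2 + n) (λ k w → f k w 0) (λ k w → shift 2 w (λ v → Σ² v (λ m c → f k m (suc c)))) ⟩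
  Σ⁺ (2 + n) (λ k w → f k w 0)
    + Σ⁺ (2 + n) (λ k w → shift 2 w (λ v → Σ² v (λ m c → f k m (suc c))))
    ≡⟨ cong (Σ⁺ (2 + n) (λ k w → f k w 0) +_) (Σ⁺-shiftʳ (2 + n) 2 (λ k v → Σ² v (λ m c → f k m (suc c)))) ⟩
  Σ⁺ (2 + n) (λ k w → f k w 0) + Σ⁺ n (λ k w → Σ² w (λ m c → f k m (suc c)))
    ≡⟨ cong (Σ⁺ (2 + n) (λ k w → f k w 0) +_) (Σ⁺Σ² n _) ⟩
  Σ⁺ (2 + n) (λ k w → f k w 0) + Σ² n (λ m r → Σ⁺ m (λ k j → f k j (suc r))) ∎

-- Both sides run over the solutions of k + 2(r + γ) = n.
Σ²Σ² : ∀ n (g : ℕ → ℕ → ℕ → ℕ) →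
  Σ² n (λ m r → Σ² m (λ k γ → g k r γ)) ≡ Σ² n (λ k c → Σ⁺ c (g k))
Σ²Σ² zero          g = refl
Σ²Σ² (suc zero)    g = refl
Σ²Σ² (suc (suc n)) g = begin
  (g (2 + n) 0 0 + Σ² n (λ k γ → g k 0 (suc γ)))
    + Σ² n (λ m r → Σ² m (λ k γ → g k (suc r) γ))
    ≡⟨ cong (g (2 + n) 0 0 + Σ² n (λ k γ → g k 0 (suc γ)) +_) (Σ²Σ² n _) ⟩
  (g (2 + n) 0 0 + Σ² n (λ k γ → g k 0 (suc γ)))
    + Σ² n (λ k c → Σ⁺ c (λ r γ → g k (suc r) γ))
    ≡⟨ +-assoc (g (2 + n) 0 0) _ _ ⟩
  g (2 + n) 0 0 + (Σ² n (λ k γ → g k 0 (suc γ))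
    + Σ² n (λ k c → Σ⁺ c (λ r γ → g k (suc r) γ)))
    ≡⟨ cong (g (2 + n) 0 0 +_) (Σ²-+ n _ _) ⟨
  g (2 + n) 0 0 + Σ² n (λ k c → Σ⁺ (suc c) (g k)) ∎

Σ⁺-ends : ∀ n f →
  Σ⁺ (2 + n) f ≡ f 0 (2 + n) + (f (2 + n) 0 + Σ⁺ n (λ i j → f (suc i) (suc j)))
Σ⁺-ends n f = cong (f 0 (2 + n) +_) 
  (trans (Σ⁺-last n (λ i j → f (suc i) j)) (+-comm _ (f (2 + n) 0)))

-- Where `f` can be non-zero, the first index is j + i′ with i′ + 2j = n. The induction removes both
-- ends of the antidiagonal at once.
Σ⁺-fold : ∀ n f → (∀ i j → i + j ≡ n → i < j → f i j ≡ 0) → Σ⁺ n f ≡ Σ² n (λ i j → f (j + i) j)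
Σ⁺-fold zero          f z = refl
Σ⁺-fold (suc zero)    f z = cong (_+ f 1 0) (z 0 1 refl (s≤s z≤n))
Σ⁺-fold (suc (suc n)) f z = begin
  Σ⁺ (2 + n) f
    ≡⟨ Σ⁺-ends n f ⟩
  f 0 (2 + n) + (f (2 + n) 0 + Σ⁺ n (λ i j → f (suc i) (suc j)))
    ≡⟨ cong₂ (λ x y → x + (f (2 + n) 0 + y)) (z 0 (2 + n) refl (s≤s z≤n))
         (Σ⁺-fold n _ λ i j e p → z (suc i) (suc j) (cong suc (trans (+-suc i j) (cong suc e))) (s≤s p)) ⟩
  f (2 + n) 0 + Σ² n (λ i j → f (suc (j + i)) (suc j)) ∎

Σ<-cong : ∀ n {f g} → (∀ k → k < n → f k ≡ g k) → Σ< n f ≡ Σ< n g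
Σ<-cong zero    e = refl
Σ<-cong (suc n) e = cong₂ _+_ (e 0 (s≤s z≤n)) (Σ<-cong n λ k p → e (suc k) (s≤s p))

Σ<-+ : ∀ n f g → Σ< n (λ k → f k + g k) ≡ Σ< n f + Σ< n g
Σ<-+ zero    f g = refl
Σ<-+ (suc n) f g = trans (cong (f 0 + g 0 +_) (Σ<-+ n _ _)) (+-interchange (f 0) _ _ _)

Σ<-* : ∀ n c f → Σ< n (λ k → c * f k) ≡ c * Σ< n f
Σ<-* zero    c f = sym (*-zeroʳ c)
Σ<-* (suc n) c f = trans (cong (c * f 0 +_) (Σ<-* n c _)) (sym (*-distribˡ-+ c (f 0) _))

Σ<-zero : ∀ n {f} → (∀ k → k < n → f k ≡ 0) → Σ< n f ≡ 0
Σ<-zero zero    e = refl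
Σ<-zero (suc n) e = cong₂ _+_ (e 0 (s≤s z≤n)) (Σ<-zero n λ k p → e (suc k) (s≤s p))

Σ<-extend : ∀ m n f → m ≤ n → (∀ k → m ≤ k → f k ≡ 0) → Σ< m f ≡ Σ< n f
Σ<-extend zero    n       f _       z = sym (Σ<-zero n λ k _ → z k z≤n)
Σ<-extend (suc m) (suc n) f (s≤s p) z =
  cong (f 0 +_) (Σ<-extend m n _ p λ k q → z (suc k) (s≤s q))

Σ⁺-Σ< : ∀ n f → Σ⁺ n f ≡ Σ< (suc n) (λ k → f k (n ∸ k))
Σ⁺-Σ< zero    f = sym (+-identityʳ _)
Σ⁺-Σ< (suc n) f = cong (f 0 (suc n) +_) (Σ⁺-Σ< n _)

Σ⁺-cut : ∀ δ m f → (∀ k l → δ < k → f k l ≡ 0) → Σ⁺ (δ + m) f ≡ Σ⁺ δ (λ k l → f k (l + m))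
Σ⁺-cut zero    zero    f z = refl
Σ⁺-cut zero    (suc m) f z = trans (cong (f 0 (suc m) +_) (Σ⁺-zero m λ i j _ → z (suc i) j (s≤s z≤n)))
                                   (+-identityʳ _)
Σ⁺-cut (suc δ) m       f z =
  cong (f 0 (suc (δ + m)) +_) (Σ⁺-cut δ m (λ i j → f (suc i) j) λ k l p → z (suc k) l (s≤s p))

-- Gaussian binomials

-- The Gaussian binomial [a choose b] with base q, evaluated at a natural number q.
G : ℕ → ℕ → ℕ → ℕ
G q a       zero    = 1
G q zero    (suc b) = 0
G q (suc a) (suc b) = G q a b + q ^ suc b * G q a (suc b)

m≤n⇒n≡m+ : ∀ {m n} → m ≤ n → ∃ λ k → n ≡ m + k
m≤n⇒n≡m+ {m} {n} p = n ∸ m , sym (m+[n∸m]≡n p)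

module Gaussian (q : ℕ) where

  G-zero : ∀ a b → a < b → G q a b ≡ 0
  G-zero zero    (suc b) p       = refl
  G-zero (suc a) (suc b) (s≤s p) = begin
    G q a b + q ^ suc b * G q a (suc b)
      ≡⟨ cong₂ (λ x y → x + q ^ suc b * y) (G-zero a b p) (G-zero a (suc b) (m≤n⇒m≤1+n p)) ⟩
    q ^ suc b * 0
      ≡⟨ *-zeroʳ (q ^ suc b) ⟩
    0 ∎

  G-split : ∀ a b → (∃ λ c → a ≡ b + c) ⊎ G q a b ≡ 0
  G-split a b with b ≤? a
  ... | yes p = inj₁ (m≤n⇒n≡m+ p)
  ... | no ¬p = inj₂ (G-zero a b (≰⇒> ¬p))

  qint qfact : ℕ → ℕ
  qint zero    = 0
  qint (suc n) = 1 + q * qint n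
  qfact zero    = 1
  qfact (suc n) = qint (suc n) * qfact n

  -- True even at q = 0, since `qint (suc n)` is a successor. This is what allows cancellation to
  -- replace division by q-factorials.
  qfact-nonZero : ∀ n → NonZero (qfact n)
  qfact-nonZero zero    = _
  qfact-nonZero (suc n) = m*n≢0 (qint (suc n)) (qfact n) {{_}} {{qfact-nonZero n}}

  qint-+ : ∀ a b → qint (a + b) ≡ qint a + q ^ a * qint b
  qint-+ zero    b = sym (+-identityʳ _)
  qint-+ (suc a) b = trans (cong (λ x → 1 + q * x) (qint-+ a b)) (aux q (qint a) (q ^ a) (qint b))
    where
    aux : ∀ q x y z → 1 + q * (x + y * z) ≡ 1 + q * x + q * y * z
    aux = solve-∀

  G-diag : ∀ a → G q a a ≡ 1
  G-diag zero    = refl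
  G-diag (suc a) = trans (cong₂ (λ x y → x + q ^ suc a * y) (G-diag a) (G-zero a (suc a) ≤-refl))
                         (cong suc (*-zeroʳ (q ^ suc a)))

  -- The quotient formula with its denominators cleared. The two terms of the recursion contribute
  -- [a+1] and q^(a+1) [b+1] times the same q-factorial, and these add up to [a+b+2].
  G-qfact : ∀ a b → G q (a + b) a * (qfact a * qfact b) ≡ qfact (a + b)
  G-qfact zero    b = trans (+-identityʳ _) (+-identityʳ _)
  G-qfact (suc a) zero = begin
    G q (suc a + 0) (suc a) * (qfact (suc a) * 1)
      ≡⟨ cong₂ (λ x y → G q x (suc a) * y) (+-identityʳ (suc a)) (*-identityʳ (qfact (suc a))) ⟩
    G q (suc a) (suc a) * qfact (suc a)
      ≡⟨ cong (_* qfact (suc a)) (G-diag (suc a)) ⟩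
    1 * qfact (suc a)
      ≡⟨ *-identityˡ (qfact (suc a)) ⟩
    qfact (suc a)
      ≡⟨ cong qfact (+-identityʳ (suc a)) ⟨
    qfact (suc a + 0) ∎
  G-qfact (suc a) (suc b) = begin
    (x + r * y) * (m * fa * (n * fb))
      ≡⟨ aux x r y m fa n fb ⟩
    m * (x * (fa * (n * fb))) + r * n * (y * (m * fa * fb))
      ≡⟨ cong₂ (λ u v → m * u + r * n * v) (G-qfact a (suc b)) ih ⟩
    m * qfact (a + suc b) + r * n * qfact (a + suc b)
      ≡⟨ *-distribʳ-+ (qfact (a + suc b)) m _ ⟨
    (m + r * n) * qfact (a + suc b)
      ≡⟨ cong (_* qfact (a + suc b)) (qint-+ (suc a) (suc b)) ⟨
    qfact (suc a + suc b) ∎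
    where
    x  = G q (a + suc b) a
    y  = G q (a + suc b) (suc a)
    r  = q ^ suc a
    m  = qint (suc a)
    n  = qint (suc b)
    fa = qfact a
    fb = qfact b
    aux : ∀ x r y m fa n fb →
      (x + r * y) * (m * fa * (n * fb)) ≡ m * (x * (fa * (n * fb))) + r * n * (y * (m * fa * fb))
    aux = solve-∀
    ih : y * (m * fa * fb) ≡ qfact (a + suc b)
    ih = trans (cong (λ z → G q z (suc a) * (m * fa * fb)) (+-suc a b))
               (trans (G-qfact (suc a) b) (cong qfact (sym (+-suc a b))))

  G-sym : ∀ a b → G q (a + b) a ≡ G q (a + b) b
  G-sym a b = *-cancelʳ-≡ _ _ (qfact a * qfact b)
    {{m*n≢0 _ _ {{qfact-nonZero a}} {{qfact-nonZero b}}}} (begin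
    G q (a + b) a * (qfact a * qfact b)  ≡⟨ G-qfact a b ⟩
    qfact (a + b)                        ≡⟨ cong qfact (+-comm a b) ⟩
    qfact (b + a)                        ≡⟨ G-qfact b a ⟨
    G q (b + a) b * (qfact b * qfact a)
      ≡⟨ cong₂ (λ x y → G q x b * y) (+-comm b a) (*-comm (qfact b) _) ⟩
    G q (a + b) b * (qfact a * qfact b)  ∎)

  -- The other Pascal rule, with the power of q on the other term: the defining recursion seen
  -- through the symmetry `G-sym`.
  G-pascal : ∀ b c → G q (suc (b + c)) (suc b) ≡ q ^ c * G q (b + c) b + G q (b + c) (suc b)
  G-pascal b zero = begin
    G q (suc (b + 0)) (suc b)
      ≡⟨ cong (λ x → G q (suc x) (suc b)) (+-identityʳ b) ⟩
    G q (suc b) (suc b)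
      ≡⟨ trans (G-diag (suc b)) (sym (G-diag b)) ⟩
    G q b b
      ≡⟨ trans (+-identityʳ _) (+-identityʳ _) ⟨
    1 * G q b b + 0
      ≡⟨ cong (1 * G q b b +_) (G-zero b (suc b) ≤-refl) ⟨
    1 * G q b b + G q b (suc b)
      ≡⟨ cong (λ x → 1 * G q x b + G q x (suc b)) (+-identityʳ b) ⟨
    1 * G q (b + 0) b + G q (b + 0) (suc b) ∎
  G-pascal b (suc c) = begin
    G q (suc b + suc c) (suc b)
      ≡⟨ G-sym (suc b) (suc c) ⟩
    G q (b + suc c) c + q ^ suc c * G q (b + suc c) (suc c)
      ≡⟨ cong₂ (λ x y → x + q ^ suc c * y) symm (sym (G-sym b (suc c))) ⟩
    G q (b + suc c) (suc b) + q ^ suc c * G q (b + suc c) b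
      ≡⟨ +-comm (G q (b + suc c) (suc b)) _ ⟩
    q ^ suc c * G q (b + suc c) b + G q (b + suc c) (suc b) ∎
    where
    symm : G q (b + suc c) c ≡ G q (b + suc c) (suc b)
    symm = trans (cong (λ x → G q x c) (+-suc b c))
      (trans (sym (G-sym (suc b) c)) (cong (λ x → G q x (suc b)) (sym (+-suc b c))))

  -- Both products are the q-multinomial coefficient with parts x, y, z.
  G-trinomial⁺ : ∀ x y z →
    G q (x + y + z) (x + y) * G q (x + y) x ≡ G q (x + y + z) y * G q (x + z) x
  G-trinomial⁺ x y z = *-cancelʳ-≡ _ _ (fx * (fy * fz))
    {{m*n≢0 _ _ {{qfact-nonZero x}} {{m*n≢0 _ _ {{qfact-nonZero y}} {{qfact-nonZero z}}}}}} (begin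
    a * b * (fx * (fy * fz))       ≡⟨ aux₁ a b fx fy fz ⟩
    a * ((b * (fx * fy)) * fz)     ≡⟨ cong (λ u → a * (u * fz)) (G-qfact x y) ⟩
    a * (qfact (x + y) * fz)       ≡⟨ G-qfact (x + y) z ⟩
    qfact (x + y + z)              ≡⟨ cong qfact (aux₃ x y z) ⟩
    qfact (y + (x + z))            ≡⟨ G-qfact y (x + z) ⟨
    G q (y + (x + z)) y * (fy * qfact (x + z))
      ≡⟨ cong₂ (λ u v → G q u y * (fy * v)) (sym (aux₃ x y z)) (sym (G-qfact x z)) ⟩
    c * (fy * (d * (fx * fz)))     ≡⟨ aux₂ c d fx fy fz ⟩
    c * d * (fx * (fy * fz))       ∎)
    where
    fx = qfact x
    fy = qfact y
    fz = qfact z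
    a = G q (x + y + z) (x + y)
    b = G q (x + y) x
    c = G q (x + y + z) y
    d = G q (x + z) x
    aux₁ : ∀ a b x y z → a * b * (x * (y * z)) ≡ a * ((b * (x * y)) * z)
    aux₁ = solve-∀
    aux₂ : ∀ c d x y z → c * (y * (d * (x * z))) ≡ c * d * (x * (y * z))
    aux₂ = solve-∀
    aux₃ : ∀ x y z → x + y + z ≡ y + (x + z)
    aux₃ = solve-∀

  -- No bound on `n` is required: for y ≤ n < x + y the factor `G q (n ∸ y) x` is zero, and for n <
  -- y the factor `G q n y` is, so the truncation in `n ∸ y` does no harm.
  G-trinomial : ∀ n x y → G q n (x + y) * G q (x + y) x ≡ G q n y * G q (n ∸ y) x
  G-trinomial n x y with x + y ≤? n
  ... | yes p with z , refl ← m≤n⇒n≡m+ p = trans (G-trinomial⁺ x y z)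
    (cong (λ u → G q (x + y + z) y * G q u x) (sym (trans (cong (_∸ y) (aux x y z)) (m+n∸m≡n y _))))
    where
    aux : ∀ x y z → x + y + z ≡ y + (x + z)
    aux = solve-∀
  ... | no ¬p = trans (cong (_* G q (x + y) x) (G-zero n (x + y) (≰⇒> ¬p))) (sym rhs)
    where
    rhs : G q n y * G q (n ∸ y) x ≡ 0
    rhs with G-split n y
    ... | inj₂ e = cong (_* G q (n ∸ y) x) e
    ... | inj₁ (w , refl) = begin
      G q (y + w) y * G q (y + w ∸ y) x
        ≡⟨ cong (λ u → G q (y + w) y * G q u x) (m+n∸m≡n y w) ⟩
      G q (y + w) y * G q w x
        ≡⟨ cong (G q (y + w) y *_) (G-zero w x w<x) ⟩
      G q (y + w) y * 0
        ≡⟨ *-zeroʳ (G q (y + w) y) ⟩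
      0 ∎
      where
      w<x : w < x
      w<x = +-cancelˡ-< y w x (subst (y + w <_) (+-comm x y) (≰⇒> ¬p))

  -- The q-Vandermonde sum, by induction on `a` through the defining recursion. The truncated
  -- `a ∸ δ` is faithful wherever `G q a δ` is non-zero; in the inductive step the powers need to be
  -- compared only for suc δ ≤ a, where (δ+γ+1) + (a-δ-1)γ = (a-δ)γ + (δ+1).
  vandermonde : ∀ a b n → G q (a + b) n ≡ Σ⁺ n (λ δ γ → q ^ ((a ∸ δ) * γ) * (G q a δ * G q b γ))
  vandermonde zero    b zero    = refl
  vandermonde zero    b (suc n) = sym (begin
    q ^ 0 * (1 * G q b (suc n)) + Σ⁺ n (λ δ γ → q ^ 0 * (0 * G q b γ))
      ≡⟨ cong (q ^ 0 * (1 * G q b (suc n)) +_) (Σ⁺-zero n λ _ _ _ → refl) ⟩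
    q ^ 0 * (1 * G q b (suc n)) + 0
      ≡⟨ aux (G q b (suc n)) ⟩
    G q b (suc n) ∎)
    where
    aux : ∀ x → 1 * (1 * x) + 0 ≡ x
    aux = solve-∀
  vandermonde (suc a) b zero    = sym (cong (λ e → q ^ e * 1) (*-zeroʳ a))
  vandermonde (suc a) b (suc n) = begin
    G q (a + b) n + q ^ suc n * G q (a + b) (suc n)
      ≡⟨ cong₂ (λ x y → x + q ^ suc n * y) (vandermonde a b n) (vandermonde a b (suc n)) ⟩
    Σ⁺ n body + q ^ suc n * (head + Σ⁺ n tail)
      ≡⟨ aux₁ (Σ⁺ n body) (q ^ suc n) head (Σ⁺ n tail) ⟩
    q ^ suc n * head + (Σ⁺ n body + q ^ suc n * Σ⁺ n tail)
      ≡⟨ cong₂ (λ x y → x + (Σ⁺ n body + y)) head-eq (sym (Σ⁺-* n (q ^ suc n) tail)) ⟩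
    q ^ (suc a * suc n) * (1 * G q b (suc n)) + (Σ⁺ n body + Σ⁺ n (λ δ γ → q ^ suc n * tail δ γ))
      ≡⟨ cong (q ^ (suc a * suc n) * (1 * G q b (suc n)) +_)
           (sym (Σ⁺-+ n body (λ δ γ → q ^ suc n * tail δ γ))) ⟩
    q ^ (suc a * suc n) * (1 * G q b (suc n)) + Σ⁺ n (λ δ γ → body δ γ + q ^ suc n * tail δ γ)
      ≡⟨ cong (q ^ (suc a * suc n) * (1 * G q b (suc n)) +_) (Σ⁺-cong n step) ⟩
    q ^ (suc a * suc n) * (1 * G q b (suc n))
      + Σ⁺ n (λ δ γ → q ^ ((a ∸ δ) * γ) * ((G q a δ + q ^ suc δ * G q a (suc δ)) * G q b γ)) ∎
    where
    body : ℕ → ℕ → ℕ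
    body δ γ = q ^ ((a ∸ δ) * γ) * (G q a δ * G q b γ)
    head = q ^ (a * suc n) * (1 * G q b (suc n))
    tail : ℕ → ℕ → ℕ
    tail δ γ = q ^ ((a ∸ suc δ) * γ) * (G q a (suc δ) * G q b γ)
    aux₁ : ∀ x r y z → x + r * (y + z) ≡ r * y + (x + r * z)
    aux₁ = solve-∀
    head-eq : q ^ suc n * head ≡ q ^ (suc a * suc n) * (1 * G q b (suc n))
    head-eq = trans (sym (*-assoc (q ^ suc n) _ _))
      (cong (_* (1 * G q b (suc n))) (sym (^-distribˡ-+-* q (suc n) (a * suc n))))
    step : ∀ δ γ → δ + γ ≡ n →
      body δ γ + q ^ suc n * tail δ γ
      ≡ q ^ ((a ∸ δ) * γ) * ((G q a δ + q ^ suc δ * G q a (suc δ)) * G q b γ)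
    step δ γ refl with G-split a (suc δ)
    ... | inj₂ e rewrite e = aux (q ^ ((a ∸ δ) * γ)) (G q a δ) (G q b γ)
                                 (q ^ suc n) (q ^ ((a ∸ suc δ) * γ)) (q ^ suc δ)
      where
      aux : ∀ x y z u v w → x * (y * z) + u * (v * (0 * z)) ≡ x * ((y + w * 0) * z)
      aux = solve-∀
    ... | inj₁ (c , refl) = begin
      x * (y * z) + q ^ suc (δ + γ) * (q ^ ((suc δ + c ∸ suc δ) * γ) * (w * z))
        ≡⟨ cong (x * (y * z) +_) (sym (*-assoc (q ^ suc (δ + γ)) _ _)) ⟩
      x * (y * z) + q ^ suc (δ + γ) * q ^ ((suc δ + c ∸ suc δ) * γ) * (w * z)
        ≡⟨ cong (λ u → x * (y * z) + u * (w * z)) powers ⟩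
      x * (y * z) + x * q ^ suc δ * (w * z)
        ≡⟨ aux x y z (q ^ suc δ) w ⟩
      x * ((y + q ^ suc δ * w) * z) ∎
      where
      x = q ^ ((a ∸ δ) * γ)
      y = G q a δ
      z = G q b γ
      w = G q a (suc δ)
      aux : ∀ x y z r w → x * (y * z) + x * r * (w * z) ≡ x * ((y + r * w) * z)
      aux = solve-∀
      exponents : ∀ δ γ c → suc (δ + γ) + c * γ ≡ suc c * γ + suc δ
      exponents = solve-∀
      powers : q ^ suc (δ + γ) * q ^ ((suc δ + c ∸ suc δ) * γ) ≡ x * q ^ suc δ
      powers = begin
        q ^ suc (δ + γ) * q ^ ((suc δ + c ∸ suc δ) * γ)
          ≡⟨ cong (λ u → q ^ suc (δ + γ) * q ^ (u * γ)) (m+n∸m≡n (suc δ) c) ⟩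
        q ^ suc (δ + γ) * q ^ (c * γ)
          ≡⟨ ^-distribˡ-+-* q (suc (δ + γ)) (c * γ) ⟨
        q ^ (suc (δ + γ) + c * γ)
          ≡⟨ cong (q ^_) (exponents δ γ c) ⟩
        q ^ (suc c * γ + suc δ)
          ≡⟨ ^-distribˡ-+-* q (suc c * γ) (suc δ) ⟩
        q ^ (suc c * γ) * q ^ suc δ
          ≡⟨ cong (λ u → q ^ (u * γ) * q ^ suc δ)
               (trans (cong (_∸ δ) (sym (+-suc δ c))) (m+n∸m≡n δ (suc c))) ⟨
        x * q ^ suc δ ∎

  vandermonde′ : ∀ a b n → G q (a + b) n ≡ Σ⁺ n (λ γ δ → q ^ (δ * (b ∸ γ)) * (G q a δ * G q b γ))
  vandermonde′ a b n = begin
    G q (a + b) n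
      ≡⟨ cong (λ x → G q x n) (+-comm a b) ⟩
    G q (b + a) n
      ≡⟨ vandermonde b a n ⟩
    Σ⁺ n (λ γ δ → q ^ ((b ∸ γ) * δ) * (G q b γ * G q a δ))
      ≡⟨ Σ⁺-cong n (λ γ δ _ → cong₂ (λ x y → q ^ x * y)
           (*-comm (b ∸ γ) δ) (*-comm (G q b γ) (G q a δ))) ⟩
    Σ⁺ n (λ γ δ → q ^ (δ * (b ∸ γ)) * (G q a δ * G q b γ)) ∎

  -- Expanding the last factor by q-Vandermonde leaves two further q-Vandermonde sums.
  saalschütz : ∀ i n f b → G q i n * G q (i + f) (f + b)
    ≡ Σ⁺ n (λ γ δ → q ^ ((b ∸ δ) * γ) * (G q b δ * (G q (n + f) γ * G q (i + f + δ) (n + f + b))))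
  saalschütz i n f b = sym (begin
    Σ⁺ n (λ γ δ → q ^ ((b ∸ δ) * γ) * (G q b δ * (G q (n + f) γ * G q (i + f + δ) (n + f + b))))
      ≡⟨ Σ⁺-cong n expand ⟩
    Σ⁺ n (λ γ δ → Σ⁺ δ (λ ε k → term γ ε k))
      ≡⟨ Σ⁺-assoc n term ⟩
    Σ⁺ n (λ w k → Σ⁺ w (λ γ ε → term γ ε k))
      ≡⟨ Σ⁺-cong n inner ⟩
    Σ⁺ n (λ w k → G q (i + f) (f + b) * (q ^ ((b ∸ k) * w) * (G q b k * G q (i ∸ b) w)))
      ≡⟨ Σ⁺-* n (G q (i + f) (f + b)) _ ⟩
    G q (i + f) (f + b) * Σ⁺ n (λ w k → q ^ ((b ∸ k) * w) * (G q b k * G q (i ∸ b) w))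
      ≡⟨ cong (G q (i + f) (f + b) *_) (Σ⁺-swap n (λ w k → q ^ ((b ∸ k) * w) * (G q b k * G q (i ∸ b) w))) ⟩
    G q (i + f) (f + b) * Σ⁺ n (λ k w → q ^ ((b ∸ k) * w) * (G q b k * G q (i ∸ b) w))
      ≡⟨ cong (G q (i + f) (f + b) *_) (vandermonde b (i ∸ b) n) ⟨
    G q (i + f) (f + b) * G q (b + (i ∸ b)) n
      ≡⟨ finish ⟩
    G q i n * G q (i + f) (f + b) ∎)
    where
    term : ℕ → ℕ → ℕ → ℕ
    term γ ε k = q ^ ((b ∸ (k + ε)) * γ) * (G q b (k + ε) * (G q (n + f) γ *
      (q ^ (ε * (ε + (γ + f + b))) * (G q (k + ε) k * G q (i + f) (ε + (γ + f + b))))))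

    -- For b > i the sum `b + (i ∸ b)` is b and not i, but then the common factor
    -- `G q (i + f) (f + b)` is zero.
    finish : G q (i + f) (f + b) * G q (b + (i ∸ b)) n ≡ G q i n * G q (i + f) (f + b)
    finish with b ≤? i
    ... | yes p = trans (cong (λ x → G q (i + f) (f + b) * G q x n) (m+[n∸m]≡n p))
                        (*-comm (G q (i + f) (f + b)) _)
    ... | no ¬p = trans (cong (_* G q (b + (i ∸ b)) n) e)
                        (sym (trans (cong (G q i n *_) e) (*-zeroʳ (G q i n))))
      where
      e : G q (i + f) (f + b) ≡ 0
      e = G-zero (i + f) (f + b) (subst (_< f + b) (+-comm f i) (+-monoʳ-< f (≰⇒> ¬p)))

    expand : ∀ γ δ → γ + δ ≡ n →
      q ^ ((b ∸ δ) * γ) * (G q b δ * (G q (n + f) γ * G q (i + f + δ) (n + f + b)))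
      ≡ Σ⁺ δ (λ ε k → term γ ε k)
    expand γ δ refl = begin
      x * (y * (z * G q (i + f + δ) (γ + δ + f + b)))
        ≡⟨ cong₂ (λ u v → x * (y * (z * G q u v))) (+-comm (i + f) δ) (aux γ δ f b) ⟩
      x * (y * (z * G q (δ + (i + f)) (δ + (γ + f + b))))
        -- A block of size δ supplies at most δ to the lower index, so the range shrinks to k ≤ δ,
        -- and with ε = δ - k the other part of the lower index is ε + (γ + f + b).
        ≡⟨ cong (λ u → x * (y * (z * u))) (trans (vandermonde δ (i + f) (δ + (γ + f + b)))
             (Σ⁺-cut δ (γ + f + b) _ λ k l p → trans
               (cong (λ u → q ^ ((δ ∸ k) * l) * (u * G q (i + f) l)) (G-zero δ k p))
               (*-zeroʳ (q ^ ((δ ∸ k) * l))))) ⟩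
      x * (y * (z * Σ⁺ δ s))
        ≡⟨ cong (λ u → x * (y * u)) (Σ⁺-* δ z s) ⟨
      x * (y * Σ⁺ δ (λ k ε → z * s k ε))
        ≡⟨ cong (x *_) (Σ⁺-* δ y (λ k ε → z * s k ε)) ⟨
      x * Σ⁺ δ (λ k ε → y * (z * s k ε))
        ≡⟨ Σ⁺-* δ x (λ k ε → y * (z * s k ε)) ⟨
      Σ⁺ δ (λ k ε → x * (y * (z * s k ε)))
        ≡⟨ Σ⁺-cong δ (λ { k ε refl → cong
             (λ u → x * (y * (z * (q ^ (u * (ε + (γ + f + b))) * (G q (k + ε) k * G q (i + f) (ε + (γ + f + b)))))))
             (m+n∸m≡n k ε) }) ⟩
      Σ⁺ δ (λ k ε → term γ ε k)
        ≡⟨ Σ⁺-swap δ (λ k ε → term γ ε k) ⟩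
      Σ⁺ δ (λ ε k → term γ ε k) ∎
      where
      x = q ^ ((b ∸ δ) * γ)
      y = G q b δ
      z = G q (γ + δ + f) γ
      s : ℕ → ℕ → ℕ
      s k ε = q ^ ((δ ∸ k) * (ε + (γ + f + b))) * (G q δ k * G q (i + f) (ε + (γ + f + b)))
      aux : ∀ γ δ f b → γ + δ + f + b ≡ δ + (γ + f + b)
      aux = solve-∀

    revise : ∀ k ε → G q b (k + ε) * G q (k + ε) k ≡ G q b k * G q (b ∸ k) ε
    revise k ε = trans (cong (G q b (k + ε) *_) (G-sym k ε))
      (trans (cong (λ u → G q b u * G q u ε) (+-comm k ε)) (G-trinomial b ε k))

    rest : ℕ → ℕ → ℕ → ℕ
    rest k γ ε = q ^ ((b ∸ (k + ε)) * γ) * G q (n + f) γ * q ^ (ε * (ε + (γ + f + b)))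
                 * G q (i + f) (ε + (γ + f + b))

    split : ∀ k γ ε → term γ ε k ≡ G q b k * G q (b ∸ k) ε * rest k γ ε
    split k γ ε = trans
      (aux (q ^ ((b ∸ (k + ε)) * γ)) (G q b (k + ε)) (G q (n + f) γ)
           (q ^ (ε * (ε + (γ + f + b)))) (G q (k + ε) k) (G q (i + f) (ε + (γ + f + b))))
      (cong (_* rest k γ ε) (revise k ε))
      where
      aux : ∀ x y z u v w → x * (y * (z * (u * (v * w)))) ≡ (y * v) * (x * z * u * w)
      aux = solve-∀

    -- For fixed k, trinomial revision turns the two factors with k + ε into `G q b k` and [β, ε]
    -- with β = b - k. The exponent splits into βw, which is constant, and ε(n + f - γ), which is
    -- the weight of `vandermonde′`. Its value [w + f + b, w] is absorbed by one more trinomial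
    -- revision.
    inner : ∀ w k → w + k ≡ n → Σ⁺ w (λ γ ε → term γ ε k)
      ≡ G q (i + f) (f + b) * (q ^ ((b ∸ k) * w) * (G q b k * G q (i ∸ b) w))
    inner w k refl with G-split b k
    ... | inj₂ e = trans (Σ⁺-zero w λ γ ε _ → trans (split k γ ε) (cong (_* rest k γ ε) (cong (_* G q (b ∸ k) ε) e)))
      (sym (trans (cong (λ u → G q (i + f) (f + b) * (q ^ ((b ∸ k) * w) * (u * G q (i ∸ b) w))) e)
                  (aux₂ (G q (i + f) (f + b)) (q ^ ((b ∸ k) * w)))))
      where
      aux₂ : ∀ x y → x * (y * 0) ≡ 0
      aux₂ = solve-∀
    ... | inj₁ (β , refl) = begin
      Σ⁺ w (λ γ ε → term γ ε k)
        ≡⟨ Σ⁺-cong w collect ⟩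
      Σ⁺ w (λ γ ε → c * (q ^ (ε * (w + k + f ∸ γ)) * (G q β ε * G q (w + k + f) γ)))
        ≡⟨ Σ⁺-* w c _ ⟩
      c * Σ⁺ w (λ γ ε → q ^ (ε * (w + k + f ∸ γ)) * (G q β ε * G q (w + k + f) γ))
        ≡⟨ cong (c *_) (vandermonde′ β (w + k + f) w) ⟨
      c * G q (β + (w + k + f)) w
        ≡⟨ cong (λ u → c * G q u w) (aux₁ β w k f) ⟩
      c * G q (w + (f + b)) w
        ≡⟨ aux₂ (G q (i + f) (w + (f + b))) (q ^ (β * w)) (G q b k) (G q (w + (f + b)) w) ⟩
      G q (i + f) (w + (f + b)) * G q (w + (f + b)) w * (q ^ (β * w) * G q b k)
        ≡⟨ cong (_* (q ^ (β * w) * G q b k)) (G-trinomial (i + f) w (f + b)) ⟩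
      G q (i + f) (f + b) * G q (i + f ∸ (f + b)) w * (q ^ (β * w) * G q b k)
        ≡⟨ cong₂ (λ u v → G q (i + f) (f + b) * G q u w * (q ^ (v * w) * G q b k))
             i+f∸ (sym (m+n∸m≡n k β)) ⟩
      G q (i + f) (f + b) * G q (i ∸ b) w * (q ^ ((b ∸ k) * w) * G q b k)
        ≡⟨ aux₃ (G q (i + f) (f + b)) (G q (i ∸ b) w) (q ^ ((b ∸ k) * w)) (G q b k) ⟩
      G q (i + f) (f + b) * (q ^ ((b ∸ k) * w) * (G q b k * G q (i ∸ b) w)) ∎
      where
      c = G q (i + f) (w + (f + b)) * (q ^ (β * w) * G q b k)
      aux₁ : ∀ β w k f → β + (w + k + f) ≡ w + (f + (k + β))
      aux₁ = solve-∀
      aux₂ : ∀ x y z u → x * (y * z) * u ≡ x * u * (y * z)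
      aux₂ = solve-∀
      aux₃ : ∀ x y z u → x * y * (z * u) ≡ x * (z * (u * y))
      aux₃ = solve-∀
      i+f∸ : i + f ∸ (f + b) ≡ i ∸ b
      i+f∸ = trans (cong (_∸ (f + b)) (+-comm i f)) ([m+n]∸[m+o]≡n∸o f i b)
      collect : ∀ γ ε → γ + ε ≡ w →
        term γ ε k ≡ c * (q ^ (ε * (w + k + f ∸ γ)) * (G q β ε * G q (w + k + f) γ))
      collect γ ε refl with G-split β ε
      ... | inj₂ e = trans (split k γ ε)
        (trans (cong (λ u → G q b k * u * rest k γ ε) (trans (cong (λ u → G q u ε) (m+n∸m≡n k β)) e))
        (sym (trans (cong (λ u → c * (q ^ (ε * (w + k + f ∸ γ)) * (u * G q (w + k + f) γ))) e)
                    (aux c (q ^ (ε * (w + k + f ∸ γ))) (G q b k) (rest k γ ε)))))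
        where
        aux : ∀ x y z u → x * (y * 0) ≡ z * 0 * u
        aux = solve-∀
      ... | inj₁ (η , refl) = begin
        term γ ε k
          ≡⟨ split k γ ε ⟩
        G q b k * G q (b ∸ k) ε * rest k γ ε
          ≡⟨ cong₂ (λ u v → G q b k * G q u ε * (q ^ (v * γ) * z * q ^ (ε * (ε + (γ + f + b))) * G q (i + f) (ε + (γ + f + b))))
               (m+n∸m≡n k β) η∸ ⟩
        G q b k * G q β ε * (q ^ (η * γ) * z * q ^ (ε * (ε + (γ + f + b))) * G q (i + f) (ε + (γ + f + b)))
          ≡⟨ aux₄ (G q b k) (G q β ε) (q ^ (η * γ)) z (q ^ (ε * (ε + (γ + f + b)))) _ ⟩
        G q b k * G q β ε * z * G q (i + f) (ε + (γ + f + b)) * (q ^ (η * γ) * q ^ (ε * (ε + (γ + f + b))))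
          ≡⟨ cong₂ (λ u v → G q b k * G q β ε * z * G q (i + f) u * v) (aux₇ γ ε f b) powers ⟩
        G q b k * G q β ε * z * G q (i + f) (w + (f + b)) * (q ^ (β * w) * q ^ (ε * (w + k + f ∸ γ)))
          ≡⟨ aux₅ (G q b k) (G q β ε) z (G q (i + f) (w + (f + b))) (q ^ (β * w)) _ ⟩
        c * (q ^ (ε * (w + k + f ∸ γ)) * (G q β ε * G q (w + k + f) γ)) ∎
        where
        z = G q (w + k + f) γ
        η∸ : b ∸ (k + ε) ≡ η
        η∸ = trans (cong (_∸ (k + ε)) (sym (+-assoc k ε η))) (m+n∸m≡n (k + ε) η)
        aux₄ : ∀ x y u z v t → x * y * (u * z * v * t) ≡ x * y * z * t * (u * v)
        aux₄ = solve-∀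
        aux₅ : ∀ x y z t u v → x * y * z * t * (u * v) ≡ t * (u * x) * (v * (y * z))
        aux₅ = solve-∀
        aux₆ : ∀ γ ε k f → γ + ε + k + f ≡ γ + (ε + k + f)
        aux₆ = solve-∀
        aux₇ : ∀ γ ε f b → ε + (γ + f + b) ≡ γ + ε + (f + b)
        aux₇ = solve-∀
        exponents : ∀ η γ ε f k → η * γ + ε * (ε + (γ + f + (k + (ε + η))))
          ≡ (ε + η) * (γ + ε) + ε * (ε + k + f)
        exponents = solve-∀
        powers : q ^ (η * γ) * q ^ (ε * (ε + (γ + f + b))) ≡ q ^ (β * w) * q ^ (ε * (w + k + f ∸ γ))
        powers = begin
          q ^ (η * γ) * q ^ (ε * (ε + (γ + f + b)))
            ≡⟨ ^-distribˡ-+-* q (η * γ) _ ⟨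
          q ^ (η * γ + ε * (ε + (γ + f + b)))
            ≡⟨ cong (q ^_) (exponents η γ ε f k) ⟩
          q ^ (β * w + ε * (ε + k + f))
            ≡⟨ ^-distribˡ-+-* q (β * w) _ ⟩
          q ^ (β * w) * q ^ (ε * (ε + k + f))
            ≡⟨ cong (λ u → q ^ (β * w) * q ^ (ε * u))
                 (trans (cong (_∸ γ) (aux₆ γ ε k f)) (m+n∸m≡n γ _)) ⟨
          q ^ (β * w) * q ^ (ε * (w + k + f ∸ γ)) ∎

-- Refined q-trinomial coefficients

Σ⁺-exchange : ∀ m n (f : ℕ → ℕ → ℕ → ℕ → ℕ) →
  Σ⁺ m (λ i j → Σ⁺ n (λ k l → f i j k l)) ≡ Σ⁺ n (λ k l → Σ⁺ m (λ i j → f i j k l))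
Σ⁺-exchange zero    n f = refl
Σ⁺-exchange (suc m) n f = trans (cong (Σ⁺ n (f 0 (suc m)) +_) (Σ⁺-exchange m n λ i → f (suc i)))
                                (sym (Σ⁺-+ n (f 0 (suc m)) _))

-- The sum runs over i + γ + δ + 2r = n. As `F` vanishes for i < γ, the index i may be replaced by γ
-- + i, which changes the constraint to δ + i + 2(r + γ) = n; r and γ then enter it only through c =
-- r + γ.
Σ⁺Σ²-regroup : ∀ n (F : ℕ → ℕ → ℕ → ℕ → ℕ) → (∀ i γ δ r → i < γ → F i γ δ r ≡ 0) →
  Σ⁺ n (λ i w → Σ² w (λ m r → Σ⁺ m (λ γ δ → F i γ δ r)))
    ≡ Σ² n (λ m c → Σ⁺ m (λ δ i → Σ⁺ c (λ r γ → F (γ + i) γ δ r)))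
Σ⁺Σ²-regroup n F z = begin
  Σ⁺ n (λ i w → Σ² w (λ m r → Σ⁺ m (λ γ δ → F i γ δ r)))
    ≡⟨ Σ⁺Σ² n (λ i m r → Σ⁺ m (λ γ δ → F i γ δ r)) ⟩
  Σ² n (λ m r → Σ⁺ m (λ i k → Σ⁺ k (λ γ δ → F i γ δ r)))
    ≡⟨ Σ²-cong n (λ m r _ → trans (Σ⁺-assoc m (λ i γ δ → F i γ δ r))
         (trans (Σ⁺-cong m λ k δ _ → Σ⁺-fold k (λ i γ → F i γ δ r) λ i γ _ → z i γ δ r)
         (trans (Σ⁺-swap m (λ k δ → Σ² k (λ i γ → F (γ + i) γ δ r)))
                (Σ⁺Σ² m (λ δ i γ → F (γ + i) γ δ r))))) ⟩
  Σ² n (λ m r → Σ² m (λ k γ → Σ⁺ k (λ δ i → F (γ + i) γ δ r)))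
    ≡⟨ Σ²Σ² n (λ k r γ → Σ⁺ k (λ δ i → F (γ + i) γ δ r)) ⟩
  Σ² n (λ k c → Σ⁺ c (λ r γ → Σ⁺ k (λ δ i → F (γ + i) γ δ r)))
    ≡⟨ Σ²-cong n (λ k c _ → Σ⁺-exchange c k (λ r γ δ i → F (γ + i) γ δ r)) ⟩
  Σ² n (λ k c → Σ⁺ k (λ δ i → Σ⁺ c (λ r γ → F (γ + i) γ δ r))) ∎

module Trinomial (h : ℕ) where

  p : ℕ
  p = h ^ 2

  open Gaussian p

  p^ : ∀ n → p ^ n ≡ h ^ (2 * n)
  p^ n = ^-*-assoc h 2 n

  -- With a = b + d and r = (L - a - n)/2, the last two factors are [M+b+r, M+b] and [M-b+r+a, M-b].
  -- The complementary lower indices avoid the difference M - b.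
  trinomialTerm : ℕ → ℕ → ℕ → ℕ → ℕ → ℕ
  trinomialTerm M d b n r = h ^ (n * n) * (G p M n * (G p (M + b + r) r * G p (M + (r + d)) (r + d + b)))

  -- Warnaar's refined q-trinomial coefficient T(L,M,b+d,b) with base h², for b, d ≥ 0.
  T : ℕ → ℕ → ℕ → ℕ → ℕ
  T L M d b = shift (b + d) L (λ k → Σ² k (trinomialTerm M d b))

  -- The argument of φ is the first parameter L - i of the trinomial, recovered as n + 2r + a from
  -- the range of its defining sum.
  initial : (ℕ → ℕ) → ℕ → ℕ → ℕ → ℕ → ℕ → ℕ
  initial φ d b i n r = h ^ (i * i) * (φ (n + 2 * r + (b + d)) * trinomialTerm i d b n r)

  summand₂ : (ℕ → ℕ) → ℕ → ℕ → ℕ → ℕ → ℕ → ℕ → ℕ → ℕ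
  summand₂ φ d b c δ i r γ = p ^ ((c + i + b ∸ r) * γ) * (G p (c + i + b) r
    * (G p (c + (δ + d)) γ * φ (c + δ + (b + d) + r)))

  summand₃ : (ℕ → ℕ → ℕ → ℕ) → ℕ → ℕ → ℕ → ℕ → ℕ → ℕ → ℕ
  summand₃ Ψ d b n c γ δ = p ^ ((b ∸ δ) * γ) * (G p b δ
    * (G p (n + (c + (b + d))) γ * Ψ c δ (b + γ)))

  -- φ is the factor in which T-transform and its limit differ; it becomes Ψ after the summation
  -- over r, where r + γ = c, and Ω after the summation over δ, where γ + δ = n.
  module _ (d b Λ : ℕ) (φ : ℕ → ℕ) (Ψ : ℕ → ℕ → ℕ → ℕ) (Ω : ℕ → ℕ → ℕ)
    (sum₂ : ∀ c δ i → δ + i + 2 * c ≡ Λ →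
      Σ⁺ c (λ r γ → summand₂ φ d b c δ i r γ) ≡ Ψ c δ i)
    (sum₃ : ∀ n c → b + n + 2 * c ≡ Λ →
      Σ⁺ n (λ γ δ → summand₃ Ψ d b n c γ δ) ≡ Ω n c)
    where

    private
      F₀ F : ℕ → ℕ → ℕ → ℕ → ℕ
      F₀ i γ δ r = h ^ (i * i + (γ + δ) * (γ + δ)) * (φ (γ + δ + 2 * r + (b + d)) * G p (i + b + r) r)
      F i γ δ r = F₀ i γ δ r
        * (p ^ ((b ∸ δ) * γ) * (G p b δ * (G p (γ + δ + (r + d)) γ
        * G p (i + (r + d) + δ) (γ + δ + (r + d) + b))))

      -- This is the vanishing that permits the substitution of γ + i for i in `Σ⁺Σ²-regroup`.
      F-zero : ∀ i γ δ r → i < γ → F i γ δ r ≡ 0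
      F-zero i γ δ r i<γ = trans
        (cong (λ u → F₀ i γ δ r
                     * (p ^ ((b ∸ δ) * γ) * (G p b δ * (G p (γ + δ + (r + d)) γ * u))))
              (G-zero (i + (r + d) + δ) (γ + δ + (r + d) + b) lt))
        (aux (F₀ i γ δ r)
             (p ^ ((b ∸ δ) * γ)) (G p b δ) (G p (γ + δ + (r + d)) γ))
        where
        aux : ∀ x y z u → x * (y * (z * (u * 0))) ≡ 0
        aux = solve-∀
        aux₂ : ∀ γ δ r d b → γ + δ + (r + d) + b ≡ γ + (r + d) + δ + b
        aux₂ = solve-∀
        lt : i + (r + d) + δ < γ + δ + (r + d) + b
        lt = subst (i + (r + d) + δ <_) (sym (aux₂ γ δ r d b))
          (m≤n⇒m≤n+o b (+-monoˡ-< δ (+-monoˡ-< (r + d) i<γ)))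

      -- The first of the three summations, read backwards: Saalschütz opens the pair `G p i n`,
      -- `G p (i + (r + d)) (r + d + b)` and splits n into γ + δ.
      F-expand : ∀ i n r →
        initial φ d b i n r
        ≡ Σ⁺ n (λ γ δ → F i γ δ r)
      F-expand i n r = begin
        h ^ (i * i) * (φx * (h ^ (n * n) * (G p i n * (g * G p (i + (r + d)) (r + d + b)))))
          ≡⟨ aux (h ^ (i * i)) φx (h ^ (n * n)) (G p i n) g _ ⟩
        h ^ (i * i) * h ^ (n * n) * (φx * g) * (G p i n * G p (i + (r + d)) (r + d + b))
          ≡⟨ cong₂ (λ u v → u * (φx * g) * v) (sym (^-distribˡ-+-* h (i * i) (n * n)))
               (saalschütz i n (r + d) b) ⟩
        h ^ (i * i + n * n) * (φx * g) * Σ⁺ n (λ γ δ → p ^ ((b ∸ δ) * γ) * (G p b δ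
          * (G p (n + (r + d)) γ * G p (i + (r + d) + δ) (n + (r + d) + b))))
          ≡⟨ Σ⁺-* n (h ^ (i * i + n * n) * (φx * g)) _ ⟨
        Σ⁺ n (λ γ δ → h ^ (i * i + n * n) * (φx * g) * (p ^ ((b ∸ δ) * γ) * (G p b δ
          * (G p (n + (r + d)) γ * G p (i + (r + d) + δ) (n + (r + d) + b)))))
          ≡⟨ Σ⁺-cong n (λ { γ δ refl → refl }) ⟩
        Σ⁺ n (λ γ δ → F i γ δ r) ∎
        where
        φx = φ (n + 2 * r + (b + d))
        g = G p (i + b + r) r
        aux : ∀ x y z u v w → x * (y * (z * (u * (v * w)))) ≡ x * z * (y * v) * (u * w)
        aux = solve-∀

      H : ℕ → ℕ → ℕ → ℕ
      H c δ i = h ^ (i * i + δ * δ) * (G p b δ * G p (c + i + d + δ) (c + δ + d + b))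

      -- After i becomes γ + i, the factors collected in `H` depend on r and γ only through c = r +
      -- γ. Completing squares separates the powers: (γ+i)² + (γ+δ)² + 2(b-δ)γ = i² + δ² +
      -- 2(γ+i+b)γ, where γ + i + b = c + i + b - r is the exponent in `summand₂`.
      H-sum : ∀ c δ i → δ + i + 2 * c ≡ Λ → Σ⁺ c (λ r γ → F (γ + i) γ δ r) ≡ H c δ i * Ψ c δ i
      H-sum c δ i e = begin
        Σ⁺ c (λ r γ → F (γ + i) γ δ r)
          ≡⟨ Σ⁺-cong c collect ⟩
        Σ⁺ c (λ r γ → H c δ i * (summand₂ φ d b c δ i r γ))
          ≡⟨ Σ⁺-* c (H c δ i) _ ⟩
        H c δ i * Σ⁺ c (λ r γ → summand₂ φ d b c δ i r γ)
          ≡⟨ cong (H c δ i *_) (sum₂ c δ i e) ⟩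
        H c δ i * Ψ c δ i ∎
        where
        collect : ∀ r γ → r + γ ≡ c → F (γ + i) γ δ r ≡
          H c δ i * (summand₂ φ d b c δ i r γ)
        collect r γ refl with G-split b δ
        ... | inj₂ z = trans
            (cong (λ u → h ^ ((γ + i) * (γ + i) + (γ + δ) * (γ + δ))
               * (φ (γ + δ + 2 * r + (b + d)) * G p (γ + i + b + r) r)
               * (p ^ ((b ∸ δ) * γ) * (u * (G p (γ + δ + (r + d)) γ
               * G p (γ + i + (r + d) + δ) (γ + δ + (r + d) + b))))) z)
            (trans (aux₁ (h ^ ((γ + i) * (γ + i) + (γ + δ) * (γ + δ))
               * (φ (γ + δ + 2 * r + (b + d)) * G p (γ + i + b + r) r)) (p ^ ((b ∸ δ) * γ))
               (h ^ (i * i + δ * δ)) rest)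
            (sym (cong (λ u → h ^ (i * i + δ * δ) * (u * G p (c + i + d + δ) (c + δ + d + b)) * rest) z)))
          where
          rest = summand₂ φ d b c δ i r γ
          aux₁ : ∀ x y z u → x * (y * 0) ≡ z * 0 * u
          aux₁ = solve-∀
        ... | inj₁ (β , refl) = begin
          h ^ ((γ + i) * (γ + i) + (γ + δ) * (γ + δ))
            * (φ (γ + δ + 2 * r + (b + d)) * G p (γ + i + b + r) r)
            * (p ^ ((b ∸ δ) * γ) * (G p b δ * (G p (γ + δ + (r + d)) γ
            * G p (γ + i + (r + d) + δ) (γ + δ + (r + d) + b))))
            ≡⟨ aux₁ (h ^ ((γ + i) * (γ + i) + (γ + δ) * (γ + δ)))
                 (φ (γ + δ + 2 * r + (b + d))) (G p (γ + i + b + r) r) (p ^ ((b ∸ δ) * γ))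
                 (G p b δ) (G p (γ + δ + (r + d)) γ) (G p (γ + i + (r + d) + δ) (γ + δ + (r + d) + b)) ⟩
          (h ^ ((γ + i) * (γ + i) + (γ + δ) * (γ + δ)) * p ^ ((b ∸ δ) * γ))
            * (G p b δ * G p (γ + i + (r + d) + δ) (γ + δ + (r + d) + b)
               * (G p (γ + i + b + r) r * (G p (γ + δ + (r + d)) γ * φ (γ + δ + 2 * r + (b + d)))))
            ≡⟨ cong₂ _*_ powers (cong₂ _*_ (cong (G p b δ *_) (cong₂ (G p) (e₁ r γ i d δ) (e₂ r γ d b δ)))
                 (cong₂ _*_ (cong (λ u → G p u r) (e₃ r γ i b))
                   (cong₂ (λ u v → G p u γ * φ v) (e₄ r γ d δ) (e₅ r γ d δ b)))) ⟩
          (h ^ (i * i + δ * δ) * p ^ ((c + i + b ∸ r) * γ))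
            * (G p b δ * G p (c + i + d + δ) (c + δ + d + b)
               * (G p (c + i + b) r * (G p (c + (δ + d)) γ * φ (c + δ + (b + d) + r))))
            ≡⟨ aux₂ (h ^ (i * i + δ * δ)) (p ^ ((c + i + b ∸ r) * γ)) (G p b δ) _ _ ⟩
          H c δ i * (summand₂ φ d b c δ i r γ) ∎
          where
          aux₁ : ∀ a b c d e f g →
            a * (b * c) * (d * (e * (f * g))) ≡ a * d * (e * g * (c * (f * b)))
          aux₁ = solve-∀
          aux₂ : ∀ a b c d e → a * b * (c * d * e) ≡ a * (c * d) * (b * e)
          aux₂ = solve-∀
          e₁ : ∀ r γ i d δ → γ + i + (r + d) + δ ≡ r + γ + i + d + δ
          e₁ = solve-∀
          e₂ : ∀ r γ d b δ → γ + δ + (r + d) + b ≡ r + γ + δ + d + b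
          e₂ = solve-∀
          e₃ : ∀ r γ i b → γ + i + b + r ≡ r + γ + i + b
          e₃ = solve-∀
          e₄ : ∀ r γ d δ → γ + δ + (r + d) ≡ r + γ + (δ + d)
          e₄ = solve-∀
          e₅ : ∀ r γ d δ b → γ + δ + 2 * r + (b + d) ≡ r + γ + δ + (b + d) + r
          e₅ = solve-∀
          e₆ : ∀ r γ i b → r + γ + i + b ≡ r + (γ + i + b)
          e₆ = solve-∀
          exponents : ∀ γ i δ β → (γ + i) * (γ + i) + (γ + δ) * (γ + δ) + 2 * (β * γ)
            ≡ i * i + δ * δ + 2 * ((γ + i + (δ + β)) * γ)
          exponents = solve-∀
          powers : h ^ ((γ + i) * (γ + i) + (γ + δ) * (γ + δ)) * p ^ ((b ∸ δ) * γ)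
            ≡ h ^ (i * i + δ * δ) * p ^ ((c + i + b ∸ r) * γ)
          powers = begin
            h ^ ((γ + i) * (γ + i) + (γ + δ) * (γ + δ)) * p ^ ((b ∸ δ) * γ)
              ≡⟨ cong (h ^ ((γ + i) * (γ + i) + (γ + δ) * (γ + δ)) *_) (trans (cong (λ u → p ^ (u * γ)) (m+n∸m≡n δ β)) (p^ (β * γ))) ⟩
            h ^ ((γ + i) * (γ + i) + (γ + δ) * (γ + δ)) * h ^ (2 * (β * γ))
              ≡⟨ ^-distribˡ-+-* h ((γ + i) * (γ + i) + (γ + δ) * (γ + δ)) _ ⟨
            h ^ ((γ + i) * (γ + i) + (γ + δ) * (γ + δ) + 2 * (β * γ))
              ≡⟨ cong (h ^_) (exponents γ i δ β) ⟩
            h ^ (i * i + δ * δ + 2 * ((γ + i + b) * γ))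
              ≡⟨ ^-distribˡ-+-* h (i * i + δ * δ) _ ⟩
            h ^ (i * i + δ * δ) * h ^ (2 * ((γ + i + b) * γ))
              ≡⟨ cong (h ^ (i * i + δ * δ) *_) (trans (cong (λ u → p ^ (u * γ))
                   (trans (cong (_∸ r) (e₆ r γ i b)) (m+n∸m≡n r _))) (p^ ((γ + i + b) * γ))) ⟨
            h ^ (i * i + δ * δ) * p ^ ((c + i + b ∸ r) * γ) ∎

      H-zero : ∀ c i δ → i < b → H c δ i * Ψ c δ i ≡ 0
      H-zero c i δ i<b = trans
        (cong (λ u → h ^ (i * i + δ * δ) * (G p b δ * u) * Ψ c δ i)
              (G-zero (c + i + d + δ) (c + δ + d + b) lt))
        (aux₁ (h ^ (i * i + δ * δ)) (G p b δ) (Ψ c δ i))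
        where
        aux₁ : ∀ x y z → x * (y * 0) * z ≡ 0
        aux₁ = solve-∀
        aux₂ : ∀ c i d δ → c + δ + d + i ≡ c + i + d + δ
        aux₂ = solve-∀
        lt : c + i + d + δ < c + δ + d + b
        lt = subst (_< c + δ + d + b) (aux₂ c i d δ) (+-monoʳ-< (c + δ + d) i<b)

      -- By `H-zero` the index i starts at b. Writing i = b + γ and n = γ + δ gives i² + δ² = b² +
      -- n² + 2(b-δ)γ: this is the origin of the factor `h ^ (b * b)`, and the rest is the weight of
      -- `summand₃`.
      H-last : ∀ n c → b + n + 2 * c ≡ Λ →
        Σ⁺ n (λ γ δ → H c δ (b + γ) * Ψ c δ (b + γ)) ≡ h ^ (b * b) * (h ^ (n * n) * Ω n c)
      H-last n c e = begin
        Σ⁺ n (λ γ δ → H c δ (b + γ) * Ψ c δ (b + γ))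
          ≡⟨ Σ⁺-cong n collect ⟩
        Σ⁺ n (λ γ δ → h ^ (b * b) * h ^ (n * n) * (summand₃ Ψ d b n c γ δ))
          ≡⟨ Σ⁺-* n (h ^ (b * b) * h ^ (n * n)) _ ⟩
        h ^ (b * b) * h ^ (n * n) * Σ⁺ n (λ γ δ → summand₃ Ψ d b n c γ δ)
          ≡⟨ cong (h ^ (b * b) * h ^ (n * n) *_) (sum₃ n c e) ⟩
        h ^ (b * b) * h ^ (n * n) * Ω n c
          ≡⟨ *-assoc (h ^ (b * b)) _ _ ⟩
        h ^ (b * b) * (h ^ (n * n) * Ω n c) ∎
        where
        collect : ∀ γ δ → γ + δ ≡ n → H c δ (b + γ) * Ψ c δ (b + γ)
          ≡ h ^ (b * b) * h ^ (n * n) * (summand₃ Ψ d b n c γ δ)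
        collect γ δ refl with G-split b δ
        ... | inj₂ z = trans
            (cong (λ u → h ^ ((b + γ) * (b + γ) + δ * δ)
               * (u * G p (c + (b + γ) + d + δ) (c + δ + d + b)) * Ψ c δ (b + γ)) z)
            (trans (aux (h ^ ((b + γ) * (b + γ) + δ * δ)) _ (h ^ (b * b) * h ^ (n * n)) (p ^ ((b ∸ δ) * γ)))
            (sym (cong (λ u → h ^ (b * b) * h ^ (n * n) * (p ^ ((b ∸ δ) * γ)
               * (u * (G p (n + (c + (b + d))) γ * Ψ c δ (b + γ))))) z)))
          where
          aux : ∀ x y z u → x * 0 * y ≡ z * (u * 0)
          aux = solve-∀
        ... | inj₁ (β , refl) = begin
          h ^ ((b + γ) * (b + γ) + δ * δ)
            * (G p b δ * G p (c + (b + γ) + d + δ) (c + δ + d + b)) * Ψ c δ (b + γ)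
            ≡⟨ cong₂ (λ u v → u * (G p b δ * v) * Ψ c δ (b + γ)) powers symm ⟩
          h ^ (b * b) * h ^ (n * n) * p ^ ((b ∸ δ) * γ)
            * (G p b δ * G p (n + (c + (b + d))) γ) * Ψ c δ (b + γ)
            ≡⟨ aux (h ^ (b * b) * h ^ (n * n)) (p ^ ((b ∸ δ) * γ)) (G p b δ) _ _ ⟩
          h ^ (b * b) * h ^ (n * n) * (summand₃ Ψ d b n c γ δ) ∎
          where
          aux : ∀ x y z u v → x * y * (z * u) * v ≡ x * (y * (z * (u * v)))
          aux = solve-∀
          e₁ : ∀ c b γ d δ → c + (b + γ) + d + δ ≡ γ + (c + δ + d + b)
          e₁ = solve-∀
          e₂ : ∀ c b γ d δ → γ + (c + δ + d + b) ≡ γ + δ + (c + (b + d))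
          e₂ = solve-∀
          symm : G p (c + (b + γ) + d + δ) (c + δ + d + b) ≡ G p (n + (c + (b + d))) γ
          symm = trans (cong (λ u → G p u (c + δ + d + b)) (e₁ c b γ d δ))
            (trans (sym (G-sym γ (c + δ + d + b))) (cong (λ u → G p u γ) (e₂ c b γ d δ)))
          exponents : ∀ δ β γ → (δ + β + γ) * (δ + β + γ) + δ * δ
            ≡ (δ + β) * (δ + β) + (γ + δ) * (γ + δ) + 2 * (β * γ)
          exponents = solve-∀
          powers : h ^ ((b + γ) * (b + γ) + δ * δ) ≡ h ^ (b * b) * h ^ (n * n) * p ^ ((b ∸ δ) * γ)
          powers = begin
            h ^ ((b + γ) * (b + γ) + δ * δ)
              ≡⟨ cong (h ^_) (exponents δ β γ) ⟩
            h ^ (b * b + n * n + 2 * (β * γ))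
              ≡⟨ ^-distribˡ-+-* h (b * b + n * n) _ ⟩
            h ^ (b * b + n * n) * h ^ (2 * (β * γ))
              ≡⟨ cong₂ _*_ (^-distribˡ-+-* h (b * b) (n * n))
                   (sym (trans (cong (λ u → p ^ (u * γ)) (m+n∸m≡n δ β)) (p^ (β * γ)))) ⟩
            h ^ (b * b) * h ^ (n * n) * p ^ ((b ∸ δ) * γ) ∎

    -- The triple summation in a form common to finite M and its limit: n is opened into γ + δ, then
    -- r is summed for fixed c = r + γ, then δ for fixed γ + δ. The remaining shift by b records
    -- that i begins at b.
    transform :
      Σ⁺ Λ (λ i w → Σ² w (initial φ d b i))
        ≡ h ^ (b * b) * shift b Λ (λ k → Σ² k (λ n c → h ^ (n * n) * Ω n c))
    transform = begin
      Σ⁺ Λ (λ i w → Σ² w (initial φ d b i))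
        ≡⟨ Σ⁺-cong Λ (λ i w _ → Σ²-cong w λ n r _ → F-expand i n r) ⟩
      Σ⁺ Λ (λ i w → Σ² w (λ n r → Σ⁺ n (λ γ δ → F i γ δ r)))
        ≡⟨ Σ⁺Σ²-regroup Λ F F-zero ⟩
      Σ² Λ (λ m c → Σ⁺ m (λ δ i → Σ⁺ c (λ r γ → F (γ + i) γ δ r)))
        ≡⟨ Σ²-cong Λ (λ m c e → begin
             Σ⁺ m (λ δ i → Σ⁺ c (λ r γ → F (γ + i) γ δ r))
               ≡⟨ Σ⁺-cong m (λ δ i e′ → H-sum c δ i (trans (cong (_+ 2 * c) e′) e)) ⟩
             Σ⁺ m (λ δ i → H c δ i * Ψ c δ i)
               ≡⟨ Σ⁺-swap m (λ δ i → H c δ i * Ψ c δ i) ⟩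
             Σ⁺ m (λ i δ → H c δ i * Ψ c δ i)
               ≡⟨ Σ⁺-drop b m (λ i δ → H c δ i * Ψ c δ i) (λ i δ → H-zero c i δ) ⟩
             shift b m (λ n → Σ⁺ n (λ γ δ → H c δ (b + γ) * Ψ c δ (b + γ)))
               ≡⟨ shift-cong b m (λ n e′ → H-last n c (trans (cong (_+ 2 * c) e′) e)) ⟩
             shift b m (λ n → h ^ (b * b) * (h ^ (n * n) * Ω n c)) ∎) ⟩
      Σ² Λ (λ m c → shift b m (λ n → h ^ (b * b) * (h ^ (n * n) * Ω n c)))
        ≡⟨ Σ²-shift Λ b (λ n c → h ^ (b * b) * (h ^ (n * n) * Ω n c)) ⟩
      shift b Λ (λ k → Σ² k (λ n c → h ^ (b * b) * (h ^ (n * n) * Ω n c)))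
        ≡⟨ shift-cong b Λ (λ k _ → Σ²-* k (h ^ (b * b)) (λ n c → h ^ (n * n) * Ω n c)) ⟩
      shift b Λ (λ k → h ^ (b * b) * Σ² k (λ n c → h ^ (n * n) * Ω n c))
        ≡⟨ shift-* b Λ (h ^ (b * b)) _ ⟩
      h ^ (b * b) * shift b Λ (λ k → Σ² k (λ n c → h ^ (n * n) * Ω n c)) ∎

  -- Here l = L - i, so φ is `G p (l + M) L`. The second summation is again Saalschütz, because its
  -- lower index c + (δ+d) + (c+i+b) equals b + d + Λ = L; so is the third, with f = c + b + d. The
  -- resulting summand is that of T with d replaced by b + d.
  T-transform : ∀ L M d b →
    Σ⁺ L (λ i l → h ^ (i * i) * (G p (l + M) L * T l i d b)) ≡ h ^ (b * b) * T L M (b + d) b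
  T-transform L M d b = begin
    Σ⁺ L (λ i l → h ^ (i * i) * (G p (l + M) L * T l i d b))
      ≡⟨ Σ⁺-cong L (λ i l _ → inside i l) ⟩
    Σ⁺ L (λ i l → shift (b + d) l (λ w → Σ² w (initial φ d b i)))
      ≡⟨ Σ⁺-shiftʳ L (b + d) (λ i w → Σ² w (initial φ d b i)) ⟩
    shift (b + d) L (λ Λ → Σ⁺ Λ (λ i w → Σ² w (initial φ d b i)))
      ≡⟨ shift-cong (b + d) L (λ Λ e → transform d b Λ φ Ψ Ω (sum₂ Λ e) (sum₃ Λ)) ⟩
    shift (b + d) L (λ Λ → h ^ (b * b) * shift b Λ (λ k → Σ² k (trinomialTerm M (b + d) b)))
      ≡⟨ shift-* (b + d) L (h ^ (b * b)) _ ⟩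
    h ^ (b * b) * shift (b + d) L (λ Λ → shift b Λ (λ k → Σ² k (trinomialTerm M (b + d) b)))
      ≡⟨ cong (h ^ (b * b) *_) (trans (shift-shift (b + d) b L _)
           (cong (λ u → shift u L (λ k → Σ² k (trinomialTerm M (b + d) b))) (+-comm (b + d) b))) ⟩
    h ^ (b * b) * T L M (b + d) b ∎
    where
    φ : ℕ → ℕ
    φ x = G p (x + M) L
    Ψ : ℕ → ℕ → ℕ → ℕ
    Ψ c δ i = G p (M + b + c) c * G p (M + b + c + (δ + d)) (δ + d + (c + i + b))
    Ω : ℕ → ℕ → ℕ
    Ω n c = G p M n * (G p (M + b + c) c * G p (M + (c + (b + d))) (c + (b + d) + b))
    inside : ∀ i l → h ^ (i * i) * (G p (l + M) L * T l i d b)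
      ≡ shift (b + d) l (λ w → Σ² w (initial φ d b i))
    inside i l = begin
      h ^ (i * i) * (φ l * T l i d b)
        ≡⟨ cong (h ^ (i * i) *_) (shift-* (b + d) l (φ l) _) ⟨
      h ^ (i * i) * shift (b + d) l (λ w → φ l * Σ² w (trinomialTerm i d b))
        ≡⟨ shift-* (b + d) l (h ^ (i * i)) _ ⟨
      shift (b + d) l (λ w → h ^ (i * i) * (φ l * Σ² w (trinomialTerm i d b)))
        ≡⟨ shift-cong (b + d) l (λ w e → trans
             (cong (h ^ (i * i) *_) (sym (Σ²-* w (φ l) (trinomialTerm i d b))))
             (trans (sym (Σ²-* w (h ^ (i * i)) (λ n r → φ l * trinomialTerm i d b n r)))
             (Σ²-cong w λ n r e′ → cong (λ u → h ^ (i * i) * (φ u * trinomialTerm i d b n r))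
               (trans (sym e) (trans (+-comm (b + d) w) (cong (_+ (b + d)) (sym e′))))))) ⟩
      shift (b + d) l (λ w → Σ² w (initial φ d b i)) ∎
    sum₂ : ∀ Λ → b + d + Λ ≡ L → ∀ c δ i → δ + i + 2 * c ≡ Λ →
      Σ⁺ c (λ r γ → summand₂ φ d b c δ i r γ) ≡ Ψ c δ i
    sum₂ Λ e c δ i e′ = sym (begin
      G p (M + b + c) c * G p (M + b + c + (δ + d)) (δ + d + (c + i + b))
        ≡⟨ saalschütz (M + b + c) c (δ + d) (c + i + b) ⟩
      Σ⁺ c (λ γ r → p ^ ((c + i + b ∸ r) * γ) * (G p (c + i + b) r
        * (G p (c + (δ + d)) γ * G p (M + b + c + (δ + d) + r) (c + (δ + d) + (c + i + b)))))
        ≡⟨ Σ⁺-swap c _ ⟩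
      Σ⁺ c (λ r γ → p ^ ((c + i + b ∸ r) * γ) * (G p (c + i + b) r
        * (G p (c + (δ + d)) γ * G p (M + b + c + (δ + d) + r) (c + (δ + d) + (c + i + b)))))
        ≡⟨ Σ⁺-cong c (λ r γ _ → cong₂ (λ u v → p ^ ((c + i + b ∸ r) * γ) * (G p (c + i + b) r
             * (G p (c + (δ + d)) γ * G p u v))) (e₁ M b c δ d r)
             (trans (e₂ c δ d i b) (trans (cong (b + d +_) e′) e))) ⟩
      Σ⁺ c (λ r γ → summand₂ φ d b c δ i r γ) ∎)
      where
      e₁ : ∀ M b c δ d r → M + b + c + (δ + d) + r ≡ c + δ + (b + d) + r + M
      e₁ = solve-∀
      e₂ : ∀ c δ d i b → c + (δ + d) + (c + i + b) ≡ b + d + (δ + i + 2 * c)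
      e₂ = solve-∀
    sum₃ : ∀ Λ n c → b + n + 2 * c ≡ Λ →
      Σ⁺ n (λ γ δ → summand₃ Ψ d b n c γ δ) ≡ Ω n c
    sum₃ Λ n c _ = begin
      Σ⁺ n (λ γ δ → summand₃ Ψ d b n c γ δ)
        ≡⟨ Σ⁺-cong n collect ⟩
      Σ⁺ n (λ γ δ → g * (p ^ ((b ∸ δ) * γ) * (G p b δ * (G p (n + (c + (b + d))) γ
        * G p (M + (c + (b + d)) + δ) (n + (c + (b + d)) + b)))))
        ≡⟨ Σ⁺-* n g _ ⟩
      g * Σ⁺ n (λ γ δ → p ^ ((b ∸ δ) * γ) * (G p b δ * (G p (n + (c + (b + d))) γ
        * G p (M + (c + (b + d)) + δ) (n + (c + (b + d)) + b))))
        ≡⟨ cong (g *_) (saalschütz M n (c + (b + d)) b) ⟨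
      g * (G p M n * G p (M + (c + (b + d))) (c + (b + d) + b))
        ≡⟨ aux g (G p M n) _ ⟩
      Ω n c ∎
      where
      g = G p (M + b + c) c
      aux : ∀ x y z → x * (y * z) ≡ y * (x * z)
      aux = solve-∀
      e₁ : ∀ M c δ d b → M + b + c + (δ + d) ≡ M + (c + (b + d)) + δ
      e₁ = solve-∀
      e₂ : ∀ c δ d b γ → δ + d + (c + (b + γ) + b) ≡ γ + δ + (c + (b + d)) + b
      e₂ = solve-∀
      collect : ∀ γ δ → γ + δ ≡ n →
        summand₃ Ψ d b n c γ δ
        ≡ g * (p ^ ((b ∸ δ) * γ) * (G p b δ * (G p (n + (c + (b + d))) γ
          * G p (M + (c + (b + d)) + δ) (n + (c + (b + d)) + b))))
      collect γ δ refl = trans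
        (aux₂ (p ^ ((b ∸ δ) * γ)) (G p b δ) (G p (n + (c + (b + d))) γ) g _)
        (cong₂ (λ u v → g * (p ^ ((b ∸ δ) * γ) * (G p b δ * (G p (n + (c + (b + d))) γ * G p u v))))
          (e₁ M c δ d b) (e₂ c δ d b γ))
        where
        aux₂ : ∀ x y z g w → x * (y * (z * (g * w))) ≡ g * (x * (y * (z * w)))
        aux₂ = solve-∀

  -- The limit M → ∞ of T-transform.
  T-transform∞ : ∀ L d b →
    Σ⁺ L (λ i l → h ^ (i * i) * T l i d b)
      ≡ h ^ (b * b) * shift (b + d + b) L (λ k → Σ² k (λ n r →
          h ^ (n * n) * (G p L r * G p (n + r + (b + d + b)) n)))
  T-transform∞ L d b = begin
    Σ⁺ L (λ i l → h ^ (i * i) * T l i d b)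
      ≡⟨ Σ⁺-cong L (λ i l _ → inside i l) ⟩
    Σ⁺ L (λ i l → shift (b + d) l (λ w → Σ² w (initial (λ _ → 1) d b i)))
      ≡⟨ Σ⁺-shiftʳ L (b + d) (λ i w → Σ² w (initial (λ _ → 1) d b i)) ⟩
    shift (b + d) L (λ Λ → Σ⁺ Λ (λ i w → Σ² w (initial (λ _ → 1) d b i)))
      -- With φ constant, the second and third summations degenerate from Saalschütz to Vandermonde
      -- sums.
      ≡⟨ shift-cong (b + d) L (λ Λ e →
           transform d b Λ (λ _ → 1) (λ c _ _ → G p L c) Ω (sum₂ Λ e) (sum₃ Λ)) ⟩
    shift (b + d) L (λ Λ → h ^ (b * b) * shift b Λ (λ k → Σ² k (λ n r → h ^ (n * n) * Ω n r)))
      ≡⟨ shift-* (b + d) L (h ^ (b * b)) _ ⟩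
    h ^ (b * b) * shift (b + d) L (λ Λ → shift b Λ (λ k → Σ² k (λ n r → h ^ (n * n) * Ω n r)))
      ≡⟨ cong (h ^ (b * b) *_) (shift-shift (b + d) b L _) ⟩
    h ^ (b * b) * shift (b + d + b) L (λ k → Σ² k (λ n r → h ^ (n * n) * Ω n r)) ∎
    where
    Ω : ℕ → ℕ → ℕ
    Ω n c = G p L c * G p (n + c + (b + d + b)) n
    inside : ∀ i l → h ^ (i * i) * T l i d b
      ≡ shift (b + d) l (λ w → Σ² w (initial (λ _ → 1) d b i))
    inside i l = trans (sym (shift-* (b + d) l (h ^ (i * i)) _))
      (shift-cong (b + d) l λ w _ → trans (sym (Σ²-* w (h ^ (i * i)) _))
        (Σ²-cong w λ n r _ → cong (h ^ (i * i) *_) (sym (*-identityˡ (trinomialTerm i d b n r)))))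
    sum₂ : ∀ Λ → b + d + Λ ≡ L → ∀ c δ i → δ + i + 2 * c ≡ Λ →
      Σ⁺ c (λ r γ → p ^ ((c + i + b ∸ r) * γ) * (G p (c + i + b) r
        * (G p (c + (δ + d)) γ * 1))) ≡ G p L c
    sum₂ Λ refl c δ i refl = begin
      Σ⁺ c (λ r γ → p ^ ((c + i + b ∸ r) * γ) * (G p (c + i + b) r * (G p (c + (δ + d)) γ * 1)))
        ≡⟨ Σ⁺-cong c (λ r γ _ → cong (λ u → p ^ ((c + i + b ∸ r) * γ) * (G p (c + i + b) r * u))
             (*-identityʳ (G p (c + (δ + d)) γ))) ⟩
      Σ⁺ c (λ r γ → p ^ ((c + i + b ∸ r) * γ) * (G p (c + i + b) r * G p (c + (δ + d)) γ))
        ≡⟨ vandermonde (c + i + b) (c + (δ + d)) c ⟨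
      G p (c + i + b + (c + (δ + d))) c
        ≡⟨ cong (λ u → G p u c) (e₁ c δ d i b) ⟩
      G p L c ∎
      where
      e₁ : ∀ c δ d i b → c + i + b + (c + (δ + d)) ≡ b + d + (δ + i + 2 * c)
      e₁ = solve-∀
    sum₃ : ∀ Λ n c → b + n + 2 * c ≡ Λ →
      Σ⁺ n (λ γ δ → p ^ ((b ∸ δ) * γ) * (G p b δ
        * (G p (n + (c + (b + d))) γ * G p L c))) ≡ Ω n c
    sum₃ Λ n c _ = begin
      Σ⁺ n (λ γ δ → p ^ ((b ∸ δ) * γ) * (G p b δ * (G p (n + (c + (b + d))) γ * G p L c)))
        ≡⟨ Σ⁺-cong n (λ γ δ _ → aux (p ^ ((b ∸ δ) * γ)) (G p b δ) (G p (n + (c + (b + d))) γ) (G p L c)) ⟩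
      Σ⁺ n (λ γ δ → G p L c * (p ^ ((b ∸ δ) * γ) * (G p b δ * G p (n + (c + (b + d))) γ)))
        ≡⟨ Σ⁺-* n (G p L c) _ ⟩
      G p L c * Σ⁺ n (λ γ δ → p ^ ((b ∸ δ) * γ) * (G p b δ * G p (n + (c + (b + d))) γ))
        ≡⟨ cong (G p L c *_) (Σ⁺-swap n (λ γ δ → p ^ ((b ∸ δ) * γ) * (G p b δ * G p (n + (c + (b + d))) γ))) ⟩
      G p L c * Σ⁺ n (λ δ γ → p ^ ((b ∸ δ) * γ) * (G p b δ * G p (n + (c + (b + d))) γ))
        ≡⟨ cong (G p L c *_) (vandermonde b (n + (c + (b + d))) n) ⟨
      G p L c * G p (b + (n + (c + (b + d)))) n
        ≡⟨ cong (λ u → G p L c * G p u n) (e₁ b n c d) ⟩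
      Ω n c ∎
      where
      aux : ∀ x y z u → x * (y * (z * u)) ≡ u * (x * (y * z))
      aux = solve-∀
      e₁ : ∀ b n c d → b + (n + (c + (b + d))) ≡ n + c + (b + d + b)
      e₁ = solve-∀

-- The sum over i and the central Gaussian binomial [2M, M+a]

Σ<-shift : ∀ a m g → Σ< (suc (a + m)) (λ i → shift a i g) ≡ Σ< (suc m) g
Σ<-shift zero    m g = refl
Σ<-shift (suc a) m g = Σ<-shift a m g

-- Trades a range that depends on `n` for a bound `J` common to all n, so that the sum over j can be
-- moved outside sums in which n varies.
Σ⁺-bounded : ∀ n f J → n < J → Σ⁺ n f ≡ Σ< J (λ j → shift j n (f j))
Σ⁺-bounded zero    f (suc J) _       =
  trans (sym (+-identityʳ (f 0 0))) (cong (f 0 0 +_) (sym (Σ<-zero J λ _ _ → refl)))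
Σ⁺-bounded (suc n) f (suc J) (s≤s p) = cong (f 0 (suc n) +_) (Σ⁺-bounded n (λ j → f (suc j)) J p)

-- The left side ranges over n + r ≤ m and the right side over n + 2r ≤ m; the difference lies where
-- `g` vanishes.
Σ⁺Σ⁺-fold : ∀ m (g : ℕ → ℕ → ℕ) → (∀ n r → m < n + 2 * r → g n r ≡ 0) →
  Σ⁺ m (λ _ k → Σ⁺ k g) ≡ Σ⁺ m (λ _ k → Σ² k g)
Σ⁺Σ⁺-fold m g z = begin
  Σ⁺ m (λ _ k → Σ⁺ k g)
    ≡⟨ Σ⁺-assoc m (λ _ → g) ⟩
  Σ⁺ m (λ x r → Σ⁺ x (λ _ n → g n r))
    ≡⟨ Σ⁺-fold m _ (λ x r e x<r → Σ⁺-zero x λ _ n _ → z n r (subst (_< n + 2 * r) e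
         (≤-trans (+-monoˡ-< r x<r)
         (≤-trans (≤-reflexive (cong (r +_) (sym (+-identityʳ r)))) (m≤n+m (2 * r) n))))) ⟩
  Σ² m (λ x r → Σ⁺ (r + x) (λ _ n → g n r))
    ≡⟨ Σ²-cong m cut ⟩
  Σ² m (λ x r → Σ⁺ x (λ _ n → g n r))
    ≡⟨ Σ⁺Σ² m (λ _ → g) ⟨
  Σ⁺ m (λ _ k → Σ² k g) ∎
  where
  cut : ∀ x r → x + 2 * r ≡ m → Σ⁺ (r + x) (λ _ n → g n r) ≡ Σ⁺ x (λ _ n → g n r)
  cut x r e = begin
    Σ⁺ (r + x) (λ _ n → g n r)  ≡⟨ Σ⁺-swap (r + x) (λ _ n → g n r) ⟩
    Σ⁺ (r + x) (λ n _ → g n r)  ≡⟨ cong (λ u → Σ⁺ u (λ n _ → g n r)) (+-comm r x) ⟩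
    Σ⁺ (x + r) (λ n _ → g n r)
      ≡⟨ Σ⁺-cut x r (λ n _ → g n r) (λ n _ x<n → z n r (subst (_< n + 2 * r) e (+-monoˡ-< (2 * r) x<n))) ⟩
    Σ⁺ x (λ n _ → g n r)        ≡⟨ Σ⁺-swap x (λ n _ → g n r) ⟩
    Σ⁺ x (λ _ n → g n r)        ∎

module MultinomialSum (h : ℕ) where
  open Trinomial h
  open Gaussian p

  private
    module _ (a M : ℕ) where
      i# : ℕ → ℕ → ℕ
      i# n r = a + (n + 2 * r)
      g : ℕ → ℕ → ℕ
      g n r = p ^ ((a + (n + r)) * (n + r) + r * (r + a)) *  (G p M (i# n r) * (G p (i# n r) r * G p (n + r + a) n))

      g-zero : ∀ n r → M < i# n r → g n r ≡ 0
      g-zero n r lt = trans (cong (λ u → p ^ ((a + (n + r)) * (n + r) + r * (r + a)) *  (u * (G p (i# n r) r * G p (n + r + a) n))) (G-zero M (i# n r) lt))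
        (*-zeroʳ (p ^ ((a + (n + r)) * (n + r) + r * (r + a))))

      -- Both products are the q-multinomial coefficient of M with parts r, n, r + a and M - i,
      -- since i = r + n + (r + a).
      multinomial : ∀ n r → G p M (i# n r) * (G p (i# n r) r * G p (n + r + a) n)
        ≡ G p M (n + r) * (G p (n + r) n * G p (M ∸ (n + r)) (r + a))
      multinomial n r = begin
        G p M i * (G p i r * G p (n + r + a) n)
          ≡⟨ cong (λ u → G p M i * (G p i r * G p u n)) (trans (+-assoc n r a)
               (sym (trans (cong (_∸ r) e₁) (m+n∸m≡n r _)))) ⟩
        G p M i * (G p i r * G p (i ∸ r) n)
          ≡⟨ cong (G p M i *_) (G-trinomial i n r) ⟨
        G p M i * (G p i (n + r) * G p (n + r) n)
          ≡⟨ cong (λ u → G p M i * (u * G p (n + r) n)) symm ⟩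
        G p M i * (G p i (r + a) * G p (n + r) n)
          ≡⟨ *-assoc (G p M i) _ _ ⟨
        G p M i * G p i (r + a) * G p (n + r) n
          ≡⟨ cong (λ u → G p M u * G p u (r + a) * G p (n + r) n) e₂ ⟩
        G p M ((r + a) + (n + r)) * G p ((r + a) + (n + r)) (r + a) * G p (n + r) n
          ≡⟨ cong (_* G p (n + r) n) (G-trinomial M (r + a) (n + r)) ⟩
        G p M (n + r) * G p (M ∸ (n + r)) (r + a) * G p (n + r) n
          ≡⟨ aux (G p M (n + r)) _ _ ⟩
        G p M (n + r) * (G p (n + r) n * G p (M ∸ (n + r)) (r + a)) ∎
        where
        i = i# n r
        aux : ∀ x y z → x * y * z ≡ x * (z * y)
        aux = solve-∀
        e₁ : i ≡ r + (n + (r + a))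
        e₁ = lemma n r a
          where
          lemma : ∀ n r a → a + (n + 2 * r) ≡ r + (n + (r + a))
          lemma = solve-∀
        e₂ : i ≡ (r + a) + (n + r)
        e₂ = lemma n r a
          where
          lemma : ∀ n r a → a + (n + 2 * r) ≡ (r + a) + (n + r)
          lemma = solve-∀
        symm : G p i (n + r) ≡ G p i (r + a)
        symm = trans (cong (λ u → G p u (n + r)) e₂)
          (trans (sym (G-sym (r + a) (n + r))) (cong (λ u → G p u (r + a)) (sym e₂)))

    -- With M = a + m, q-Vandermonde splits the upper index 2M as M + M and the lower index m as δ +
    -- k. The first factor is [M, δ] = [M, k + a], and a second q-Vandermonde with M = k + (M - k)
    -- opens it; the new indices n, r satisfy n + r = k.
    central : ∀ a m → G p (2 * (a + m)) (a + m + a) ≡ Σ⁺ m (λ _ k → Σ⁺ k (g a (a + m)))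
    central a m = begin
      G p (2 * M) (M + a)
        ≡⟨ cong (λ u → G p u (M + a)) (e₁ a m) ⟩
      G p (M + a + m) (M + a)
        ≡⟨ G-sym (M + a) m ⟩
      G p (M + a + m) m
        ≡⟨ cong (λ u → G p u m) (e₂ a m) ⟩
      G p (M + M) m
        ≡⟨ vandermonde M M m ⟩
      Σ⁺ m (λ δ k → p ^ ((M ∸ δ) * k) * (G p M δ * G p M k))
        ≡⟨ Σ⁺-cong m outer ⟩
      Σ⁺ m (λ _ k → Σ⁺ k (g a M)) ∎
      where
      M = a + m
      e₁ : ∀ a m → 2 * (a + m) ≡ a + m + a + m
      e₁ = solve-∀
      e₂ : ∀ a m → a + m + a + m ≡ a + m + (a + m)
      e₂ = solve-∀
      outer : ∀ δ k → δ + k ≡ m → p ^ ((M ∸ δ) * k) * (G p M δ * G p M k) ≡ Σ⁺ k (g a M)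
      outer δ k refl = begin
        p ^ ((M ∸ δ) * k) * (G p M δ * G p M k)
          ≡⟨ cong₂ (λ u v → p ^ (u * k) * (v * G p M k)) M∸δ symm ⟩
        p ^ ((a + k) * k) * (G p M (k + a) * G p M k)
          ≡⟨ cong (λ u → p ^ ((a + k) * k) * (u * G p M k)) (begin
               G p M (k + a)
                 ≡⟨ cong (λ u → G p u (k + a)) (m+[n∸m]≡n k≤M) ⟨
               G p (k + (M ∸ k)) (k + a)
                 ≡⟨ vandermonde k (M ∸ k) (k + a) ⟩
               Σ⁺ (k + a) (λ n s → p ^ ((k ∸ n) * s) * (G p k n * G p (M ∸ k) s))
                 ≡⟨ Σ⁺-cut k a _ (λ n s k<n → trans
                      (cong (λ u → p ^ ((k ∸ n) * s) * (u * G p (M ∸ k) s)) (G-zero k n k<n))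
                      (*-zeroʳ (p ^ ((k ∸ n) * s)))) ⟩
               Σ⁺ k inner ∎) ⟩
        p ^ ((a + k) * k) * (Σ⁺ k inner * G p M k)
          ≡⟨ aux (p ^ ((a + k) * k)) (Σ⁺ k inner) (G p M k) ⟩
        p ^ ((a + k) * k) * G p M k * Σ⁺ k inner
          ≡⟨ Σ⁺-* k (p ^ ((a + k) * k) * G p M k) inner ⟨
        Σ⁺ k (λ n r → p ^ ((a + k) * k) * G p M k * inner n r)
          ≡⟨ Σ⁺-cong k (λ { n r refl → collect n r }) ⟩
        Σ⁺ k (g a M) ∎
        where
        inner : ℕ → ℕ → ℕ
        inner n r = p ^ ((k ∸ n) * (r + a)) * (G p k n * G p (M ∸ k) (r + a))
        aux : ∀ x y z → x * (y * z) ≡ x * z * y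
        aux = solve-∀
        e₃ : ∀ a δ k → a + (δ + k) ≡ δ + (k + a)
        e₃ = solve-∀
        M∸δ : M ∸ δ ≡ a + k
        M∸δ = trans (cong (_∸ δ) (e₃ a δ k)) (trans (m+n∸m≡n δ _) (+-comm k a))
        symm : G p M δ ≡ G p M (k + a)
        symm = trans (cong (λ u → G p u δ) (e₃ a δ k))
          (trans (G-sym δ (k + a)) (cong (λ u → G p u (k + a)) (sym (e₃ a δ k))))
        k≤M : k ≤ M
        k≤M = ≤-trans (m≤n+m k δ) (m≤n+m (δ + k) a)
        collect : ∀ n r → p ^ ((a + (n + r)) * (n + r)) * G p M (n + r)
          * (p ^ ((n + r ∸ n) * (r + a)) * (G p (n + r) n * G p (M ∸ (n + r)) (r + a))) ≡ g a M n r
        collect n r = begin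
          x * G p M (n + r) * (p ^ ((n + r ∸ n) * (r + a)) * (G p (n + r) n * G p (M ∸ (n + r)) (r + a)))
            ≡⟨ aux₁ x (G p M (n + r)) _ _ ⟩
          x * p ^ ((n + r ∸ n) * (r + a)) * (G p M (n + r) * (G p (n + r) n * G p (M ∸ (n + r)) (r + a)))
            ≡⟨ cong₂ _*_ (trans (cong (λ u → x * p ^ (u * (r + a))) (m+n∸m≡n n r))
                           (sym (^-distribˡ-+-* p ((a + (n + r)) * (n + r)) (r * (r + a)))))
                 (sym (multinomial a M n r)) ⟩
          g a M n r ∎
          where
          x = p ^ ((a + (n + r)) * (n + r))
          aux₁ : ∀ x y z w → x * y * (z * w) ≡ x * z * (y * w)
          aux₁ = solve-∀

  -- The inner sums leave only i = a + n + 2r, and there i² + n² = a² + 2((a+n+r)(n+r) + r(r+a)).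
  -- The bracket is the exponent of p in the double Vandermonde expansion `central`, so the whole
  -- sum collapses to a single Gaussian binomial. For a > M both sides are zero.
  multinomial-sum : ∀ B M a → M ≤ B →
    Σ< (suc B) (λ i → h ^ (i * i) * (G p M i * shift a i (λ k → Σ² k (λ n r →
      h ^ (n * n) * (G p i r * G p (n + r + a) n)))))
    ≡ h ^ (a * a) * G p (2 * M) (M + a)
  multinomial-sum B M a M≤B = begin
    Σ< (suc B) F
      ≡⟨ Σ<-extend (suc M) (suc B) F (s≤s M≤B) (λ i M<i → trans
           (cong (λ u → h ^ (i * i) * (u * inner i)) (G-zero M i M<i)) (*-zeroʳ (h ^ (i * i)))) ⟨
    Σ< (suc M) F
      ≡⟨ Σ<-cong (suc M) (λ i _ → F-shift i) ⟩
    Σ< (suc M) (λ i → shift a i (λ k → h ^ (a * a) * Σ² k (g a M)))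
      ≡⟨ rest ⟩
    h ^ (a * a) * G p (2 * M) (M + a) ∎
    where
    inner F : ℕ → ℕ
    inner i = shift a i (λ k → Σ² k (λ n r → h ^ (n * n) * (G p i r * G p (n + r + a) n)))
    F i = h ^ (i * i) * (G p M i * inner i)

    collect : ∀ n r → let i = i# a M n r in
      h ^ (i * i) * (G p M i * (h ^ (n * n) * (G p i r * G p (n + r + a) n))) ≡ h ^ (a * a) * g a M n r
    collect n r = begin
      h ^ (i * i) * (G p M i * (h ^ (n * n) * (G p i r * G p (n + r + a) n)))
        ≡⟨ aux (h ^ (i * i)) (G p M i) (h ^ (n * n)) _ ⟩
      h ^ (i * i) * h ^ (n * n) * (G p M i * (G p i r * G p (n + r + a) n))
        ≡⟨ cong (_* (G p M i * (G p i r * G p (n + r + a) n))) powers ⟩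
      h ^ (a * a) * p ^ e * (G p M i * (G p i r * G p (n + r + a) n))
        ≡⟨ *-assoc (h ^ (a * a)) _ _ ⟩
      h ^ (a * a) * g a M n r ∎
      where
      i = i# a M n r
      e = (a + (n + r)) * (n + r) + r * (r + a)
      aux : ∀ x y z w → x * (y * (z * w)) ≡ x * z * (y * w)
      aux = solve-∀
      exponents : ∀ a n r → (a + (n + 2 * r)) * (a + (n + 2 * r)) + n * n
        ≡ a * a + 2 * ((a + (n + r)) * (n + r) + r * (r + a))
      exponents = solve-∀
      powers : h ^ (i * i) * h ^ (n * n) ≡ h ^ (a * a) * p ^ e
      powers = begin
        h ^ (i * i) * h ^ (n * n)    ≡⟨ ^-distribˡ-+-* h (i * i) (n * n) ⟨
        h ^ (i * i + n * n)          ≡⟨ cong (h ^_) (exponents a n r) ⟩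
        h ^ (a * a + 2 * e)          ≡⟨ ^-distribˡ-+-* h (a * a) (2 * e) ⟩
        h ^ (a * a) * h ^ (2 * e)    ≡⟨ cong (h ^ (a * a) *_) (p^ e) ⟨
        h ^ (a * a) * p ^ e          ∎

    F-shift : ∀ i → F i ≡ shift a i (λ k → h ^ (a * a) * Σ² k (g a M))
    F-shift i = begin
      h ^ (i * i) * (G p M i * inner i)
        ≡⟨ cong (h ^ (i * i) *_) (shift-* a i (G p M i) _) ⟨
      h ^ (i * i) * shift a i (λ k → G p M i * Σ² k f)
        ≡⟨ shift-* a i (h ^ (i * i)) _ ⟨
      shift a i (λ k → h ^ (i * i) * (G p M i * Σ² k f))
        ≡⟨ shift-cong a i (λ k e → begin
             h ^ (i * i) * (G p M i * Σ² k f)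
               ≡⟨ cong (h ^ (i * i) *_) (Σ²-* k (G p M i) f) ⟨
             h ^ (i * i) * Σ² k (λ n r → G p M i * f n r)
               ≡⟨ Σ²-* k (h ^ (i * i)) (λ n r → G p M i * f n r) ⟨
             Σ² k (λ n r → h ^ (i * i) * (G p M i * f n r))
               ≡⟨ Σ²-cong k (λ n r e′ → trans
                    (cong (λ j → h ^ (j * j) * (G p M j * (h ^ (n * n) * (G p j r * G p (n + r + a) n))))
                      (trans (sym e) (cong (a +_) (sym e′))))
                    (collect n r)) ⟩
             Σ² k (λ n r → h ^ (a * a) * g a M n r)
               ≡⟨ Σ²-* k (h ^ (a * a)) (g a M) ⟩
             h ^ (a * a) * Σ² k (g a M) ∎) ⟩
      shift a i (λ k → h ^ (a * a) * Σ² k (g a M)) ∎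
      where
      f : ℕ → ℕ → ℕ
      f n r = h ^ (n * n) * (G p i r * G p (n + r + a) n)

    rest : Σ< (suc M) (λ i → shift a i (λ k → h ^ (a * a) * Σ² k (g a M)))
      ≡ h ^ (a * a) * G p (2 * M) (M + a)
    rest with a ≤? M
    ... | no a≰M = trans
      (Σ<-zero (suc M) λ i i≤M → shift-zero a i (λ k → h ^ (a * a) * Σ² k (g a M)) (<-≤-trans i≤M (≰⇒> a≰M)))
      (sym (trans (cong (h ^ (a * a) *_) (G-zero (2 * M) (M + a) lt)) (*-zeroʳ (h ^ (a * a)))))
      where
      lt : 2 * M < M + a
      lt = +-monoʳ-< M (subst (_< a) (sym (+-identityʳ M)) (≰⇒> a≰M))
    ... | yes a≤M with m , refl ← m≤n⇒n≡m+ a≤M = begin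
      Σ< (suc (a + m)) (λ i → shift a i (λ k → h ^ (a * a) * Σ² k (g a M)))
        ≡⟨ Σ<-shift a m (λ k → h ^ (a * a) * Σ² k (g a M)) ⟩
      Σ< (suc m) (λ k → h ^ (a * a) * Σ² k (g a M))
        ≡⟨ Σ<-* (suc m) (h ^ (a * a)) (λ k → Σ² k (g a M)) ⟩
      h ^ (a * a) * Σ< (suc m) (λ k → Σ² k (g a M))
        ≡⟨ cong (h ^ (a * a) *_) (Σ⁺-Σ< m (λ k _ → Σ² k (g a M))) ⟨
      h ^ (a * a) * Σ⁺ m (λ k _ → Σ² k (g a M))
        ≡⟨ cong (h ^ (a * a) *_) (Σ⁺-swap m (λ k _ → Σ² k (g a M))) ⟩
      h ^ (a * a) * Σ⁺ m (λ _ k → Σ² k (g a M))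
        ≡⟨ cong (h ^ (a * a) *_) (Σ⁺Σ⁺-fold m (g a M) λ n r lt →
             g-zero a M n r (+-monoʳ-< a lt)) ⟨
      h ^ (a * a) * Σ⁺ m (λ _ k → Σ⁺ k (g a M))
        ≡⟨ cong (h ^ (a * a) *_) (central a m) ⟨
      h ^ (a * a) * G p (2 * (a + m)) (a + m + a) ∎

-- The cubic seed identity

-- The coefficient of z^m in ∏_{k<n} (1 + c k z).
elem : (ℕ → ℕ) → ℕ → ℕ → ℕ
elem c zero    zero    = 1
elem c zero    (suc m) = 0
elem c (suc n) zero    = elem c n zero
elem c (suc n) (suc m) = elem c n (suc m) + c n * elem c n m

elem-cong : ∀ {c d} → (∀ k → c k ≡ d k) → ∀ n m → elem c n m ≡ elem d n m
elem-cong e zero    zero    = refl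
elem-cong e zero    (suc m) = refl
elem-cong e (suc n) zero    = elem-cong e n zero
elem-cong e (suc n) (suc m) = cong₂ _+_ (elem-cong e n (suc m)) (cong₂ _*_ (e n) (elem-cong e n m))

-- Rothe's q-binomial theorem. `w m` is y^m q^(m(m-1)/2), given by its recurrence so that no
-- exponent has to be halved and each use can supply its own closed form.
rothe : ∀ q y (w : ℕ → ℕ) → w 0 ≡ 1 → (∀ m → w (suc m) ≡ w m * (y * q ^ m)) →
  ∀ n m → elem (λ k → y * q ^ k) n m ≡ w m * G q n m
rothe q y w w0 ws zero    zero    = sym (cong (_* 1) w0)
rothe q y w w0 ws zero    (suc m) = sym (*-zeroʳ (w (suc m)))
rothe q y w w0 ws (suc n) zero    = rothe q y w w0 ws n zero
rothe q y w w0 ws (suc n) (suc m) = begin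
  elem _ n (suc m) + y * q ^ n * elem _ n m
    ≡⟨ cong₂ (λ u v → u + y * q ^ n * v) (rothe q y w w0 ws n (suc m)) (rothe q y w w0 ws n m) ⟩
  w (suc m) * G q n (suc m) + y * q ^ n * (w m * G q n m)
    ≡⟨ pascal ⟩
  w (suc m) * G q (suc n) (suc m) ∎
  where
  open Gaussian q
  pascal : w (suc m) * G q n (suc m) + y * q ^ n * (w m * G q n m) ≡ w (suc m) * G q (suc n) (suc m)
  pascal with m ≤? n
  ... | yes m≤n with c , refl ← m≤n⇒n≡m+ m≤n = begin
    w (suc m) * b + y * q ^ (m + c) * (w m * a)
      ≡⟨ cong₂ (λ u v → u * b + y * v * (w m * a)) (ws m) (^-distribˡ-+-* q m c) ⟩
    w m * (y * q ^ m) * b + y * (q ^ m * q ^ c) * (w m * a)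
      ≡⟨ aux (w m) y (q ^ m) b (q ^ c) a ⟩
    w m * (y * q ^ m) * (q ^ c * a + b)
      ≡⟨ cong₂ _*_ (ws m) (G-pascal m c) ⟨
    w (suc m) * G q (suc n) (suc m) ∎
    where
    a = G q (m + c) m
    b = G q (m + c) (suc m)
    aux : ∀ w y z b r a → w * (y * z) * b + y * (z * r) * (w * a) ≡ w * (y * z) * (r * a + b)
    aux = solve-∀
  ... | no m≰n = trans
    (cong₂ (λ u v → w (suc m) * u + y * q ^ n * (w m * v)) (G-zero n (suc m) (m≤n⇒m≤1+n n<m)) (G-zero n m n<m))
    (trans (aux (w (suc m)) (y * q ^ n) (w m)) (cong (w (suc m) *_) (sym (G-zero (suc n) (suc m) (s≤s n<m)))))
    where
    n<m : n < m
    n<m = ≰⇒> m≰n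
    aux : ∀ x z u → x * 0 + z * (u * 0) ≡ x * 0
    aux = solve-∀

-- Multiplication of a generating function by 1 + c z.
linear : ℕ → (ℕ → ℕ) → ℕ → ℕ
linear c f zero    = f zero
linear c f (suc m) = f (suc m) + c * f m

conv : (ℕ → ℕ) → (ℕ → ℕ) → ℕ → ℕ
conv f g m = Σ⁺ m (λ i j → f i * g j)

linear-cong : ∀ c {f g} → (∀ m → f m ≡ g m) → ∀ m → linear c f m ≡ linear c g m
linear-cong c e zero    = e zero
linear-cong c e (suc m) = cong₂ (λ u v → u + c * v) (e (suc m)) (e m)

conv-cong : ∀ {f f′ g g′} → (∀ m → f m ≡ f′ m) → (∀ m → g m ≡ g′ m) → ∀ m → conv f g m ≡ conv f′ g′ m
conv-cong e e′ m = Σ⁺-cong m λ i j _ → cong₂ _*_ (e i) (e′ j)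

conv-comm : ∀ f g m → conv f g m ≡ conv g f m
conv-comm f g m = trans (Σ⁺-swap m (λ i j → f i * g j)) (Σ⁺-cong m λ i j _ → *-comm (f j) (g i))

conv-linearˡ : ∀ c f g m → conv (linear c f) g m ≡ linear c (conv f g) m
conv-linearˡ c f g zero    = refl
conv-linearˡ c f g (suc m) = begin
  f 0 * g (suc m) + Σ⁺ m (λ i j → (f (suc i) + c * f i) * g j)
    ≡⟨ cong (f 0 * g (suc m) +_) (Σ⁺-cong m λ i j _ → aux (f (suc i)) c (f i) (g j)) ⟩
  f 0 * g (suc m) + Σ⁺ m (λ i j → f (suc i) * g j + c * (f i * g j))
    ≡⟨ cong (f 0 * g (suc m) +_) (Σ⁺-+ m (λ i j → f (suc i) * g j) (λ i j → c * (f i * g j))) ⟩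
  f 0 * g (suc m) + (Σ⁺ m (λ i j → f (suc i) * g j) + Σ⁺ m (λ i j → c * (f i * g j)))
    ≡⟨ cong (λ u → f 0 * g (suc m) + (Σ⁺ m (λ i j → f (suc i) * g j) + u)) (Σ⁺-* m c (λ i j → f i * g j)) ⟩
  f 0 * g (suc m) + (Σ⁺ m (λ i j → f (suc i) * g j) + c * conv f g m)
    ≡⟨ +-assoc (f 0 * g (suc m)) _ _ ⟨
  conv f g (suc m) + c * conv f g m ∎
  where
  aux : ∀ x c y z → (x + c * y) * z ≡ x * z + c * (y * z)
  aux = solve-∀

conv-linearʳ : ∀ c f g m → conv f (linear c g) m ≡ linear c (conv f g) m
conv-linearʳ c f g m = trans (conv-comm f (linear c g) m)
  (trans (conv-linearˡ c g f m) (linear-cong c (conv-comm g f) m))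

elem-suc : ∀ c n m → elem c (suc n) m ≡ linear (c n) (elem c n) m
elem-suc c n zero    = refl
elem-suc c n (suc m) = refl

-- Three further linear factors, one for each residue class modulo 3, come in at every step. Class 1
-- is placed outermost because it becomes the factor p^(κ²/2) [n, κ] of the trinomial, while classes
-- 0 and 2 have to be combined with each other.
elem-thirds : ∀ c n m → elem c (n * 3) m
  ≡ conv (elem (λ k → c (1 + k * 3)) n) (conv (elem (λ k → c (k * 3)) n) (elem (λ k → c (2 + k * 3)) n)) m
elem-thirds c zero    zero    = refl
elem-thirds c zero    (suc m) =
  sym (cong₂ _+_ (trans (+-identityʳ _) (Σ⁺-zero m λ i j _ → refl)) (Σ⁺-zero m λ i j _ → refl))
elem-thirds c (suc n) m = begin
  elem c (suc n * 3) m
    ≡⟨ elem-suc c (2 + n * 3) m ⟩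
  linear c₂ (elem c (2 + n * 3)) m
    ≡⟨ linear-cong c₂ (λ m → trans (elem-suc c (1 + n * 3) m) (linear-cong c₁ (λ m → trans (elem-suc c (n * 3) m)
         (linear-cong c₀ (elem-thirds c n) m)) m)) m ⟩
  linear c₂ (linear c₁ (linear c₀ (conv E₁ (conv E₀ E₂)))) m
    ≡⟨ linear-cong c₂ (linear-cong c₁ (λ m → sym (conv-linearʳ c₀ E₁ (conv E₀ E₂) m))) m ⟩
  linear c₂ (linear c₁ (conv E₁ (linear c₀ (conv E₀ E₂)))) m
    ≡⟨ linear-cong c₂ (λ m → sym (conv-linearˡ c₁ E₁ (linear c₀ (conv E₀ E₂)) m)) m ⟩
  linear c₂ (conv (linear c₁ E₁) (linear c₀ (conv E₀ E₂))) m
    ≡⟨ conv-linearʳ c₂ (linear c₁ E₁) (linear c₀ (conv E₀ E₂)) m ⟨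
  conv (linear c₁ E₁) (linear c₂ (linear c₀ (conv E₀ E₂))) m
    ≡⟨ conv-cong (λ m → sym (elem-suc (λ k → c (1 + k * 3)) n m)) (λ m → begin
         linear c₂ (linear c₀ (conv E₀ E₂)) m
           ≡⟨ linear-cong c₂ (λ m → sym (conv-linearˡ c₀ E₀ E₂ m)) m ⟩
         linear c₂ (conv (linear c₀ E₀) E₂) m
           ≡⟨ conv-linearʳ c₂ (linear c₀ E₀) E₂ m ⟨
         conv (linear c₀ E₀) (linear c₂ E₂) m
           ≡⟨ conv-cong (elem-suc (λ k → c (k * 3)) n) (elem-suc (λ k → c (2 + k * 3)) n) m ⟨
         conv (elem (λ k → c (k * 3)) (suc n)) (elem (λ k → c (2 + k * 3)) (suc n)) m ∎) m ⟩
  conv (elem (λ k → c (1 + k * 3)) (suc n))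
    (conv (elem (λ k → c (k * 3)) (suc n)) (elem (λ k → c (2 + k * 3)) (suc n))) m ∎
  where
  c₀ = c (n * 3)
  c₁ = c (1 + n * 3)
  c₂ = c (2 + n * 3)
  E₀ = elem (λ k → c (k * 3)) n
  E₁ = elem (λ k → c (1 + k * 3)) n
  E₂ = elem (λ k → c (2 + k * 3)) n

-- Σ over c of g (r - c) (s - c) c.
Σᵐⁱⁿ : ℕ → ℕ → (ℕ → ℕ → ℕ → ℕ) → ℕ
Σᵐⁱⁿ zero    s       g = g 0 s 0
Σᵐⁱⁿ (suc r) zero    g = g (suc r) 0 0
Σᵐⁱⁿ (suc r) (suc s) g = g (suc r) (suc s) 0 + Σᵐⁱⁿ r s (λ a b c → g a b (suc c))

-- The substitution r = a + c, s = b + c turns a + b + 2c = n into r + s = n, and c then runs up to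
-- the smaller of r and s.
Σ²Σ⁺-min : ∀ n (g : ℕ → ℕ → ℕ → ℕ) →
  Σ² n (λ m c → Σ⁺ m (λ a b → g a b c)) ≡ Σ⁺ n (λ r s → Σᵐⁱⁿ r s g)
Σ²Σ⁺-min zero          g = refl
Σ²Σ⁺-min (suc zero)    g = refl
Σ²Σ⁺-min (suc (suc n)) g = begin
  Σ⁺ (2 + n) (λ a b → g a b 0) + Σ² n (λ m c → Σ⁺ m (λ a b → g a b (suc c)))
    ≡⟨ cong₂ _+_ (Σ⁺-ends n (λ a b → g a b 0)) (Σ²Σ⁺-min n λ a b c → g a b (suc c)) ⟩
  g 0 (2 + n) 0 + (g (2 + n) 0 0 + Σ⁺ n (λ a b → g (suc a) (suc b) 0)) + Σ⁺ n (λ r s → Σᵐⁱⁿ r s (λ a b c → g a b (suc c)))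
    ≡⟨ aux (g 0 (2 + n) 0) (g (2 + n) 0 0) _ _ ⟩
  g 0 (2 + n) 0 + (g (2 + n) 0 0 + (Σ⁺ n (λ a b → g (suc a) (suc b) 0) + Σ⁺ n (λ r s → Σᵐⁱⁿ r s (λ a b c → g a b (suc c)))))
    ≡⟨ cong (λ u → g 0 (2 + n) 0 + (g (2 + n) 0 0 + u)) (Σ⁺-+ n _ _) ⟨
  g 0 (2 + n) 0 + (g (2 + n) 0 0 + Σ⁺ n (λ r s → Σᵐⁱⁿ (suc r) (suc s) g))
    ≡⟨ Σ⁺-ends n (λ r s → Σᵐⁱⁿ r s g) ⟨
  Σ⁺ (2 + n) (λ r s → Σᵐⁱⁿ r s g) ∎
  where
  aux : ∀ x y z w → x + (y + z) + w ≡ x + (y + (z + w))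
  aux = solve-∀

Σᵐⁱⁿ-≤ : ∀ j r g → Σᵐⁱⁿ r (j + r) g ≡ Σ⁺ r (λ ρ c → g ρ (j + ρ) c)
Σᵐⁱⁿ-≤ j zero    g = refl
Σᵐⁱⁿ-≤ j (suc r) g = begin
  Σᵐⁱⁿ (suc r) (j + suc r) g
    ≡⟨ cong (λ u → Σᵐⁱⁿ (suc r) u g) (+-suc j r) ⟩
  g (suc r) (suc (j + r)) 0 + Σᵐⁱⁿ r (j + r) (λ a b c → g a b (suc c))
    ≡⟨ cong₂ (λ u v → g (suc r) u 0 + v) (sym (+-suc j r)) (Σᵐⁱⁿ-≤ j r _) ⟩
  g (suc r) (j + suc r) 0 + Σ⁺ r (λ ρ c → g ρ (j + ρ) (suc c))
    ≡⟨ +-comm (g (suc r) (j + suc r) 0) _ ⟩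
  Σ⁺ r (λ ρ c → g ρ (j + ρ) (suc c)) + g (suc r) (j + suc r) 0
    ≡⟨ Σ⁺-last r (λ ρ c → g ρ (j + ρ) c) ⟨
  Σ⁺ (suc r) (λ ρ c → g ρ (j + ρ) c) ∎

Σᵐⁱⁿ-≥ : ∀ j r g → Σᵐⁱⁿ (j + r) r g ≡ Σ⁺ r (λ ρ c → g (j + ρ) ρ c)
Σᵐⁱⁿ-≥ j zero g with j
... | zero  = refl
... | suc k = refl
Σᵐⁱⁿ-≥ j (suc r) g = begin
  Σᵐⁱⁿ (j + suc r) (suc r) g
    ≡⟨ cong (λ u → Σᵐⁱⁿ u (suc r) g) (+-suc j r) ⟩
  g (suc (j + r)) (suc r) 0 + Σᵐⁱⁿ (j + r) r (λ a b c → g a b (suc c))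
    ≡⟨ cong₂ (λ u v → g u (suc r) 0 + v) (sym (+-suc j r)) (Σᵐⁱⁿ-≥ j r _) ⟩
  g (j + suc r) (suc r) 0 + Σ⁺ r (λ ρ c → g (j + ρ) ρ (suc c))
    ≡⟨ +-comm (g (j + suc r) (suc r) 0) _ ⟩
  Σ⁺ r (λ ρ c → g (j + ρ) ρ (suc c)) + g (j + suc r) (suc r) 0
    ≡⟨ Σ⁺-last r (λ ρ c → g (j + ρ) ρ c) ⟨
  Σ⁺ (suc r) (λ ρ c → g (j + ρ) ρ c) ∎

-- Prevents the diagonal from being counted twice when the pairs (r, j + r) and (j + r, r) are put
-- together.
ifPos : ℕ → ℕ → ℕ
ifPos zero    x = 0
ifPos (suc _) x = x

Σ⁺-diagonals : ∀ n f → Σ⁺ n f ≡ Σ² n (λ j r → f r (j + r) + ifPos j (f (j + r) r))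
Σ⁺-diagonals zero          f = sym (+-identityʳ _)
Σ⁺-diagonals (suc zero)    f = refl
Σ⁺-diagonals (suc (suc n)) f = begin
  Σ⁺ (2 + n) f
    ≡⟨ Σ⁺-ends n f ⟩
  f 0 (2 + n) + (f (2 + n) 0 + Σ⁺ n (λ i j → f (suc i) (suc j)))
    ≡⟨ +-assoc (f 0 (2 + n)) _ _ ⟨
  f 0 (2 + n) + f (2 + n) 0 + Σ⁺ n (λ i j → f (suc i) (suc j))
    ≡⟨ cong₂ _+_ (cong₂ (λ u v → f 0 u + f v 0) (sym (+-identityʳ (2 + n))) (sym (+-identityʳ (2 + n))))
         (trans (Σ⁺-diagonals n (λ i j → f (suc i) (suc j)))
           (Σ²-cong n λ j r _ → cong (λ u → f (suc r) u + ifPos j (f u (suc r))) (sym (+-suc j r)))) ⟩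
  Σ² (2 + n) (λ j r → f r (j + r) + ifPos j (f (j + r) r)) ∎

module Seed (t : ℕ) where
  open Trinomial (t ^ 3) public
  open Gaussian p

  q h : ℕ
  q = t ^ 2
  h = t ^ 3

  q³≡p : q ^ 3 ≡ p
  q³≡p = trans (^-*-assoc t 2 3) (sym (^-*-assoc t 3 2))

  -- The number 3x² - 2x without subtraction. As q = t², it is the exponent of t in q^(3j²/2+j) at j
  -- = -x, while `d x` is the one at j = x.
  u : ℕ → ℕ
  u zero    = 0
  u (suc x) = suc x * (3 * x + 1)

  u-spec : ∀ x → u x + 2 * x ≡ 3 * (x * x)
  u-spec zero    = refl
  u-spec (suc x) = aux x
    where
    aux : ∀ x → suc x * (3 * x + 1) + 2 * suc x ≡ 3 * (suc x * suc x)
    aux = solve-∀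

  d : ℕ → ℕ
  d x = 3 * (x * x) + 2 * x

  -- An instance of `saalschütz` with parameters n + r, n - j, j, n, after passing to complementary
  -- lower indices. The two sums have different ranges, ρ ≤ n - j and ρ ≤ r; they are compared
  -- through `K`, which vanishes beyond either bound. The form `r + 0` is what `trinomialTerm`
  -- produces at d = 0.
  saalschütz-diagonal : ∀ n r j →
    Σ⁺ r (λ ρ c → p ^ (ρ * (ρ + j)) * (G p n ρ * (G p n (j + ρ) * G p (2 * n + c) c)))
      ≡ G p (n + j + r) r * G p (n + (r + 0)) (r + 0 + j)
  saalschütz-diagonal n r j with j ≤? n
  ... | no j≰n = trans
    (Σ⁺-zero r λ ρ c _ → trans
      (cong (λ x → p ^ (ρ * (ρ + j)) * (G p n ρ * (x * G p (2 * n + c) c)))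
        (G-zero n (j + ρ) (m≤n⇒m≤n+o ρ (≰⇒> j≰n))))
      (aux (p ^ (ρ * (ρ + j))) (G p n ρ)))
    (sym (trans (cong (G p (n + j + r) r *_) (G-zero (n + (r + 0)) (r + 0 + j)
      (subst (_< r + 0 + j) (+-comm (r + 0) n) (+-monoʳ-< (r + 0) (≰⇒> j≰n)))))
      (*-zeroʳ (G p (n + j + r) r))))
    where
    aux : ∀ x y → x * (y * 0) ≡ 0
    aux = solve-∀
  ... | yes j≤n with y , refl ← m≤n⇒n≡m+ j≤n = sym (begin
    G p (n + j + r) r * G p (n + (r + 0)) (r + 0 + j)
      ≡⟨ cong₂ _*_ sym₁ sym₂ ⟩
    G p (n + r + j) (j + n) * G p (n + r) y
      ≡⟨ *-comm (G p (n + r + j) (j + n)) _ ⟩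
    G p (n + r) y * G p (n + r + j) (j + n)
      ≡⟨ saalschütz (n + r) y j n ⟩
    Σ⁺ y S
      ≡⟨ Σ⁺-Σ< y S ⟩
    Σ< (suc y) (λ ρ → S ρ (y ∸ ρ))
      ≡⟨ Σ<-cong (suc y) (λ { ρ (s≤s ρ≤y) → S≡K ρ ρ≤y }) ⟩
    Σ< (suc y) K
      ≡⟨ Σ<-extend (suc y) (suc (y + r)) K (s≤s (m≤m+n y r)) K-zero₁ ⟩
    Σ< (suc (y + r)) K
      ≡⟨ Σ<-extend (suc r) (suc (y + r)) K (s≤s (m≤n+m r y)) K-zero₂ ⟨
    Σ< (suc r) K
      ≡⟨ Σ<-cong (suc r) (λ { ρ (s≤s ρ≤r) → R≡K ρ ρ≤r }) ⟨
    Σ< (suc r) (λ ρ → R ρ (r ∸ ρ))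
      ≡⟨ Σ⁺-Σ< r R ⟨
    Σ⁺ r R ∎)
    where
    S R : ℕ → ℕ → ℕ
    S γ δ = p ^ ((n ∸ δ) * γ) * (G p n δ * (G p (y + j) γ * G p (n + r + j + δ) (y + j + n)))
    R ρ c = p ^ (ρ * (ρ + j)) * (G p n ρ * (G p n (j + ρ) * G p (2 * n + c) c))
    K : ℕ → ℕ
    K ρ = p ^ (ρ * (ρ + j)) * (G p n ρ * (G p n (j + ρ) * G p (2 * n + r ∸ ρ) (2 * n)))

    sym₁ : G p (n + j + r) r ≡ G p (n + r + j) (j + n)
    sym₁ = trans (cong (λ x → G p x r) (e₁ n j r)) (trans (G-sym r (j + n)) (cong (λ x → G p x (j + n)) (e₂ n j r)))
      where
      e₁ : ∀ n j r → n + j + r ≡ r + (j + n)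
      e₁ = solve-∀
      e₂ : ∀ n j r → r + (j + n) ≡ n + r + j
      e₂ = solve-∀
    sym₂ : G p (n + (r + 0)) (r + 0 + j) ≡ G p (n + r) y
    sym₂ = trans (cong (λ x → G p x (r + 0 + j)) (e₁ j y r)) (trans (G-sym (r + 0 + j) y)
      (cong (λ x → G p x y) (e₂ j y r)))
      where
      e₁ : ∀ j y r → j + y + (r + 0) ≡ r + 0 + j + y
      e₁ = solve-∀
      e₂ : ∀ j y r → r + 0 + j + y ≡ j + y + r
      e₂ = solve-∀

    S≡K : ∀ ρ → ρ ≤ y → S ρ (y ∸ ρ) ≡ K ρ
    S≡K ρ ρ≤y with δ , refl ← m≤n⇒n≡m+ ρ≤y = begin
      p ^ ((n ∸ (ρ + δ ∸ ρ)) * ρ) * (G p n (ρ + δ ∸ ρ) * (G p (y + j) ρ * G p (n + r + j + (ρ + δ ∸ ρ)) (y + j + n)))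
        ≡⟨ cong (λ x → p ^ ((n ∸ x) * ρ) * (G p n x * (G p (y + j) ρ * G p (n + r + j + x) (y + j + n))))
             (m+n∸m≡n ρ δ) ⟩
      p ^ ((n ∸ δ) * ρ) * (G p n δ * (G p (y + j) ρ * G p (n + r + j + δ) (y + j + n)))
        ≡⟨ cong₂ (λ a b → p ^ a * (G p n δ * b)) exponents
             (cong₂ _*_ (cong (λ a → G p a ρ) (+-comm y j)) (cong₂ (G p) tops (e₃ j ρ δ))) ⟩
      p ^ (ρ * (ρ + j)) * (G p n δ * (G p n ρ * G p (2 * n + r ∸ ρ) (2 * n)))
        ≡⟨ cong (λ a → p ^ (ρ * (ρ + j)) * (a * (G p n ρ * G p (2 * n + r ∸ ρ) (2 * n)))) symm ⟩
      p ^ (ρ * (ρ + j)) * (G p n (j + ρ) * (G p n ρ * G p (2 * n + r ∸ ρ) (2 * n)))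
        ≡⟨ cong (p ^ (ρ * (ρ + j)) *_) (aux (G p n (j + ρ)) (G p n ρ) _) ⟩
      K ρ ∎
      where
      aux : ∀ a b c → a * (b * c) ≡ b * (a * c)
      aux = solve-∀
      e₁ : ∀ j ρ δ → j + (ρ + δ) ≡ δ + (ρ + j)
      e₁ = solve-∀
      e₂ : ∀ j ρ δ r → 2 * (j + (ρ + δ)) + r ≡ ρ + (j + (ρ + δ) + r + j + δ)
      e₂ = solve-∀
      e₃ : ∀ j ρ δ → ρ + δ + j + (j + (ρ + δ)) ≡ 2 * (j + (ρ + δ))
      e₃ = solve-∀
      exponents : (n ∸ δ) * ρ ≡ ρ * (ρ + j)
      exponents = trans (cong (_* ρ) (trans (cong (_∸ δ) (e₁ j ρ δ)) (m+n∸m≡n δ _))) (*-comm (ρ + j) ρ)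
      tops : n + r + j + δ ≡ 2 * n + r ∸ ρ
      tops = sym (trans (cong (_∸ ρ) (e₂ j ρ δ r)) (m+n∸m≡n ρ _))
      symm : G p n δ ≡ G p n (j + ρ)
      symm = trans (cong (λ a → G p a δ) (sym (+-assoc j ρ δ)))
        (trans (sym (G-sym (j + ρ) δ)) (cong (λ a → G p a (j + ρ)) (+-assoc j ρ δ)))

    R≡K : ∀ ρ → ρ ≤ r → R ρ (r ∸ ρ) ≡ K ρ
    R≡K ρ ρ≤r = cong (λ a → p ^ (ρ * (ρ + j)) * (G p n ρ * (G p n (j + ρ) * a)))
      (trans (sym (G-sym (2 * n) (r ∸ ρ))) (cong (λ a → G p a (2 * n)) (sym (+-∸-assoc (2 * n) ρ≤r))))

    K-zero₁ : ∀ ρ → y < ρ → K ρ ≡ 0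
    K-zero₁ ρ y<ρ = trans
      (cong (λ a → p ^ (ρ * (ρ + j)) * (G p n ρ * (a * G p (2 * n + r ∸ ρ) (2 * n))))
        (G-zero n (j + ρ) (+-monoʳ-< j y<ρ)))
      (aux (p ^ (ρ * (ρ + j))) (G p n ρ))
      where
      aux : ∀ a b → a * (b * 0) ≡ 0
      aux = solve-∀

    K-zero₂ : ∀ ρ → r < ρ → K ρ ≡ 0
    -- The truncated `2 * n + r ∸ ρ` drops strictly below 2n only while ρ is not too large (it fails
    -- for n = 0); beyond n the factor `G p n ρ` is zero instead.
    K-zero₂ ρ r<ρ with ρ ≤? n
    ... | no ρ≰n = trans
      (cong (λ a → p ^ (ρ * (ρ + j)) * (a * (G p n (j + ρ) * G p (2 * n + r ∸ ρ) (2 * n))))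
        (G-zero n ρ (≰⇒> ρ≰n)))
      (*-zeroʳ (p ^ (ρ * (ρ + j))))
    ... | yes ρ≤n = trans
      (cong (λ a → p ^ (ρ * (ρ + j)) * (G p n ρ * (G p n (j + ρ) * a))) (G-zero (2 * n + r ∸ ρ) (2 * n) lt))
      (aux (p ^ (ρ * (ρ + j))) (G p n ρ) (G p n (j + ρ)))
      where
      aux : ∀ a b c → a * (b * (c * 0)) ≡ 0
      aux = solve-∀
      lt : 2 * n + r ∸ ρ < 2 * n
      lt = subst (2 * n + r ∸ ρ <_) (m+n∸n≡m (2 * n) r)
        (∸-monoʳ-< r<ρ (≤-trans ρ≤n (≤-trans (m≤m+n n (n + 0)) (m≤m+n (2 * n) r))))

  -- The weights q^(3j²/2+j) of j and -j together, with j = 0 taken once.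
  v : ℕ → ℕ
  v j = t ^ d j + ifPos j (t ^ u j)

  seedTerm : ℕ → ℕ → ℕ → ℕ
  seedTerm n m k = t ^ (m * m) * (G q (n * 3) m * G p (2 * n + k) k)

  private
    α β : ℕ → ℕ → ℕ
    α n x = t ^ u x * G p n x
    β n y = t ^ d y * G p n y

    -- The left side is a coefficient of (-zt;q)_(3n). In the class of s modulo 3 the factors have
    -- ratio q³ = p and initial term t q^s, that is t, t³ = h, t⁵. Rothe's theorem then gives the
    -- powers t^(3x²-2x), h^(κ²), t^(3y²+2y) for s = 0, 1, 2; `α` and `β` belong to classes 0 and 2.
    cubic-split : ∀ n m → t ^ (m * m) * G q (n * 3) m
      ≡ conv (λ κ → h ^ (κ * κ) * G p n κ) (conv (α n) (β n)) m
    cubic-split n m = begin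
      t ^ (m * m) * G q (n * 3) m
        ≡⟨ rothe q t (λ m → t ^ (m * m)) refl w₀ (n * 3) m ⟨
      elem (λ k → t * q ^ k) (n * 3) m
        ≡⟨ elem-thirds (λ k → t * q ^ k) n m ⟩
      conv (elem (λ k → t * q ^ (1 + k * 3)) n)
        (conv (elem (λ k → t * q ^ (k * 3)) n) (elem (λ k → t * q ^ (2 + k * 3)) n)) m
        ≡⟨ conv-cong (third 1 h (aux₁ t) (λ m → h ^ (m * m)) refl w₁)
             (conv-cong (third 0 t (*-identityʳ t) (λ m → t ^ u m) refl w₂)
                        (third 2 (t ^ 5) (aux₅ t) (λ m → t ^ d m) refl w₃)) m ⟩
      conv (λ κ → h ^ (κ * κ) * G p n κ) (conv (α n) (β n)) m ∎
      where
      aux₁ : ∀ t → t * (t * (t * 1) * 1) ≡ t * (t * (t * 1))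
      aux₁ = solve-∀
      aux₅ : ∀ t → t * ((t * (t * 1)) * ((t * (t * 1)) * 1)) ≡ t * (t * (t * (t * (t * 1))))
      aux₅ = solve-∀
      third : ∀ s y → t * q ^ s ≡ y → (w : ℕ → ℕ) → w 0 ≡ 1 → (∀ m → w (suc m) ≡ w m * (y * p ^ m)) →
        ∀ m → elem (λ k → t * q ^ (s + k * 3)) n m ≡ w m * G p n m
      third s y e w w0 ws m = trans (elem-cong (λ k → begin
          t * q ^ (s + k * 3)      ≡⟨ cong (t *_) (^-distribˡ-+-* q s (k * 3)) ⟩
          t * (q ^ s * q ^ (k * 3)) ≡⟨ *-assoc t _ _ ⟨
          t * q ^ s * q ^ (k * 3)
            ≡⟨ cong₂ _*_ e (trans (cong (q ^_) (*-comm k 3)) (trans (sym (^-*-assoc q 3 k)) (cong (_^ k) q³≡p))) ⟩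
          y * p ^ k                ∎) n m)
        (rothe p y w w0 ws n m)
      t^ : ∀ a b → t ^ a * t ^ b ≡ t ^ (a + b)
      t^ a b = sym (^-distribˡ-+-* t a b)
      p^t : ∀ m → p ^ m ≡ t ^ (6 * m)
      p^t m = trans (cong (_^ m) (^-*-assoc t 3 2)) (^-*-assoc t 6 m)
      w₀ : ∀ m → t ^ (suc m * suc m) ≡ t ^ (m * m) * (t * q ^ m)
      w₀ m = sym (begin
        t ^ (m * m) * (t * q ^ m)      ≡⟨ cong (λ x → t ^ (m * m) * (t * x)) (^-*-assoc t 2 m) ⟩
        t ^ (m * m) * t ^ (1 + 2 * m)  ≡⟨ t^ (m * m) (1 + 2 * m) ⟩
        t ^ (m * m + (1 + 2 * m))      ≡⟨ cong (t ^_) (e m) ⟩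
        t ^ (suc m * suc m)            ∎)
        where
        e : ∀ m → m * m + (1 + 2 * m) ≡ suc m * suc m
        e = solve-∀
      w₁ : ∀ m → h ^ (suc m * suc m) ≡ h ^ (m * m) * (h * p ^ m)
      w₁ m = sym (begin
        h ^ (m * m) * (h * p ^ m)      ≡⟨ cong (λ x → h ^ (m * m) * (h * x)) (^-*-assoc h 2 m) ⟩
        h ^ (m * m) * h ^ (1 + 2 * m)  ≡⟨ ^-distribˡ-+-* h (m * m) (1 + 2 * m) ⟨
        h ^ (m * m + (1 + 2 * m))      ≡⟨ cong (h ^_) (e m) ⟩
        h ^ (suc m * suc m)            ∎)
        where
        e : ∀ m → m * m + (1 + 2 * m) ≡ suc m * suc m
        e = solve-∀
      w₂ : ∀ m → t ^ u (suc m) ≡ t ^ u m * (t * p ^ m)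
      w₂ m = sym (begin
        t ^ u m * (t * p ^ m)          ≡⟨ cong (λ x → t ^ u m * (t * x)) (p^t m) ⟩
        t ^ u m * t ^ (1 + 6 * m)      ≡⟨ t^ (u m) (1 + 6 * m) ⟩
        t ^ (u m + (1 + 6 * m))        ≡⟨ cong (t ^_) e ⟩
        t ^ u (suc m)                  ∎)
        where
        e₁ : ∀ x m → x + (1 + 6 * m) + 2 * m ≡ x + 2 * m + (1 + 6 * m)
        e₁ = solve-∀
        e₂ : ∀ m → 3 * (m * m) + (1 + 6 * m) ≡ suc m * (3 * m + 1) + 2 * m
        e₂ = solve-∀
        e : u m + (1 + 6 * m) ≡ u (suc m)
        e = +-cancelʳ-≡ (2 * m) _ _ (trans (e₁ (u m) m) (trans (cong (_+ (1 + 6 * m)) (u-spec m)) (e₂ m)))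
      w₃ : ∀ m → t ^ d (suc m) ≡ t ^ d m * (t ^ 5 * p ^ m)
      w₃ m = sym (begin
        t ^ d m * (t ^ 5 * p ^ m)      ≡⟨ cong (λ x → t ^ d m * (t ^ 5 * x)) (p^t m) ⟩
        t ^ d m * (t ^ 5 * t ^ (6 * m)) ≡⟨ cong (t ^ d m *_) (t^ 5 (6 * m)) ⟩
        t ^ d m * t ^ (5 + 6 * m)      ≡⟨ t^ (d m) (5 + 6 * m) ⟩
        t ^ (d m + (5 + 6 * m))        ≡⟨ cong (t ^_) (e m) ⟩
        t ^ d (suc m)                  ∎)
        where
        e : ∀ m → 3 * (m * m) + 2 * m + (5 + 6 * m) ≡ 3 * (suc m * suc m) + 2 * suc m
        e = solve-∀

    module _ (n : ℕ) where
      Z : ℕ → ℕ → ℕ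
      Z j r = G p (n + j + r) r * G p (n + (r + 0)) (r + 0 + j)

      -- The factor `G p (2 * n + c) c` is the coefficient of z^(2c) in 1/(z²;p)_(2n+1).
      g : ℕ → ℕ → ℕ → ℕ
      g x y c = α n x * (β n y * G p (2 * n + c) c)

      powers : ∀ a b c e → a + b ≡ e + 2 * (3 * c) → t ^ a * t ^ b ≡ t ^ e * p ^ c
      powers a b c e eq = begin
        t ^ a * t ^ b                  ≡⟨ ^-distribˡ-+-* t a b ⟨
        t ^ (a + b)                    ≡⟨ cong (t ^_) eq ⟩
        t ^ (e + 2 * (3 * c))          ≡⟨ ^-distribˡ-+-* t e _ ⟩
        t ^ e * t ^ (2 * (3 * c))
          ≡⟨ cong (λ x → t ^ e * t ^ x) (aux c) ⟩
        t ^ e * t ^ (3 * (2 * c))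
          ≡⟨ cong (t ^ e *_) (trans (p^ c) (^-*-assoc t 3 (2 * c))) ⟨
        t ^ e * p ^ c                  ∎
        where
        aux : ∀ c → 2 * (3 * c) ≡ 3 * (2 * c)
        aux = solve-∀

      diagonal : ∀ j r e (f : ℕ → ℕ → ℕ) →
        (∀ ρ c → f ρ c ≡ t ^ e * (p ^ (ρ * (ρ + j)) * (G p n ρ * (G p n (j + ρ) * G p (2 * n + c) c)))) →
        Σ⁺ r f ≡ t ^ e * Z j r
      diagonal j r e f eq = trans (Σ⁺-cong r λ ρ c _ → eq ρ c)
        (trans (Σ⁺-* r (t ^ e) _) (cong (t ^ e *_) (saalschütz-diagonal n r j)))

      -- Here x = ρ and y = j + ρ, and the linear parts of the exponents cancel up to that of j:
      -- u(ρ) + d(j+ρ) = d(j) + 6ρ(ρ+j). As p = t⁶, exactly the weight of `saalschütz-diagonal`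
      -- remains.
      upper : ∀ j r → Σᵐⁱⁿ r (j + r) g ≡ t ^ d j * Z j r
      upper j r = trans (Σᵐⁱⁿ-≤ j r g) (diagonal j r (d j) _ λ ρ c → begin
        t ^ u ρ * G p n ρ * (t ^ d (j + ρ) * G p n (j + ρ) * G p (2 * n + c) c)
          ≡⟨ aux (t ^ u ρ) (G p n ρ) (t ^ d (j + ρ)) _ _ ⟩
        t ^ u ρ * t ^ d (j + ρ) * (G p n ρ * (G p n (j + ρ) * G p (2 * n + c) c))
          ≡⟨ cong (_* (G p n ρ * (G p n (j + ρ) * G p (2 * n + c) c)))
               (powers (u ρ) (d (j + ρ)) (ρ * (ρ + j)) (d j) (exponents ρ)) ⟩
        t ^ d j * p ^ (ρ * (ρ + j)) * (G p n ρ * (G p n (j + ρ) * G p (2 * n + c) c))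
          ≡⟨ *-assoc (t ^ d j) _ _ ⟩
        t ^ d j * (p ^ (ρ * (ρ + j)) * (G p n ρ * (G p n (j + ρ) * G p (2 * n + c) c))) ∎)
        where
        aux : ∀ a b c d e → a * b * (c * d * e) ≡ a * c * (b * (d * e))
        aux = solve-∀
        e₁ : ∀ x j ρ → x + (3 * ((j + ρ) * (j + ρ)) + 2 * (j + ρ))
          ≡ x + 2 * ρ + (3 * ((j + ρ) * (j + ρ)) + 2 * j)
        e₁ = solve-∀
        e₂ : ∀ j ρ → 3 * (ρ * ρ) + (3 * ((j + ρ) * (j + ρ)) + 2 * j)
          ≡ 3 * (j * j) + 2 * j + 2 * (3 * (ρ * (ρ + j)))
        e₂ = solve-∀
        exponents : ∀ ρ → u ρ + d (j + ρ) ≡ d j + 2 * (3 * (ρ * (ρ + j)))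
        exponents ρ = trans (e₁ (u ρ) j ρ) (trans (cong (_+ (3 * ((j + ρ) * (j + ρ)) + 2 * j)) (u-spec ρ)) (e₂ j ρ))

      -- With the roles of the two classes exchanged, u(j+ρ) + d(ρ) = u(j) + 6ρ(ρ+j). The sum over ρ
      -- is the same as above the diagonal, which is why j and -j meet the same trinomial.
      lower : ∀ j r → Σᵐⁱⁿ (j + r) r g ≡ t ^ u j * Z j r
      lower j r = trans (Σᵐⁱⁿ-≥ j r g) (diagonal j r (u j) _ λ ρ c → begin
        t ^ u (j + ρ) * G p n (j + ρ) * (t ^ d ρ * G p n ρ * G p (2 * n + c) c)
          ≡⟨ aux (t ^ u (j + ρ)) (G p n (j + ρ)) (t ^ d ρ) _ _ ⟩
        t ^ u (j + ρ) * t ^ d ρ * (G p n ρ * (G p n (j + ρ) * G p (2 * n + c) c))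
          ≡⟨ cong (_* (G p n ρ * (G p n (j + ρ) * G p (2 * n + c) c)))
               (powers (u (j + ρ)) (d ρ) (ρ * (ρ + j)) (u j) (exponents ρ)) ⟩
        t ^ u j * p ^ (ρ * (ρ + j)) * (G p n ρ * (G p n (j + ρ) * G p (2 * n + c) c))
          ≡⟨ *-assoc (t ^ u j) _ _ ⟩
        t ^ u j * (p ^ (ρ * (ρ + j)) * (G p n ρ * (G p n (j + ρ) * G p (2 * n + c) c))) ∎)
        where
        aux : ∀ a b c d e → a * b * (c * d * e) ≡ a * c * (d * (b * e))
        aux = solve-∀
        e₁ : ∀ x j ρ → x + (3 * (ρ * ρ) + 2 * ρ) + 2 * j ≡ x + 2 * (j + ρ) + 3 * (ρ * ρ)
        e₁ = solve-∀
        e₂ : ∀ j ρ → 3 * ((j + ρ) * (j + ρ)) + 3 * (ρ * ρ) ≡ 3 * (j * j) + 2 * (3 * (ρ * (ρ + j)))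
        e₂ = solve-∀
        e₃ : ∀ x j y → x + 2 * j + y ≡ x + y + 2 * j
        e₃ = solve-∀
        exponents : ∀ ρ → u (j + ρ) + d ρ ≡ u j + 2 * (3 * (ρ * (ρ + j)))
        exponents ρ = +-cancelʳ-≡ (2 * j) _ _ (begin
          u (j + ρ) + d ρ + 2 * j                  ≡⟨ e₁ (u (j + ρ)) j ρ ⟩
          u (j + ρ) + 2 * (j + ρ) + 3 * (ρ * ρ)    ≡⟨ cong (_+ 3 * (ρ * ρ)) (u-spec (j + ρ)) ⟩
          3 * ((j + ρ) * (j + ρ)) + 3 * (ρ * ρ)    ≡⟨ e₂ j ρ ⟩
          3 * (j * j) + 2 * (3 * (ρ * (ρ + j)))    ≡⟨ cong (_+ 2 * (3 * (ρ * (ρ + j)))) (u-spec j) ⟨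
          u j + 2 * j + 2 * (3 * (ρ * (ρ + j)))    ≡⟨ e₃ (u j) j _ ⟩
          u j + 2 * (3 * (ρ * (ρ + j))) + 2 * j    ∎)

      both : ∀ w → Σ² w (λ m c → Σ⁺ m (λ x y → g x y c)) ≡ Σ² w (λ j r → v j * Z j r)
      both w = begin
        Σ² w (λ m c → Σ⁺ m (λ x y → g x y c))
          ≡⟨ Σ²Σ⁺-min w g ⟩
        Σ⁺ w (λ r s → Σᵐⁱⁿ r s g)
          ≡⟨ Σ⁺-diagonals w (λ r s → Σᵐⁱⁿ r s g) ⟩
        Σ² w (λ j r → Σᵐⁱⁿ r (j + r) g + ifPos j (Σᵐⁱⁿ (j + r) r g))
          ≡⟨ Σ²-cong w (λ j r _ → trans (cong₂ (λ a b → a + ifPos j b) (upper j r) (lower j r)) (merge j r)) ⟩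
        Σ² w (λ j r → v j * Z j r) ∎
        where
        merge : ∀ j r → t ^ d j * Z j r + ifPos j (t ^ u j * Z j r) ≡ v j * Z j r
        merge zero    r = sym (*-distribʳ-+ (Z 0 r) (t ^ d 0) 0)
        merge (suc j) r = sym (*-distribʳ-+ (Z (suc j) r) (t ^ d (suc j)) (t ^ u (suc j)))

  -- For each index κ of class 1, the other two classes and the denominator are summed by `both`.
  -- The κ-sum is then moved inside, where it supplies the missing factor of the trinomial's
  -- summand. `J` is an arbitrary bound above `L`, so that one range of j serves all values of `L`
  -- occurring later.
  seed : ∀ L n J → L < J → Σ² L (seedTerm n) ≡ Σ< J (λ j → v j * T L n 0 j)
  seed L n J L<J = begin
    Σ² L (seedTerm n)
      ≡⟨ Σ²-cong L (λ m k _ → expand m k) ⟩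
    Σ² L (λ m k → Σ⁺ m (λ κ w → Σ⁺ w (λ x y → b κ * g n x y k)))
      ≡⟨ Σ⁺Σ² L (λ κ w k → Σ⁺ w (λ x y → b κ * g n x y k)) ⟨
    Σ⁺ L (λ κ w → Σ² w (λ m k → Σ⁺ m (λ x y → b κ * g n x y k)))
      ≡⟨ Σ⁺-cong L (λ κ w _ → inner κ w) ⟩
    Σ⁺ L (λ κ w → Σ² w (λ j r → v j * trinomialTerm n 0 j κ r))
      ≡⟨ Σ⁺Σ² L (λ κ j r → v j * trinomialTerm n 0 j κ r) ⟩
    Σ² L (λ m r → Σ⁺ m (λ κ j → v j * trinomialTerm n 0 j κ r))
      ≡⟨ Σ²-cong L (λ m r _ → Σ⁺-swap m (λ κ j → v j * trinomialTerm n 0 j κ r)) ⟩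
    Σ² L (λ m r → Σ⁺ m (λ j κ → v j * trinomialTerm n 0 j κ r))
      ≡⟨ Σ⁺Σ² L (λ j κ r → v j * trinomialTerm n 0 j κ r) ⟨
    Σ⁺ L (λ j w → Σ² w (λ κ r → v j * trinomialTerm n 0 j κ r))
      ≡⟨ Σ⁺-bounded L _ J L<J ⟩
    Σ< J (λ j → shift j L (λ w → Σ² w (λ κ r → v j * trinomialTerm n 0 j κ r)))
      ≡⟨ Σ<-cong J (λ j _ → begin
           shift j L (λ w → Σ² w (λ κ r → v j * trinomialTerm n 0 j κ r))
             ≡⟨ shift-cong j L (λ w _ → Σ²-* w (v j) (trinomialTerm n 0 j)) ⟩
           shift j L (λ w → v j * Σ² w (trinomialTerm n 0 j))
             ≡⟨ shift-* j L (v j) _ ⟩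
           v j * shift j L (λ w → Σ² w (trinomialTerm n 0 j))
             ≡⟨ cong (λ a → v j * shift a L (λ w → Σ² w (trinomialTerm n 0 j))) (+-identityʳ j) ⟨
           v j * T L n 0 j ∎) ⟩
    Σ< J (λ j → v j * T L n 0 j) ∎
    where
    b : ℕ → ℕ
    b κ = h ^ (κ * κ) * G p n κ
    expand : ∀ m k → seedTerm n m k ≡ Σ⁺ m (λ κ w → Σ⁺ w (λ x y → b κ * g n x y k))
    expand m k = begin
      t ^ (m * m) * (G q (n * 3) m * s)
        ≡⟨ *-assoc (t ^ (m * m)) _ _ ⟨
      t ^ (m * m) * G q (n * 3) m * s
        ≡⟨ cong (_* s) (cubic-split n m) ⟩
      Σ⁺ m (λ κ w → b κ * conv (α n) (β n) w) * s
        ≡⟨ *-comm _ s ⟩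
      s * Σ⁺ m (λ κ w → b κ * conv (α n) (β n) w)
        ≡⟨ Σ⁺-* m s _ ⟨
      Σ⁺ m (λ κ w → s * (b κ * conv (α n) (β n) w))
        ≡⟨ Σ⁺-cong m (λ κ w _ → begin
             s * (b κ * conv (α n) (β n) w)
               ≡⟨ *-assoc s (b κ) _ ⟨
             s * b κ * conv (α n) (β n) w
               ≡⟨ Σ⁺-* w (s * b κ) (λ x y → α n x * β n y) ⟨
             Σ⁺ w (λ x y → s * b κ * (α n x * β n y))
               ≡⟨ Σ⁺-cong w (λ x y _ → aux s (b κ) (α n x) (β n y)) ⟩
             Σ⁺ w (λ x y → b κ * g n x y k) ∎) ⟩
      Σ⁺ m (λ κ w → Σ⁺ w (λ x y → b κ * g n x y k)) ∎
      where
      s = G p (2 * n + k) k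
      aux : ∀ s b x y → s * b * (x * y) ≡ b * (x * (y * s))
      aux = solve-∀
    inner : ∀ κ w → Σ² w (λ m k → Σ⁺ m (λ x y → b κ * g n x y k))
      ≡ Σ² w (λ j r → v j * trinomialTerm n 0 j κ r)
    inner κ w = begin
      Σ² w (λ m k → Σ⁺ m (λ x y → b κ * g n x y k))
        ≡⟨ Σ²-cong w (λ m k _ → Σ⁺-* m (b κ) (λ x y → g n x y k)) ⟩
      Σ² w (λ m k → b κ * Σ⁺ m (λ x y → g n x y k))
        ≡⟨ Σ²-* w (b κ) _ ⟩
      b κ * Σ² w (λ m k → Σ⁺ m (λ x y → g n x y k))
        ≡⟨ cong (b κ *_) (both n w) ⟩
      b κ * Σ² w (λ j r → v j * Z n j r)
        ≡⟨ Σ²-* w (b κ) _ ⟨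
      Σ² w (λ j r → b κ * (v j * Z n j r))
        ≡⟨ Σ²-cong w (λ j r _ → aux (h ^ (κ * κ)) (G p n κ) (v j) (Z n j r)) ⟩
      Σ² w (λ j r → v j * trinomialTerm n 0 j κ r) ∎
      where
      aux : ∀ a b c d → a * b * (c * d) ≡ c * (a * (b * d))
      aux = solve-∀

-- The ring of formal power series

infix 4 _≈_
_≈_ : Series → Series → Set
a ≈ b = ∀ n → a n ≡ b n

tail : Series → Series
tail a n = a (suc n)

⊗-unfold : ∀ a b n → (a ⊗ b) n ≡ sumℤ (applyUpTo (λ k → a k ℤ.* b (n ∸ k)) (suc n))
⊗-unfold a b n = cong sumℤ (map-upTo (λ k → a k ℤ.* b (n ∸ k)) (suc n))

⊗-zero : ∀ a b → (a ⊗ b) 0 ≡ a 0 ℤ.* b 0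
⊗-zero a b = ℤ.+-identityʳ _

-- Splitting off the constant term of the left factor gives a recursion for the Cauchy product; the
-- ring laws follow from it by induction on the index of the coefficient.
⊗-suc : ∀ a b n → (a ⊗ b) (suc n) ≡ a 0 ℤ.* b (suc n) ℤ.+ (tail a ⊗ b) n
⊗-suc a b n = trans (⊗-unfold a b (suc n)) (cong (λ z → a 0 ℤ.* b (suc n) ℤ.+ z) (sym (⊗-unfold (tail a) b n)))

⊗-cong : ∀ {a b c d} → a ≈ b → c ≈ d → a ⊗ c ≈ b ⊗ d
⊗-cong {a} {b} {c} {d} e e′ zero    =
  trans (⊗-zero a c) (trans (cong₂ ℤ._*_ (e 0) (e′ 0)) (sym (⊗-zero b d)))
⊗-cong {a} {b} {c} {d} e e′ (suc n) = begin
  (a ⊗ c) (suc n)                              ≡⟨ ⊗-suc a c n ⟩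
  a 0 ℤ.* c (suc n) ℤ.+ (tail a ⊗ c) n
    ≡⟨ cong₂ ℤ._+_ (cong₂ ℤ._*_ (e 0) (e′ (suc n))) (⊗-cong (λ k → e (suc k)) e′ n) ⟩
  b 0 ℤ.* d (suc n) ℤ.+ (tail b ⊗ d) n         ≡⟨ ⊗-suc b d n ⟨
  (b ⊗ d) (suc n)                              ∎

⊗-zeroˡ : ∀ b → 0S ⊗ b ≈ 0S
⊗-zeroˡ b zero    = ⊗-zero 0S b
⊗-zeroˡ b (suc n) = trans (⊗-suc 0S b n) (trans (ℤ.+-identityˡ _) (⊗-zeroˡ b n))

⊗-identityˡ : ∀ a → 1S ⊗ a ≈ a
⊗-identityˡ a zero    = trans (⊗-zero 1S a) (ℤ.*-identityˡ _)
⊗-identityˡ a (suc n) = trans (⊗-suc 1S a n)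
  (trans (cong₂ ℤ._+_ (ℤ.*-identityˡ (a (suc n))) (⊗-zeroˡ a n)) (ℤ.+-identityʳ _))

⊗-distribʳ : ∀ c a b → (a ⊕ b) ⊗ c ≈ (a ⊗ c) ⊕ (b ⊗ c)
⊗-distribʳ c a b zero    = trans (⊗-zero (a ⊕ b) c)
  (trans (ℤ.*-distribʳ-+ (c 0) (a 0) (b 0)) (sym (cong₂ ℤ._+_ (⊗-zero a c) (⊗-zero b c))))
⊗-distribʳ c a b (suc n) = begin
  ((a ⊕ b) ⊗ c) (suc n)
    ≡⟨ ⊗-suc (a ⊕ b) c n ⟩
  (a 0 ℤ.+ b 0) ℤ.* c (suc n) ℤ.+ ((tail a ⊕ tail b) ⊗ c) n
    ≡⟨ cong (λ z → (a 0 ℤ.+ b 0) ℤ.* c (suc n) ℤ.+ z) (⊗-distribʳ c (tail a) (tail b) n) ⟩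
  (a 0 ℤ.+ b 0) ℤ.* c (suc n) ℤ.+ ((tail a ⊗ c) n ℤ.+ (tail b ⊗ c) n)
    ≡⟨ aux (a 0) (b 0) (c (suc n)) _ _ ⟩
  (a 0 ℤ.* c (suc n) ℤ.+ (tail a ⊗ c) n) ℤ.+ (b 0 ℤ.* c (suc n) ℤ.+ (tail b ⊗ c) n)
    ≡⟨ cong₂ ℤ._+_ (⊗-suc a c n) (⊗-suc b c n) ⟨
  ((a ⊗ c) ⊕ (b ⊗ c)) (suc n) ∎
  where
  aux : ∀ x y z u v → (x ℤ.+ y) ℤ.* z ℤ.+ (u ℤ.+ v) ≡ (x ℤ.* z ℤ.+ u) ℤ.+ (y ℤ.* z ℤ.+ v)
  aux = ℤSolver.solve-∀

⊗-scale : ∀ x b c → (λ n → x ℤ.* b n) ⊗ c ≈ (λ n → x ℤ.* (b ⊗ c) n)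
⊗-scale x b c zero    = trans (⊗-zero (λ n → x ℤ.* b n) c)
  (trans (ℤ.*-assoc x (b 0) (c 0)) (cong (x ℤ.*_) (sym (⊗-zero b c))))
⊗-scale x b c (suc n) = begin
  ((λ n → x ℤ.* b n) ⊗ c) (suc n)
    ≡⟨ ⊗-suc (λ n → x ℤ.* b n) c n ⟩
  x ℤ.* b 0 ℤ.* c (suc n) ℤ.+ ((λ n → x ℤ.* b (suc n)) ⊗ c) n
    ≡⟨ cong (λ z → x ℤ.* b 0 ℤ.* c (suc n) ℤ.+ z) (⊗-scale x (tail b) c n) ⟩
  x ℤ.* b 0 ℤ.* c (suc n) ℤ.+ x ℤ.* (tail b ⊗ c) n
    ≡⟨ aux x (b 0) (c (suc n)) _ ⟩
  x ℤ.* (b 0 ℤ.* c (suc n) ℤ.+ (tail b ⊗ c) n)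
    ≡⟨ cong (x ℤ.*_) (⊗-suc b c n) ⟨
  x ℤ.* (b ⊗ c) (suc n) ∎
  where
  aux : ∀ x y z u → x ℤ.* y ℤ.* z ℤ.+ x ℤ.* u ≡ x ℤ.* (y ℤ.* z ℤ.+ u)
  aux = ℤSolver.solve-∀

⊗-assoc : ∀ a b c → (a ⊗ b) ⊗ c ≈ a ⊗ (b ⊗ c)
⊗-assoc a b c zero    = begin
  ((a ⊗ b) ⊗ c) 0           ≡⟨ ⊗-zero (a ⊗ b) c ⟩
  (a ⊗ b) 0 ℤ.* c 0         ≡⟨ cong (ℤ._* c 0) (⊗-zero a b) ⟩
  a 0 ℤ.* b 0 ℤ.* c 0       ≡⟨ ℤ.*-assoc (a 0) (b 0) (c 0) ⟩
  a 0 ℤ.* (b 0 ℤ.* c 0)     ≡⟨ cong (a 0 ℤ.*_) (⊗-zero b c) ⟨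
  a 0 ℤ.* (b ⊗ c) 0         ≡⟨ ⊗-zero a (b ⊗ c) ⟨
  (a ⊗ (b ⊗ c)) 0           ∎
⊗-assoc a b c (suc n) = begin
  ((a ⊗ b) ⊗ c) (suc n)
    ≡⟨ ⊗-suc (a ⊗ b) c n ⟩
  (a ⊗ b) 0 ℤ.* c (suc n) ℤ.+ (tail (a ⊗ b) ⊗ c) n
    ≡⟨ cong₂ (λ x y → x ℤ.* c (suc n) ℤ.+ y) (⊗-zero a b) (begin
         (tail (a ⊗ b) ⊗ c) n
           ≡⟨ ⊗-cong {d = c} (⊗-suc a b) (λ _ → refl) n ⟩
         (((λ n → a 0 ℤ.* b (suc n)) ⊕ (tail a ⊗ b)) ⊗ c) n
           ≡⟨ ⊗-distribʳ c (λ n → a 0 ℤ.* b (suc n)) (tail a ⊗ b) n ⟩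
         ((λ n → a 0 ℤ.* b (suc n)) ⊗ c) n ℤ.+ ((tail a ⊗ b) ⊗ c) n
           ≡⟨ cong₂ ℤ._+_ (⊗-scale (a 0) (tail b) c n) (⊗-assoc (tail a) b c n) ⟩
         a 0 ℤ.* (tail b ⊗ c) n ℤ.+ (tail a ⊗ (b ⊗ c)) n ∎) ⟩
  a 0 ℤ.* b 0 ℤ.* c (suc n) ℤ.+ (a 0 ℤ.* (tail b ⊗ c) n ℤ.+ (tail a ⊗ (b ⊗ c)) n)
    ≡⟨ aux (a 0) (b 0) (c (suc n)) _ _ ⟩
  a 0 ℤ.* (b 0 ℤ.* c (suc n) ℤ.+ (tail b ⊗ c) n) ℤ.+ (tail a ⊗ (b ⊗ c)) n
    ≡⟨ cong (λ x → a 0 ℤ.* x ℤ.+ (tail a ⊗ (b ⊗ c)) n) (⊗-suc b c n) ⟨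
  a 0 ℤ.* (b ⊗ c) (suc n) ℤ.+ (tail a ⊗ (b ⊗ c)) n
    ≡⟨ ⊗-suc a (b ⊗ c) n ⟨
  (a ⊗ (b ⊗ c)) (suc n) ∎
  where
  aux : ∀ x y z u v → x ℤ.* y ℤ.* z ℤ.+ (x ℤ.* u ℤ.+ v) ≡ x ℤ.* (y ℤ.* z ℤ.+ u) ℤ.+ v
  aux = ℤSolver.solve-∀

-- The mirror recursion, with the constant term of the right factor split off. The two together give
-- commutativity.
⊗-sucʳ : ∀ a b n → (a ⊗ b) (suc n) ≡ a (suc n) ℤ.* b 0 ℤ.+ (a ⊗ tail b) n
⊗-sucʳ a b zero    = begin
  (a ⊗ b) 1                                  ≡⟨ ⊗-suc a b 0 ⟩
  a 0 ℤ.* b 1 ℤ.+ (tail a ⊗ b) 0             ≡⟨ cong (λ z → a 0 ℤ.* b 1 ℤ.+ z) (⊗-zero (tail a) b) ⟩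
  a 0 ℤ.* b 1 ℤ.+ a 1 ℤ.* b 0                ≡⟨ ℤ.+-comm (a 0 ℤ.* b 1) _ ⟩
  a 1 ℤ.* b 0 ℤ.+ a 0 ℤ.* b 1                ≡⟨ cong (λ z → a 1 ℤ.* b 0 ℤ.+ z) (⊗-zero a (tail b)) ⟨
  a 1 ℤ.* b 0 ℤ.+ (a ⊗ tail b) 0             ∎
⊗-sucʳ a b (suc n) = begin
  (a ⊗ b) (2 + n)
    ≡⟨ ⊗-suc a b (suc n) ⟩
  a 0 ℤ.* b (2 + n) ℤ.+ (tail a ⊗ b) (suc n)
    ≡⟨ cong (λ z → a 0 ℤ.* b (2 + n) ℤ.+ z) (⊗-sucʳ (tail a) b n) ⟩
  a 0 ℤ.* b (2 + n) ℤ.+ (a (2 + n) ℤ.* b 0 ℤ.+ (tail a ⊗ tail b) n)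
    ≡⟨ aux (a 0 ℤ.* b (2 + n)) (a (2 + n) ℤ.* b 0) _ ⟩
  a (2 + n) ℤ.* b 0 ℤ.+ (a 0 ℤ.* b (2 + n) ℤ.+ (tail a ⊗ tail b) n)
    ≡⟨ cong (λ z → a (2 + n) ℤ.* b 0 ℤ.+ z) (⊗-suc a (tail b) n) ⟨
  a (2 + n) ℤ.* b 0 ℤ.+ (a ⊗ tail b) (suc n) ∎
  where
  aux : ∀ x y z → x ℤ.+ (y ℤ.+ z) ≡ y ℤ.+ (x ℤ.+ z)
  aux = ℤSolver.solve-∀

⊗-comm : ∀ a b → a ⊗ b ≈ b ⊗ a
⊗-comm a b zero    = trans (⊗-zero a b) (trans (ℤ.*-comm (a 0) (b 0)) (sym (⊗-zero b a)))
⊗-comm a b (suc n) = begin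
  (a ⊗ b) (suc n)                           ≡⟨ ⊗-suc a b n ⟩
  a 0 ℤ.* b (suc n) ℤ.+ (tail a ⊗ b) n      ≡⟨ cong₂ ℤ._+_ (ℤ.*-comm (a 0) _) (⊗-comm (tail a) b n) ⟩
  b (suc n) ℤ.* a 0 ℤ.+ (b ⊗ tail a) n      ≡⟨ ⊗-sucʳ b a n ⟨
  (b ⊗ a) (suc n)                           ∎

neg : Series → Series
neg a n = ℤ.- a n

≈-isEquivalence : IsEquivalence _≈_
≈-isEquivalence = record
  { refl  = λ _ → refl
  ; sym   = λ e n → sym (e n)
  ; trans = λ e e′ n → trans (e n) (e′ n)
  }

series-isCommutativeRing : IsCommutativeRing _≈_ _⊕_ _⊗_ neg 0S 1S
series-isCommutativeRing = record
  { isRing = record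
    { +-isAbelianGroup = record
      { isGroup = record
        { isMonoid = record
          { isSemigroup = record
            { isMagma = record
              { isEquivalence = ≈-isEquivalence
              ; ∙-cong        = λ e e′ n → cong₂ ℤ._+_ (e n) (e′ n)
              }
            ; assoc = λ a b c n → ℤ.+-assoc (a n) (b n) (c n)
            }
          ; identity = (λ a n → ℤ.+-identityˡ (a n)) , (λ a n → ℤ.+-identityʳ (a n))
          }
        ; inverse = (λ a n → ℤ.+-inverseˡ (a n)) , (λ a n → ℤ.+-inverseʳ (a n))
        ; ⁻¹-cong = λ e n → cong ℤ.-_ (e n)
        }
      ; comm = λ a b n → ℤ.+-comm (a n) (b n)
      }
    ; *-cong     = ⊗-cong
    ; *-assoc    = ⊗-assoc
    ; *-identity = ⊗-identityˡ , λ a n → trans (⊗-comm a 1S n) (⊗-identityˡ a n)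
    ; distrib    = (λ c a b n → trans (⊗-comm c (a ⊕ b) n) (trans (⊗-distribʳ c a b n)
                     (cong₂ ℤ._+_ (⊗-comm a c n) (⊗-comm b c n)))) , ⊗-distribʳ
    }
  ; *-comm = ⊗-comm
  }

seriesRing : CommutativeRing 0ℓ 0ℓ
seriesRing = record { isCommutativeRing = series-isCommutativeRing }

module Ring = CommutativeRing seriesRing
open SetoidReasoning Ring.setoid using (step-≈-⟩; step-≈-⟨) renaming (begin_ to begin≈_; _∎ to _∎≈)
module Solver = CommutativeMonoidSolver Ring.*-commutativeMonoid

-- Inverses, q-factorials and Gaussian binomials as power series

invRev-spec : ∀ a n → invRev a n ≡ applyUpTo (λ k → inv a (n ∸ k)) (suc n)
invRev-spec a zero    = refl
invRev-spec a (suc n) = cong (inv a (suc n) ∷_) (invRev-spec a n)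

zipWith-applyUpTo : ∀ (f : ℕ → ℤ → ℤ) g h n →
  zipWith f (applyUpTo g n) (applyUpTo h n) ≡ applyUpTo (λ k → f (g k) (h k)) n
zipWith-applyUpTo f g h zero    = refl
zipWith-applyUpTo f g h (suc n) = cong (f (g 0) (h 0) ∷_)
  (zipWith-applyUpTo f (λ k → g (suc k)) (λ k → h (suc k)) n)

inv-suc : ∀ a n → inv a (suc n) ≡ ℤ.- (tail a ⊗ inv a) n
inv-suc a n = cong (λ x → ℤ.- sumℤ x) (begin
  zipWith (λ k b → a k ℤ.* b) (map suc (upTo (suc n))) (invRev a n)
    ≡⟨ cong₂ (zipWith (λ k b → a k ℤ.* b)) (map-upTo suc (suc n)) (invRev-spec a n) ⟩
  zipWith (λ k b → a k ℤ.* b) (applyUpTo suc (suc n)) (applyUpTo (λ k → inv a (n ∸ k)) (suc n))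
    ≡⟨ zipWith-applyUpTo (λ k b → a k ℤ.* b) suc (λ k → inv a (n ∸ k)) (suc n) ⟩
  applyUpTo (λ k → a (suc k) ℤ.* inv a (n ∸ k)) (suc n)
    ≡⟨ map-upTo (λ k → a (suc k) ℤ.* inv a (n ∸ k)) (suc n) ⟨
  map (λ k → a (suc k) ℤ.* inv a (n ∸ k)) (upTo (suc n)) ∎)

inv-inverse : ∀ a → a 0 ≡ ⁺ 1 → a ⊗ inv a ≈ 1S
inv-inverse a e zero    = trans (⊗-zero a (inv a)) (cong (ℤ._* ⁺ 1) e)
inv-inverse a e (suc n) = begin
  (a ⊗ inv a) (suc n)
    ≡⟨ ⊗-suc a (inv a) n ⟩
  a 0 ℤ.* inv a (suc n) ℤ.+ (tail a ⊗ inv a) n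
    ≡⟨ cong₂ (λ x y → x ℤ.* y ℤ.+ (tail a ⊗ inv a) n) e (inv-suc a n) ⟩
  ⁺ 1 ℤ.* ℤ.- (tail a ⊗ inv a) n ℤ.+ (tail a ⊗ inv a) n
    ≡⟨ cong (ℤ._+ (tail a ⊗ inv a) n) (ℤ.*-identityˡ (ℤ.- (tail a ⊗ inv a) n)) ⟩
  ℤ.- (tail a ⊗ inv a) n ℤ.+ (tail a ⊗ inv a) n
    ≡⟨ ℤ.+-inverseˡ ((tail a ⊗ inv a) n) ⟩
  ⁺ 0 ∎

mono-suc-⊗ : ∀ e a n → (mono (suc e) ⊗ a) (suc n) ≡ (mono e ⊗ a) n
mono-suc-⊗ e a n = trans (⊗-suc (mono (suc e)) a n) (ℤ.+-identityˡ _)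

mono-0 : mono 0 ≈ 1S
mono-0 zero    = refl
mono-0 (suc n) = refl

mono-+ : ∀ d e → mono d ⊗ mono e ≈ mono (d + e)
mono-+ zero    e n       = trans (⊗-cong {d = mono e} mono-0 (λ _ → refl) n) (⊗-identityˡ (mono e) n)
mono-+ (suc d) e zero    = ⊗-zero (mono (suc d)) (mono e)
mono-+ (suc d) e (suc n) = trans (mono-suc-⊗ d (mono e) n) (mono-+ d e n)

1-x^ : ℕ → Series
1-x^ k = 1S ⊕ neg (mono k)

prodS-∷ʳ : ∀ as a → prodS (as ∷ʳ a) ≈ prodS as ⊗ a
prodS-∷ʳ []       a = Ring.*-comm a 1S
prodS-∷ʳ (b ∷ as) a = begin≈
  b ⊗ prodS (as ∷ʳ a)   ≈⟨ ⊗-cong {b} (λ _ → refl) (prodS-∷ʳ as a) ⟩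
  b ⊗ (prodS as ⊗ a)    ≈⟨ ⊗-assoc b (prodS as) a ⟨
  (b ⊗ prodS as) ⊗ a    ∎≈

poch-suc : ∀ n → poch (suc n) ≈ poch n ⊗ 1-x^ (suc n)
poch-suc n k = trans
  (cong (λ ks → prodS ks k) (trans (cong (map f) (sym (upTo-∷ʳ n))) (map-++ f (upTo n) (n ∷ []))))
  (prodS-∷ʳ (map f (upTo n)) (f n) k)
  where
  f : ℕ → Series
  f k = 1S ⊕ (λ t → ℤ.- mono (suc k) t)

poch-0 : ∀ n → poch n 0 ≡ ⁺ 1
poch-0 zero    = refl
poch-0 (suc n) = trans (poch-suc n 0) (trans (⊗-zero (poch n) (1-x^ (suc n))) (cong (ℤ._* ⁺ 1) (poch-0 n)))

-- Pascal's recursion makes it visible that the coefficients are natural numbers, which the quotient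
-- in `gauss` does not.
gaussian : ℕ → ℕ → Series
gaussian a       zero    = 1S
gaussian zero    (suc b) = 0S
gaussian (suc a) (suc b) = gaussian a b ⊕ (mono (suc b) ⊗ gaussian a (suc b))

gaussian-zero : ∀ a b → a < b → gaussian a b ≈ 0S
gaussian-zero zero    (suc b) _       n = refl
gaussian-zero (suc a) (suc b) (s≤s p) n = cong₂ ℤ._+_ (gaussian-zero a b p n)
  (trans (⊗-cong {mono (suc b)} (λ _ → refl) (gaussian-zero a (suc b) (m≤n⇒m≤1+n p)) n)
         (trans (⊗-comm (mono (suc b)) 0S n) (⊗-zeroˡ (mono (suc b)) n)))

gaussian-diag : ∀ a → gaussian a a ≈ 1S
gaussian-diag zero    n = refl
gaussian-diag (suc a) n = trans (cong₂ ℤ._+_ (gaussian-diag a n)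
  (trans (⊗-cong {mono (suc a)} (λ _ → refl) (gaussian-zero a (suc a) ≤-refl) n)
         (trans (⊗-comm (mono (suc a)) 0S n) (⊗-zeroˡ (mono (suc a)) n)))) (ℤ.+-identityʳ _)

1-x^-+ : ∀ d e → 1-x^ d ⊕ (mono d ⊗ 1-x^ e) ≈ 1-x^ (d + e)
1-x^-+ d e = begin≈
  1-x^ d ⊕ (mono d ⊗ 1-x^ e)
    ≈⟨ Ring.+-congˡ {1-x^ d} (proj₁ Ring.distrib (mono d) 1S (neg (mono e))) ⟩
  1-x^ d ⊕ ((mono d ⊗ 1S) ⊕ (mono d ⊗ neg (mono e)))
    ≈⟨ Ring.+-congˡ {1-x^ d} (Ring.+-cong (Ring.*-identityʳ (mono d)) (Ring.sym (-‿distribʳ-* (mono d) (mono e)))) ⟩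
  1-x^ d ⊕ (mono d ⊕ neg (mono d ⊗ mono e))
    ≈⟨ (λ n → aux (1S n) (mono d n) (ℤ.- (mono d ⊗ mono e) n)) ⟩
  1S ⊕ neg (mono d ⊗ mono e)
    ≈⟨ (λ n → cong (λ x → 1S n ℤ.+ ℤ.- x) (mono-+ d e n)) ⟩
  1-x^ (d + e) ∎≈
  where
  open RingProperties Ring.ring using (-‿distribʳ-*)
  aux : ∀ x y z → (x ℤ.+ ℤ.- y) ℤ.+ (y ℤ.+ z) ≡ x ℤ.+ z
  aux = ℤSolver.solve-∀

-- The computation of `G-qfact` carried out on series, with 1 - x^k in place of the q-integers and
-- `1-x^-+` in place of `qint-+`.
gaussian-poch : ∀ a b → gaussian (a + b) a ⊗ (poch a ⊗ poch b) ≈ poch (a + b)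
gaussian-poch zero    b = begin≈
  1S ⊗ (1S ⊗ poch b)  ≈⟨ ⊗-identityˡ (1S ⊗ poch b) ⟩
  1S ⊗ poch b         ≈⟨ ⊗-identityˡ (poch b) ⟩
  poch b              ∎≈
gaussian-poch (suc a) zero rewrite +-identityʳ a = begin≈
  gaussian (suc a) (suc a) ⊗ (poch (suc a) ⊗ 1S)
    ≈⟨ ⊗-cong (gaussian-diag (suc a)) (Ring.*-identityʳ (poch (suc a))) ⟩
  1S ⊗ poch (suc a)
    ≈⟨ ⊗-identityˡ (poch (suc a)) ⟩
  poch (suc a) ∎≈
gaussian-poch (suc a) (suc b) = begin≈
  (X ⊕ (M ⊗ Y)) ⊗ (poch (suc a) ⊗ poch (suc b))
    ≈⟨ ⊗-cong {X ⊕ (M ⊗ Y)} (λ _ → refl) (⊗-cong (poch-suc a) (poch-suc b)) ⟩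
  (X ⊕ (M ⊗ Y)) ⊗ ((Pa ⊗ A) ⊗ (Pb ⊗ B))
    ≈⟨ ⊗-distribʳ ((Pa ⊗ A) ⊗ (Pb ⊗ B)) X (M ⊗ Y) ⟩
  (X ⊗ ((Pa ⊗ A) ⊗ (Pb ⊗ B))) ⊕ ((M ⊗ Y) ⊗ ((Pa ⊗ A) ⊗ (Pb ⊗ B)))
    ≈⟨ Ring.+-cong
         (Solver.solve 5 (λ x pa a pb b → x Solver.⊕ ((pa Solver.⊕ a) Solver.⊕ (pb Solver.⊕ b)) Solver.⊜
           (x Solver.⊕ (pa Solver.⊕ (pb Solver.⊕ b))) Solver.⊕ a) (λ _ → refl) X Pa A Pb B)
         (Solver.solve 6 (λ m y pa a pb b → (m Solver.⊕ y) Solver.⊕ ((pa Solver.⊕ a) Solver.⊕ (pb Solver.⊕ b)) Solver.⊜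
           (y Solver.⊕ ((pa Solver.⊕ a) Solver.⊕ pb)) Solver.⊕ (m Solver.⊕ b)) (λ _ → refl) M Y Pa A Pb B) ⟩
  ((X ⊗ (Pa ⊗ (Pb ⊗ B))) ⊗ A) ⊕ ((Y ⊗ ((Pa ⊗ A) ⊗ Pb)) ⊗ (M ⊗ B))
    ≈⟨ Ring.+-cong (⊗-cong {c = A} left (λ _ → refl)) (⊗-cong {c = M ⊗ B} right (λ _ → refl)) ⟩
  (P ⊗ A) ⊕ (P ⊗ (M ⊗ B))
    ≈⟨ proj₁ Ring.distrib P A (M ⊗ B) ⟨
  P ⊗ (A ⊕ (M ⊗ B))
    ≈⟨ ⊗-cong {P} (λ _ → refl) (1-x^-+ (suc a) (suc b)) ⟩
  P ⊗ 1-x^ (suc a + suc b)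
    ≈⟨ poch-suc (a + suc b) ⟨
  poch (suc a + suc b) ∎≈
  where
  X = gaussian (a + suc b) a
  Y = gaussian (a + suc b) (suc a)
  M = mono (suc a)
  A = 1-x^ (suc a)
  B = 1-x^ (suc b)
  Pa = poch a
  Pb = poch b
  P = poch (a + suc b)
  left : X ⊗ (Pa ⊗ (Pb ⊗ B)) ≈ P
  left = begin≈
    X ⊗ (Pa ⊗ (Pb ⊗ B))
      ≈⟨ ⊗-cong {X} (λ _ → refl) (⊗-cong {Pa} (λ _ → refl) (poch-suc b)) ⟨
    X ⊗ (Pa ⊗ poch (suc b))
      ≈⟨ gaussian-poch a (suc b) ⟩
    P ∎≈
  right : Y ⊗ ((Pa ⊗ A) ⊗ Pb) ≈ P
  right = begin≈
    Y ⊗ ((Pa ⊗ A) ⊗ Pb)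
      ≈⟨ ⊗-cong {Y} (λ _ → refl) (⊗-cong {c = Pb} (poch-suc a) (λ _ → refl)) ⟨
    Y ⊗ (poch (suc a) ⊗ Pb)
      ≈⟨ (λ n → cong (λ u → (gaussian u (suc a) ⊗ (poch (suc a) ⊗ Pb)) n) (+-suc a b)) ⟩
    gaussian (suc a + b) (suc a) ⊗ (poch (suc a) ⊗ Pb)
      ≈⟨ gaussian-poch (suc a) b ⟩
    poch (suc a + b)
      ≈⟨ (λ n → cong (λ u → poch u n) (+-suc a b)) ⟨
    P ∎≈

gaussian-quotient : ∀ a b → poch (a + b) ⊗ (inv (poch a) ⊗ inv (poch b)) ≈ gaussian (a + b) a
gaussian-quotient a b = begin≈
  poch (a + b) ⊗ (inv (poch a) ⊗ inv (poch b))
    ≈⟨ ⊗-cong {c = inv (poch a) ⊗ inv (poch b)} (gaussian-poch a b) (λ _ → refl) ⟨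
  (g ⊗ (poch a ⊗ poch b)) ⊗ (inv (poch a) ⊗ inv (poch b))
    ≈⟨ Solver.solve 5 (λ g x y u v → (g Solver.⊕ (x Solver.⊕ y)) Solver.⊕ (u Solver.⊕ v) Solver.⊜
         g Solver.⊕ ((x Solver.⊕ u) Solver.⊕ (y Solver.⊕ v))) (λ _ → refl)
         g (poch a) (poch b) (inv (poch a)) (inv (poch b)) ⟩
  g ⊗ ((poch a ⊗ inv (poch a)) ⊗ (poch b ⊗ inv (poch b)))
    ≈⟨ ⊗-cong {g} (λ _ → refl) (⊗-cong (inv-inverse (poch a) (poch-0 a)) (inv-inverse (poch b) (poch-0 b))) ⟩
  g ⊗ (1S ⊗ 1S)
    ≈⟨ ⊗-cong {g} (λ _ → refl) (⊗-identityˡ 1S) ⟩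
  g ⊗ 1S
    ≈⟨ Ring.*-identityʳ g ⟩
  g ∎≈
  where
  g = gaussian (a + b) a

-- Polynomials with natural coefficients

coef : List ℕ → ℕ → ℕ
coef []      n       = 0
coef (a ∷ l) zero    = a
coef (a ∷ l) (suc n) = coef l n

eval : List ℕ → ℕ → ℕ
eval []      x = 0
eval (a ∷ l) x = a + x * eval l x

-- The series P is a polynomial with natural coefficients and values f.
infix 4 _⟼_
_⟼_ : Series → (ℕ → ℕ) → Set
P ⟼ f = ∃[ l ] (∀ n → P n ≡ ⁺ coef l n) × (∀ x → eval l x ≡ f x)

module _ where
  private
    head : List ℕ → ℕ
    head []      = 0
    head (a ∷ l) = a
    rest : List ℕ → List ℕ
    rest []      = []
    rest (a ∷ l) = l

    eval-rest : ∀ l x → eval l x ≡ head l + x * eval (rest l) x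
    eval-rest []      x = sym (*-zeroʳ x)
    eval-rest (a ∷ l) x = refl

    coef-head : ∀ l → coef l 0 ≡ head l
    coef-head []      = refl
    coef-head (a ∷ l) = refl

    coef-rest : ∀ l n → coef l (suc n) ≡ coef (rest l) n
    coef-rest []      n = refl
    coef-rest (a ∷ l) n = refl

  -- Modulo a sufficiently large x, the value of a polynomial over ℕ is its constant term. Removing
  -- that term and cancelling x leaves the remaining coefficients. As squares grow without bound,
  -- the values at squares suffice.
  coef-unique : ∀ n l m → (∀ t → eval l (suc t ^ 2) ≡ eval m (suc t ^ 2)) → coef l n ≡ coef m n
  coef-unique n l m e = go n
    where
    values : ∀ t → head l + suc t ^ 2 * eval (rest l) (suc t ^ 2) ≡ head m + suc t ^ 2 * eval (rest m) (suc t ^ 2)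
    values t = trans (sym (eval-rest l (suc t ^ 2))) (trans (e t) (eval-rest m (suc t ^ 2)))
    heads : head l ≡ head m
    heads = begin
      head l                          ≡⟨ m<n⇒m%n≡m (≤-trans (s≤s (m≤m+n (head l) (head m))) big) ⟨
      head l % x                      ≡⟨ [m+kn]%n≡m%n (head l) (eval (rest l) x) x ⟨
      (head l + eval (rest l) x * x) % x
        ≡⟨ cong (_% x) (trans (cong (λ z → head l + z) (*-comm (eval (rest l) x) x))
             (trans (values t) (cong (λ z → head m + z) (*-comm x (eval (rest m) x))))) ⟩
      (head m + eval (rest m) x * x) % x
        ≡⟨ [m+kn]%n≡m%n (head m) (eval (rest m) x) x ⟩
      head m % x                      ≡⟨ m<n⇒m%n≡m (≤-trans (s≤s (m≤n+m (head m) (head l))) big) ⟩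
      head m                          ∎
      where
      -- With this choice x = (t + 1)² exceeds both constant terms, so each is its own residue.
      t = head l + head m
      x = suc t ^ 2
      big : suc t ≤ x
      big = m≤m*n (suc t) (suc t * 1) {{m*n≢0 (suc t) 1}}
    go : ∀ n → coef l n ≡ coef m n
    go zero    = trans (coef-head l) (trans heads (sym (coef-head m)))
    go (suc n) = trans (coef-rest l n) (trans
      (coef-unique n (rest l) (rest m) λ t → *-cancelˡ-≡ _ _ (suc t ^ 2) {{m*n≢0 (suc t) (suc t * 1) {{_}} {{m*n≢0 (suc t) 1}}}}
        (+-cancelˡ-≡ (head l) _ _ (trans (values t) (cong (_+ suc t ^ 2 * eval (rest m) (suc t ^ 2)) (sym heads)))))
      (sym (coef-rest m n)))

⟼-unique : ∀ {P Q f g} → P ⟼ f → Q ⟼ g → (∀ t → f (suc t ^ 2) ≡ g (suc t ^ 2)) → P ≈ Q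
⟼-unique (l , c , e) (m , c′ , e′) fg n = trans (c n) (trans (cong ⁺_ (coef-unique n l m
  λ t → trans (e (suc t ^ 2)) (trans (fg t) (sym (e′ (suc t ^ 2)))))) (sym (c′ n)))

⟼-resp : ∀ {P Q f} → P ≈ Q → Q ⟼ f → P ⟼ f
⟼-resp e (l , c , v) = l , (λ n → trans (e n) (c n)) , v

⟼-0 : 0S ⟼ λ _ → 0
⟼-0 = [] , (λ _ → refl) , (λ _ → refl)

⟼-1 : 1S ⟼ λ _ → 1
⟼-1 = 1 ∷ [] , (λ { zero → refl ; (suc n) → refl }) , (λ x → cong suc (*-zeroʳ x))

add : List ℕ → List ℕ → List ℕ
add []      m       = m
add (a ∷ l) []      = a ∷ l
add (a ∷ l) (b ∷ m) = a + b ∷ add l m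

coef-add : ∀ l m n → coef (add l m) n ≡ coef l n + coef m n
coef-add []      m       n       = refl
coef-add (a ∷ l) []      n       = sym (+-identityʳ _)
coef-add (a ∷ l) (b ∷ m) zero    = refl
coef-add (a ∷ l) (b ∷ m) (suc n) = coef-add l m n

eval-add : ∀ l m x → eval (add l m) x ≡ eval l x + eval m x
eval-add []      m       x = refl
eval-add (a ∷ l) []      x = sym (+-identityʳ _)
eval-add (a ∷ l) (b ∷ m) x = trans (cong (λ z → a + b + x * z) (eval-add l m x)) (aux a b x (eval l x) (eval m x))
  where
  aux : ∀ a b x y z → a + b + x * (y + z) ≡ (a + x * y) + (b + x * z)
  aux = solve-∀

⟼-⊕ : ∀ {P Q f g} → P ⟼ f → Q ⟼ g → P ⊕ Q ⟼ λ x → f x + g x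
⟼-⊕ (l , c , e) (m , c′ , e′) = add l m ,
  (λ n → trans (cong₂ ℤ._+_ (c n) (c′ n)) (cong ⁺_ (sym (coef-add l m n)))) ,
  (λ x → trans (eval-add l m x) (cong₂ _+_ (e x) (e′ x)))

mul : List ℕ → List ℕ → List ℕ
mul []      m = []
mul (a ∷ l) m = add (map (a *_) m) (0 ∷ mul l m)

coef-scale : ∀ a m n → coef (map (a *_) m) n ≡ a * coef m n
coef-scale a []      n       = sym (*-zeroʳ a)
coef-scale a (b ∷ m) zero    = refl
coef-scale a (b ∷ m) (suc n) = coef-scale a m n

eval-scale : ∀ a m x → eval (map (a *_) m) x ≡ a * eval m x
eval-scale a []      x = sym (*-zeroʳ a)
eval-scale a (b ∷ m) x = trans (cong (λ z → a * b + x * z) (eval-scale a m x)) (aux a b x (eval m x))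
  where
  aux : ∀ a b x y → a * b + x * (a * y) ≡ a * (b + x * y)
  aux = solve-∀

coef-mul : ∀ l m → (λ n → ⁺ coef l n) ⊗ (λ n → ⁺ coef m n) ≈ (λ n → ⁺ coef (mul l m) n)
coef-mul []      m n       = ⊗-zeroˡ (λ n → ⁺ coef m n) n
coef-mul (a ∷ l) m zero    = begin
  ((λ n → ⁺ coef (a ∷ l) n) ⊗ (λ n → ⁺ coef m n)) 0
    ≡⟨ ⊗-zero (λ n → ⁺ coef (a ∷ l) n) (λ n → ⁺ coef m n) ⟩
  ⁺ a ℤ.* ⁺ coef m 0
    ≡⟨ ℤ.pos-* a (coef m 0) ⟨
  ⁺ (a * coef m 0)
    ≡⟨ cong ⁺_ (trans (cong₂ _+_ (coef-scale a m 0) refl) (+-identityʳ (a * coef m 0))) ⟨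
  ⁺ (coef (map (a *_) m) 0 + coef (0 ∷ mul l m) 0)
    ≡⟨ cong ⁺_ (coef-add (map (a *_) m) (0 ∷ mul l m) 0) ⟨
  ⁺ coef (mul (a ∷ l) m) 0 ∎
coef-mul (a ∷ l) m (suc n) = begin
  ((λ n → ⁺ coef (a ∷ l) n) ⊗ (λ n → ⁺ coef m n)) (suc n)
    ≡⟨ ⊗-suc (λ n → ⁺ coef (a ∷ l) n) (λ n → ⁺ coef m n) n ⟩
  ⁺ a ℤ.* ⁺ coef m (suc n) ℤ.+ ((λ n → ⁺ coef l n) ⊗ (λ n → ⁺ coef m n)) n
    ≡⟨ cong₂ ℤ._+_ (trans (sym (ℤ.pos-* a (coef m (suc n)))) (cong ⁺_ (sym (coef-scale a m (suc n))))) (coef-mul l m n) ⟩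
  ⁺ (coef (map (a *_) m) (suc n) + coef (mul l m) n)
    ≡⟨ cong ⁺_ (coef-add (map (a *_) m) (0 ∷ mul l m) (suc n)) ⟨
  ⁺ coef (mul (a ∷ l) m) (suc n) ∎

eval-mul : ∀ l m x → eval (mul l m) x ≡ eval l x * eval m x
eval-mul []      m x = refl
eval-mul (a ∷ l) m x = begin
  eval (add (map (a *_) m) (0 ∷ mul l m)) x
    ≡⟨ eval-add (map (a *_) m) (0 ∷ mul l m) x ⟩
  eval (map (a *_) m) x + x * eval (mul l m) x
    ≡⟨ cong₂ (λ y z → y + x * z) (eval-scale a m x) (eval-mul l m x) ⟩
  a * eval m x + x * (eval l x * eval m x)
    ≡⟨ aux a x (eval l x) (eval m x) ⟩
  (a + x * eval l x) * eval m x ∎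
  where
  aux : ∀ a x y z → a * z + x * (y * z) ≡ (a + x * y) * z
  aux = solve-∀

⟼-⊗ : ∀ {P Q f g} → P ⟼ f → Q ⟼ g → P ⊗ Q ⟼ λ x → f x * g x
⟼-⊗ (l , c , e) (m , c′ , e′) = mul l m ,
  (λ n → trans (⊗-cong c c′ n) (coef-mul l m n)) ,
  (λ x → trans (eval-mul l m x) (cong₂ _*_ (e x) (e′ x)))

⟼-mono : ∀ e → mono e ⟼ λ x → x ^ e
⟼-mono zero    = ⟼-resp mono-0 ⟼-1
⟼-mono (suc e) with l , c , v ← ⟼-mono e =
  0 ∷ l , (λ { zero → refl ; (suc n) → c n }) , (λ x → cong (x *_) (v x))

cube : List ℕ → List ℕ
cube []      = []
cube (a ∷ l) = a ∷ 0 ∷ 0 ∷ cube l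

⟼-at3 : ∀ {P f} → P ⟼ f → at3 P ⟼ λ x → f (x ^ 3)
⟼-at3 {P} {f} (l , c , e) = cube l , coefs l P c , λ x → trans (evals l x) (e (x ^ 3))
  where
  at3-3+ : ∀ P n → at3 P (3 + n) ≡ at3 (tail P) n
  at3-3+ P n = cong (λ k → if (n % 3) ≡ᵇ 0 then P k else ⁺ 0) (m/n≡1+[m∸n]/n {3 + n} {3} (s≤s (s≤s (s≤s z≤n))))
  coefs : ∀ l P → (∀ n → P n ≡ ⁺ coef l n) → ∀ n → at3 P n ≡ ⁺ coef (cube l) n
  coefs []      P c n with (n % 3) ≡ᵇ 0
  ... | true  = c (n / 3)
  ... | false = refl
  coefs (a ∷ l) P c 0 = c 0
  coefs (a ∷ l) P c 1 = refl
  coefs (a ∷ l) P c 2 = refl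
  coefs (a ∷ l) P c (suc (suc (suc n))) = trans (at3-3+ P n) (coefs l (tail P) (λ k → c (suc k)) n)
  evals : ∀ l x → eval (cube l) x ≡ eval l (x ^ 3)
  evals []      x = refl
  evals (a ∷ l) x = cong (λ z → a + z) (trans (cong (λ z → x * (x * (x * z))) (evals l x)) (aux x (eval l (x ^ 3))))
    where
    aux : ∀ x y → x * (x * (x * y)) ≡ x * (x * (x * 1)) * y
    aux = solve-∀

⟼-gaussian : ∀ a b → gaussian a b ⟼ λ x → G x a b
⟼-gaussian a       zero    = ⟼-1
⟼-gaussian zero    (suc b) = ⟼-0
⟼-gaussian (suc a) (suc b) = ⟼-⊕ (⟼-gaussian a b) (⟼-⊗ (⟼-mono (suc b)) (⟼-gaussian a (suc b)))

-- Values of Gaussian binomials with integer arguments, and of finite sums and products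

Gℤ : ℕ → ℤ → ℤ → ℕ
Gℤ x A B with B | A ℤ.- B
... | ⁺ b | ⁺ c = G x (b + c) b
... | _   | _   = 0

-- `Gℤ` splits into the same cases as `gauss`, so the convention of zero outside the range carries
-- over unchanged.
⟼-gauss : ∀ A B → gauss A B ⟼ λ x → Gℤ x A B
⟼-gauss A B with B | A ℤ.- B
... | ⁺ b      | ⁺ c      = ⟼-resp (gaussian-quotient b c) (⟼-gaussian (b + c) b)
... | ⁺ b      | -[1+ c ] = ⟼-0
... | -[1+ b ] | ⁺ c      = ⟼-0
... | -[1+ b ] | -[1+ c ] = ⟼-0

ΣL ΠL : {A : Set} → List A → (A → ℕ) → ℕ
ΣL []       f = 0
ΣL (a ∷ as) f = f a + ΣL as f
ΠL []       f = 1
ΠL (a ∷ as) f = f a * ΠL as f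

⟼-sum : ∀ {A : Set} (F : A → Series) (f : A → ℕ → ℕ) → (∀ a → F a ⟼ f a) →
  ∀ as → sumS (map F as) ⟼ λ x → ΣL as (λ a → f a x)
⟼-sum F f e []       = ⟼-0
⟼-sum F f e (a ∷ as) = ⟼-⊕ (e a) (⟼-sum F f e as)

⟼-prod : ∀ {A : Set} (F : A → Series) (f : A → ℕ → ℕ) → (∀ a → F a ⟼ f a) →
  ∀ as → prodS (map F as) ⟼ λ x → ΠL as (λ a → f a x)
⟼-prod F f e []       = ⟼-1
⟼-prod F f e (a ∷ as) = ⟼-⊗ (e a) (⟼-prod F f e as)

sumS-++ : ∀ as bs → sumS (as ++ bs) ≈ sumS as ⊕ sumS bs
sumS-++ []       bs n = sym (ℤ.+-identityˡ _)
sumS-++ (a ∷ as) bs n = trans (cong (λ z → a n ℤ.+ z) (sumS-++ as bs n)) (sym (ℤ.+-assoc (a n) _ _))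

⟼-concatMap : ∀ {A : Set} (F : A → List Series) (f : A → ℕ → ℕ) → (∀ a → sumS (F a) ⟼ f a) →
  ∀ as → sumS (concatMap F as) ⟼ λ x → ΣL as (λ a → f a x)
⟼-concatMap F f e []       = ⟼-0
⟼-concatMap F f e (a ∷ as) = ⟼-resp (sumS-++ (F a) (concatMap F as)) (⟼-⊕ (e a) (⟼-concatMap F f e as))

≡ᵇ-true : ∀ m → (m ≡ᵇ m) ≡ true
≡ᵇ-true zero    = refl
≡ᵇ-true (suc m) = ≡ᵇ-true m

≡ᵇ-false : ∀ m n → m ≢ n → (m ≡ᵇ n) ≡ false
≡ᵇ-false zero    zero    m≢n with () ← m≢n refl
≡ᵇ-false zero    (suc n) m≢n = refl
≡ᵇ-false (suc m) zero    m≢n = refl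
≡ᵇ-false (suc m) (suc n) m≢n = ≡ᵇ-false m n λ e → m≢n (cong suc e)

monoℤ-+ : ∀ e → monoℤ (⁺ e) ≈ mono e
monoℤ-+ e n with e ≟ n
... | yes refl = sym (cong (λ b → if b then ⁺ 1 else ⁺ 0) (≡ᵇ-true e))
... | no e≢n  = sym (cong (λ b → if b then ⁺ 1 else ⁺ 0) (≡ᵇ-false e n e≢n))

⟼-if : ∀ b {P f} → P ⟼ f → (if b then P else 0S) ⟼ λ x → if b then f x else 0
⟼-if true  r = r
⟼-if false r = ⟼-0

Gℤ-pos : ∀ x A b c → A ℤ.- ⁺ b ≡ ⁺ c → Gℤ x A (⁺ b) ≡ G x (b + c) b
Gℤ-pos x A b c e with A ℤ.- ⁺ b
Gℤ-pos x A b c refl | .(⁺ c) = refl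

Gℤ-neg : ∀ x A B c → A ℤ.- B ≡ -[1+ c ] → Gℤ x A B ≡ 0
Gℤ-neg x A B c e with B | A ℤ.- B
Gℤ-neg x A B c refl | ⁺ b      | .(-[1+ c ]) = refl
Gℤ-neg x A B c refl | -[1+ b ] | .(-[1+ c ]) = refl

Gℤ-bot : ∀ x A b → Gℤ x A -[1+ b ] ≡ 0
Gℤ-bot x A b with A ℤ.- -[1+ b ]
... | ⁺ c      = refl
... | -[1+ c ] = refl

Gℤ-+ : ∀ x a b → Gℤ x (⁺ a) (⁺ b) ≡ G x a b
Gℤ-+ x a b with b ≤? a
... | yes b≤a = trans
  (Gℤ-pos x (⁺ a) b (a ∸ b) (trans (ℤ.m-n≡m⊖n a b) (ℤ.⊖-≥ b≤a)))
  (cong (λ n → G x n b) (m+[n∸m]≡n b≤a))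
... | no b≰a = trans
  (Gℤ-neg x (⁺ a) (⁺ b) (b ∸ suc a) (begin
    ⁺ a ℤ.- ⁺ b              ≡⟨ ℤ.m-n≡m⊖n a b ⟩
    a ℤ.⊖ b                  ≡⟨ ℤ.⊖-< (≰⇒> b≰a) ⟩
    ℤ.- ⁺ (b ∸ a)            ≡⟨ cong (λ n → ℤ.- ⁺ n) (sym (m+[n∸m]≡n {1} (m<n⇒0<n∸m (≰⇒> b≰a)))) ⟩
    ℤ.- ⁺ suc (b ∸ a ∸ 1)    ≡⟨ cong -[1+_] (trans (∸-+-assoc b a 1) (cong (b ∸_) (+-comm a 1))) ⟩
    -[1+ b ∸ suc a ]         ∎))
  (sym (Gaussian.G-zero x a b (≰⇒> b≰a)))

-- The multisum

Π< : ℕ → (ℕ → ℕ) → ℕ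
Π< zero    f = 1
Π< (suc n) f = f 0 * Π< n (λ k → f (suc k))

Π<-cong : ∀ n {f g} → (∀ k → f k ≡ g k) → Π< n f ≡ Π< n g
Π<-cong zero    e = refl
Π<-cong (suc n) e = cong₂ _*_ (e 0) (Π<-cong n λ k → e (suc k))

ΠL-upTo : ∀ n f → ΠL (map suc (upTo n)) f ≡ Π< n (λ k → f (suc k))
ΠL-upTo n f = go n (λ k → k)
  where
  go : ∀ n g → ΠL (map suc (applyUpTo g n)) f ≡ Π< n (λ k → f (suc (g k)))
  go zero    g = refl
  go (suc n) g = cong (f (suc (g 0)) *_) (go n λ k → g (suc k))

ΣL-upTo : ∀ n f → ΣL (upTo n) f ≡ Σ< n f
ΣL-upTo n f = go n (λ k → k)
  where
  go : ∀ n g → ΣL (applyUpTo g n) f ≡ Σ< n (λ k → f (g k))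
  go zero    g = refl
  go (suc n) g = cong (f (g 0) +_) (go n λ k → g (suc k))

ΣL-++ : ∀ {A : Set} (as bs : List A) f → ΣL (as ++ bs) f ≡ ΣL as f + ΣL bs f
ΣL-++ []       bs f = refl
ΣL-++ (a ∷ as) bs f = trans (cong (f a +_) (ΣL-++ as bs f)) (sym (+-assoc (f a) _ _))

ΣL-map : ∀ {A B : Set} (g : A → B) as f → ΣL (map g as) f ≡ ΣL as (λ a → f (g a))
ΣL-map g []       f = refl
ΣL-map g (a ∷ as) f = cong (f (g a) +_) (ΣL-map g as f)

ΣL-concatMap : ∀ {A B : Set} (g : A → List B) as f → ΣL (concatMap g as) f ≡ ΣL as (λ a → ΣL (g a) f)
ΣL-concatMap g []       f = refl
ΣL-concatMap g (a ∷ as) f = trans (ΣL-++ (g a) (concatMap g as) f) (cong (ΣL (g a) f +_) (ΣL-concatMap g as f))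

ΣL-Σ< : ∀ {A : Set} (as : List A) n (f : ℕ → A → ℕ) →
  Σ< n (λ k → ΣL as (f k)) ≡ ΣL as (λ a → Σ< n (λ k → f k a))
ΣL-Σ< []       n f = Σ<-zero n λ _ _ → refl
ΣL-Σ< (a ∷ as) n f = trans (Σ<-+ n (λ k → f k a) (λ k → ΣL as (f k)))
                           (cong (Σ< n (λ k → f k a) +_) (ΣL-Σ< as n f))

-- Sums over all compositions (x ∷ xs) of N into ν + 1 parts.
Σᶜ : ℕ → ℕ → (List ℕ → ℕ) → ℕ
Σᶜ zero    N F = F (N ∷ [])
Σᶜ (suc ν) N F = Σ⁺ N (λ x N′ → Σᶜ ν N′ (λ xs → F (x ∷ xs)))

Σᶜ-cong : ∀ ν N {F F′ : List ℕ → ℕ} → (∀ x xs → x + sumℕ xs ≡ N → F (x ∷ xs) ≡ F′ (x ∷ xs)) →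
  Σᶜ ν N F ≡ Σᶜ ν N F′
Σᶜ-cong zero    N e = e N [] (+-identityʳ N)
Σᶜ-cong (suc ν) N e = Σ⁺-cong N λ x N′ eq → Σᶜ-cong ν N′ λ y ys eq′ →
  e x (y ∷ ys) (trans (cong (x +_) eq′) eq)

Σᶜ-* : ∀ ν N c F → Σᶜ ν N (λ xs → c * F xs) ≡ c * Σᶜ ν N F
Σᶜ-* zero    N c F = refl
Σᶜ-* (suc ν) N c F = trans (Σ⁺-cong N λ x N′ _ → Σᶜ-* ν N′ c λ xs → F (x ∷ xs)) (Σ⁺-* N c _)

Σᶜ-zero : ∀ ν N F → (∀ x xs → x + sumℕ xs ≡ N → F (x ∷ xs) ≡ 0) → Σᶜ ν N F ≡ 0
Σᶜ-zero ν N F z = trans (Σᶜ-cong ν N {F′ = λ xs → 0 * F xs} z) (Σᶜ-* ν N 0 F)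

Σᶜ-shift : ∀ ν N a n (F : List ℕ → ℕ → ℕ) →
  Σᶜ ν N (λ xs → shift a n (F xs)) ≡ shift a n (λ k → Σᶜ ν N (λ xs → F xs k))
Σᶜ-shift ν N zero    n       F = refl
Σᶜ-shift ν N (suc a) zero    F = Σᶜ-zero ν N (λ _ → 0) λ _ _ _ → refl
Σᶜ-shift ν N (suc a) (suc n) F = Σᶜ-shift ν N a n F

Σ<Σ<-triangle : ∀ B (f : ℕ → ℕ → ℕ) → (∀ i j → B < i + j → f i j ≡ 0) →
  Σ< (suc B) (λ i → Σ< (suc B) (f i)) ≡ Σ< (suc B) (λ n → Σ⁺ n f)
Σ<Σ<-triangle B f z = begin
  Σ< (suc B) (λ i → Σ< (suc B) (f i))
    ≡⟨ Σ<-cong (suc B) (λ { i (s≤s i≤B) → Σ<-extend (suc (B ∸ i)) (suc B) (f i) (s≤s (m∸n≤m B i))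
         (λ j lt → z i j (subst (_< i + j) (m+[n∸m]≡n i≤B) (+-monoʳ-< i lt))) }) ⟨
  Σ< (suc B) (λ i → Σ< (suc (B ∸ i)) (f i))
    ≡⟨ Σ⁺-Σ< B (λ i k → Σ< (suc k) (f i)) ⟨
  Σ⁺ B (λ i k → Σ< (suc k) (f i))
    ≡⟨ Σ⁺-cong B (λ i k _ → flatten k (f i)) ⟩
  Σ⁺ B (λ i k → Σ⁺ k (λ j _ → f i j))
    ≡⟨ Σ⁺-assoc B (λ i j _ → f i j) ⟩
  Σ⁺ B (λ n _ → Σ⁺ n f)
    ≡⟨ Σ⁺-Σ< B (λ n _ → Σ⁺ n f) ⟩
  Σ< (suc B) (λ n → Σ⁺ n f) ∎
  where
  flatten : ∀ k g → Σ< (suc k) g ≡ Σ⁺ k (λ j _ → g j)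
  flatten k g = sym (Σ⁺-Σ< k (λ j _ → g j))

-- A list with sum at most B has all its entries at most B, so these compositions lie in the box; on
-- the rest of the box `F` vanishes. The outer index N is N₁ = n₁ + ... + n_ν.
ΣL-boxes : ∀ ν B F → (∀ xs → B < sumℕ xs → F xs ≡ 0) →
  ΣL (boxes (suc ν) B) F ≡ Σ< (suc B) (λ N → Σᶜ ν N F)
ΣL-boxes ν B F z = trans (ΣL-concatMap (λ x → map (x ∷_) (boxes ν B)) (upTo (suc B)) F)
  (trans (ΣL-upTo (suc B) _) (trans (Σ<-cong (suc B) λ x _ → ΣL-map (x ∷_) (boxes ν B) F) (parts ν F z)))
  where
  parts : ∀ ν F → (∀ xs → B < sumℕ xs → F xs ≡ 0) →
    Σ< (suc B) (λ x → ΣL (boxes ν B) (λ xs → F (x ∷ xs))) ≡ Σ< (suc B) (λ N → Σᶜ ν N F)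
  parts zero    F z = Σ<-cong (suc B) λ x _ → +-identityʳ (F (x ∷ []))
  parts (suc ν) F z = begin
    Σ< (suc B) (λ x → ΣL (boxes (suc ν) B) (λ xs → F (x ∷ xs)))
      ≡⟨ Σ<-cong (suc B) (λ x _ → ΣL-boxes ν B (λ xs → F (x ∷ xs)) λ xs lt → z (x ∷ xs) (m≤n⇒m≤o+n x lt)) ⟩
    Σ< (suc B) (λ x → Σ< (suc B) (λ N → Σᶜ ν N (λ xs → F (x ∷ xs))))
      ≡⟨ Σ<Σ<-triangle B _ (λ x N lt → Σᶜ-zero ν N (λ xs → F (x ∷ xs))
           λ y ys e → z (x ∷ y ∷ ys) (subst (λ k → B < x + k) (sym e) lt)) ⟩
    Σ< (suc B) (λ N → Σᶜ (suc ν) N F) ∎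

half : ℕ → (ℕ → ℕ) → ℕ
half zero          h = h 0
half (suc zero)    h = 0
half (suc (suc w)) h = half w (λ k → h (suc k))

half-even : ∀ k h → half (2 * k) h ≡ h k
half-even zero    h = refl
half-even (suc k) h = trans (cong (λ w → half (suc w) h) (+-suc k (k + 0))) (half-even k λ k → h (suc k))

evenOrOdd : ∀ w → ∃ λ k → (w ≡ 2 * k) ⊎ (w ≡ suc (2 * k))
evenOrOdd zero = 0 , inj₁ refl
evenOrOdd (suc w) with evenOrOdd w
... | k , inj₁ refl = k , inj₂ refl
... | k , inj₂ refl = suc k , inj₁ (cong suc (sym (+-suc k (k + 0))))

half-odd : ∀ w h → (∀ k → w ≢ 2 * k) → half w h ≡ 0
half-odd zero          h ¬e with () ← ¬e 0 refl
half-odd (suc zero)    h ¬e = refl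
half-odd (suc (suc w)) h ¬e = half-odd w _ λ k e →
  ¬e (suc k) (trans (cong (2 +_) e) (cong suc (sym (+-suc k (k + 0)))))

Σ²-half : ∀ n f → Σ² n f ≡ Σ⁺ n (λ m w → half w (f m))
Σ²-half zero          f = refl
Σ²-half (suc zero)    f = refl
Σ²-half (suc (suc n)) f = sym (begin
  Σ⁺ (2 + n) (λ m w → half w (f m))
    ≡⟨ Σ⁺-last (suc n) (λ m w → half w (f m)) ⟩
  Σ⁺ (suc n) (λ m w → half (suc w) (f m)) + f (2 + n) 0
    ≡⟨ cong (_+ f (2 + n) 0) (trans (Σ⁺-last n (λ m w → half (suc w) (f m))) (+-identityʳ _)) ⟩
  Σ⁺ n (λ m w → half w (λ k → f m (suc k))) + f (2 + n) 0
    ≡⟨ cong (_+ f (2 + n) 0) (sym (Σ²-half n λ m k → f m (suc k))) ⟩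
  Σ² n (λ m k → f m (suc k)) + f (2 + n) 0
    ≡⟨ +-comm _ (f (2 + n) 0) ⟩
  Σ² (2 + n) f ∎)

-- This turns the congruence modulo 2 into the range of `Σ²`: an m > n or with n - m odd has no k
-- with m + 2k = n, so its term is zero.
Σ²-Σ< : ∀ n B f g → n ≤ B → (∀ m k → m + 2 * k ≡ n → g m ≡ f m k) →
  (∀ m → (∀ k → m + 2 * k ≢ n) → g m ≡ 0) → Σ< (suc B) g ≡ Σ² n f
Σ²-Σ< n B f g n≤B e z = begin
  Σ< (suc B) g
    ≡⟨ Σ<-extend (suc n) (suc B) g (s≤s n≤B)
         (λ m n<m → z m λ k eq → <⇒≱ n<m (subst (m ≤_) eq (m≤m+n m (2 * k)))) ⟨
  Σ< (suc n) g
    ≡⟨ Σ<-cong (suc n) (λ { m (s≤s m≤n) → term m (n ∸ m) (m+[n∸m]≡n m≤n) }) ⟩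
  Σ< (suc n) (λ m → half (n ∸ m) (f m))
    ≡⟨ Σ⁺-Σ< n (λ m w → half w (f m)) ⟨
  Σ⁺ n (λ m w → half w (f m))
    ≡⟨ Σ²-half n f ⟨
  Σ² n f ∎
  where
  term : ∀ m w → m + w ≡ n → g m ≡ half w (f m)
  term m w eq with evenOrOdd w
  ... | k , inj₁ refl = trans (e m k eq) (sym (half-even k (f m)))
  ... | k , inj₂ refl = trans (z m λ j eq′ → odd j (+-cancelˡ-≡ m _ _ (trans eq (sym eq′))))
                              (sym (half-odd (suc (2 * k)) (f m) odd))
    where
    odd : ∀ j → suc (2 * k) ≢ 2 * j
    odd j eq = go k j eq
      where
      go : ∀ k j → suc (2 * k) ≢ 2 * j
      go k       zero    ()
      go zero    (suc j) eq with () ← trans eq (cong suc (+-suc j (j + 0)))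
      go (suc k) (suc j) eq = go k j (suc-injective (suc-injective
        (trans (cong (λ z → suc (suc z)) (sym (+-suc k (k + 0)))) (trans eq (cong suc (+-suc j (j + 0)))))))

-- Values of the two truncated sums

prodValue : ℕ → List ℕ → ℕ → ℕ
prodValue i ns y = ΠL (map suc (upTo (length ns ∸ 1))) (λ j →
  Gℤ y (⁺ i ℤ.- ⁺ sumℕ (take j (Ns ns)) ℤ.+ ⁺ lookupℕ ns (j ∸ 1)) (⁺ lookupℕ ns (j ∸ 1)))

lhsTermValue lhsSummandValue : ℕ → ℕ → ℕ → List ℕ → ℕ → ℕ
lhsTermValue M i m ns x =
  x ^ ((sq m + 3 * (sq i + sumℕ (map sq (Ns ns)))) / 2)
  * (Gℤ (x ^ 3) (⁺ M) (⁺ i)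
  * (Gℤ x (⁺ (3 * lastℕ ns)) (⁺ m)
  * (Gℤ (x ^ 3) (⁺ (2 * lastℕ ns) ℤ.+ ((⁺ i ℤ.- ⁺ sumℕ (Ns ns) ℤ.- ⁺ m) /ℤ ⁺ 2)) (⁺ (2 * lastℕ ns))
  * prodValue i ns (x ^ 3))))
lhsSummandValue M i m ns x =
  if ((i + m) % 2) ≡ᵇ (sumℕ (Ns ns) % 2) then lhsTermValue M i m ns x else 0

⟼-lhsSummand : ∀ M i m ns → lhsSummand M i m ns ⟼ lhsSummandValue M i m ns
⟼-lhsSummand M i m ns = ⟼-if (((i + m) % 2) ≡ᵇ (sumℕ (Ns ns) % 2))
  (⟼-⊗ (⟼-mono ((sq m + 3 * (sq i + sumℕ (map sq (Ns ns)))) / 2)) (⟼-⊗ (⟼-at3 (⟼-gauss (⁺ M) (⁺ i))) (⟼-⊗ (⟼-gauss (⁺ (3 * lastℕ ns)) (⁺ m))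
  (⟼-⊗ (⟼-at3 (⟼-gauss (⁺ (2 * lastℕ ns) ℤ.+ ((⁺ i ℤ.- ⁺ sumℕ (Ns ns) ℤ.- ⁺ m) /ℤ ⁺ 2)) (⁺ (2 * lastℕ ns))))
  (⟼-prod (λ j → at3 (gauss (A j) (B j))) (λ j x → Gℤ (x ^ 3) (A j) (B j)) (λ j → ⟼-at3 (⟼-gauss (A j) (B j)))
          (map suc (upTo (length ns ∸ 1))))))))
  where
  A B : ℕ → ℤ
  A j = ⁺ i ℤ.- ⁺ sumℕ (take j (Ns ns)) ℤ.+ ⁺ lookupℕ ns (j ∸ 1)
  B j = ⁺ lookupℕ ns (j ∸ 1)

lhsValue : ℕ → ℕ → ℕ → ℕ → ℕ
lhsValue ν M B x = ΣL (upTo (suc B)) (λ i → ΣL (upTo (suc B)) (λ m →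
  ΣL (boxes ν B) (λ ns → lhsSummandValue M i m ns x)))

⟼-lhs : ∀ ν M B → lhsPartial ν M B ⟼ lhsValue ν M B
⟼-lhs ν M B = ⟼-concatMap
  (λ i → concatMap (λ m → map (lhsSummand M i m) (boxes ν B)) (upTo (suc B))) _
  (λ i → ⟼-concatMap (λ m → map (lhsSummand M i m) (boxes ν B)) _
    (λ m → ⟼-sum (lhsSummand M i m) (lhsSummandValue M i m) (⟼-lhsSummand M i m) (boxes ν B)) (upTo (suc B)))
  (upTo (suc B))

-- c j² + j as a natural number, where c = suc c′.
exponent : ℕ → ℤ → ℕ
exponent c′ (⁺ j)    = suc c′ * j * j + j
exponent c′ -[1+ k ] = suc k * (suc c′ * k + c′)

-- At j = -(k+1) the value is (k+1)(c(k+1) - 1), and c(k+1) - 1 = ck + c′. This is where c ≥ 1 makes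
-- the exponent a natural number.
exponent-spec : ∀ c′ j → ⁺ suc c′ ℤ.* j ℤ.* j ℤ.+ j ≡ ⁺ exponent c′ j
exponent-spec c′ (⁺ j)    = cong (ℤ._+ ⁺ j) (trans (cong (ℤ._* ⁺ j) (sym (ℤ.pos-* (suc c′) j)))
                                                   (sym (ℤ.pos-* (suc c′ * j) j)))
exponent-spec c′ -[1+ k ] = begin
  ⁺ suc c′ ℤ.* -[1+ k ] ℤ.* -[1+ k ] ℤ.+ -[1+ k ]
    ≡⟨ aux (⁺ c′) (⁺ k) ⟩
  ⁺ suc k ℤ.* (⁺ suc c′ ℤ.* ⁺ k ℤ.+ ⁺ c′)
    ≡⟨ cong (λ z → ⁺ suc k ℤ.* (z ℤ.+ ⁺ c′)) (ℤ.pos-* (suc c′) k) ⟨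
  ⁺ suc k ℤ.* ⁺ (suc c′ * k + c′)
    ≡⟨ ℤ.pos-* (suc k) (suc c′ * k + c′) ⟨
  ⁺ exponent c′ -[1+ k ] ∎
  where
  aux : ∀ c k → (⁺ 1 ℤ.+ c) ℤ.* (ℤ.- (⁺ 1 ℤ.+ k)) ℤ.* (ℤ.- (⁺ 1 ℤ.+ k)) ℤ.+ (ℤ.- (⁺ 1 ℤ.+ k))
    ≡ (⁺ 1 ℤ.+ k) ℤ.* ((⁺ 1 ℤ.+ c) ℤ.* k ℤ.+ c)
  aux = ℤSolver.solve-∀

binomial-two : ∀ n → 2 * (suc n C 2) ≡ suc n * n
binomial-two zero    = refl
binomial-two (suc n) = begin
  2 * ((2 + n) C 2)                     ≡⟨ cong (2 *_) (nCk+nC[k+1]≡[n+1]C[k+1] (suc n) 1) ⟨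
  2 * (suc n C 1 + suc n C 2)         ≡⟨ *-distribˡ-+ 2 (suc n C 1) (suc n C 2) ⟩
  2 * (suc n C 1) + 2 * (suc n C 2)   ≡⟨ cong₂ (λ x y → 2 * x + y) (nC1≡n (suc n)) (binomial-two n) ⟩
  2 * suc n + suc n * n               ≡⟨ aux n ⟩
  suc (suc n) * suc n                 ∎
  where
  aux : ∀ n → 2 * suc n + suc n * n ≡ suc (suc n) * suc n
  aux = solve-∀

binomial-triple : ∀ ν → 2 * (3 * ((ν + 2) C 2)) ≡ 3 * (suc (ν + 1) * (ν + 1))
binomial-triple ν = trans (aux ((ν + 2) C 2))
  (cong (3 *_) (trans (cong (λ n → 2 * (n C 2)) (+-suc ν 1)) (binomial-two (ν + 1))))
  where
  aux : ∀ x → 2 * (3 * x) ≡ 3 * (2 * x)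
  aux = solve-∀

rhsTermValue : ℕ → ℕ → ℕ → ℤ → ℕ → ℕ
rhsTermValue ν M c′ j x = x ^ exponent c′ j * Gℤ (x ^ 3) (⁺ (2 * M)) (⁺ M ℤ.+ ⁺ (ν + 1) ℤ.* j)

⟼-rhs : ∀ ν M c′ B → 3 * ((ν + 2) C 2) ≡ suc c′ →
  rhsPartial ν M B ⟼ λ x → ΣL (intRange B) (λ j → rhsTermValue ν M c′ j x)
⟼-rhs ν M c′ B e = ⟼-sum _ _ (λ j → ⟼-⊗
  (⟼-resp (λ n → trans (cong (λ z → monoℤ z n) (trans (cong (λ c → ⁺ c ℤ.* j ℤ.* j ℤ.+ j) e) (exponent-spec c′ j)))
                       (monoℤ-+ (exponent c′ j) n))
          (⟼-mono (exponent c′ j)))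
  (⟼-at3 (⟼-gauss (⁺ (2 * M)) (⁺ M ℤ.+ ⁺ (ν + 1) ℤ.* j)))) (intRange B)

-- Parity and the support of the summand

shift-eval : ∀ a k f → shift a (a + k) f ≡ f k
shift-eval zero    k f = refl
shift-eval (suc a) k f = shift-eval a k f

suc-parity : ∀ n → ((suc n % 2) ≡ᵇ (n % 2)) ≡ false
suc-parity zero          = refl
suc-parity (suc zero)    = refl
suc-parity (suc (suc n)) = suc-parity n

-- Division rounds so that twice the quotient does not exceed the dividend; a natural quotient would
-- contradict this.
negative-half : ∀ c → ∃ λ d → -[1+ c ] /ℤ ⁺ 2 ≡ -[1+ d ]
negative-half c with -[1+ c ] /ℤ ⁺ 2 in eq
... | -[1+ d ] = d , refl
... | ⁺ e with () ← subst (ℤ._≤ -[1+ c ]) (trans (cong (ℤ._* ⁺ 2) eq) (sym (ℤ.pos-* e 2))) ([n/d]*d≤n -[1+ c ] (⁺ 2))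

square-parity : ∀ n → ∃ λ y → n * n + n ≡ 2 * y
square-parity zero    = 0 , refl
square-parity (suc n) with y , e ← square-parity n = y + suc n ,
  trans (aux₁ n) (trans (cong (_+ 2 * suc n) e) (aux₂ y n))
  where
  aux₁ : ∀ n → suc n * suc n + suc n ≡ n * n + n + 2 * suc n
  aux₁ = solve-∀
  aux₂ : ∀ y n → 2 * y + 2 * suc n ≡ 2 * (y + suc n)
  aux₂ = solve-∀

squares-parity : ∀ ns → ∃ λ y → sumℕ (map sq ns) + sumℕ ns ≡ 2 * y
squares-parity []       = 0 , refl
squares-parity (n ∷ ns) with y , e ← square-parity n | z , e′ ← squares-parity ns = y + z ,
  trans (+-interchange (n * n) (sumℕ (map sq ns)) n (sumℕ ns)) (trans (cong₂ _+_ e e′) (sym (*-distribˡ-+ 2 y z)))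

even-difference : ∀ e a b → e + 2 * a ≡ 2 * b → 2 * (e / 2) ≡ e
even-difference e a b eq = trans (cong (λ n → 2 * (n / 2)) e≡) (trans (cong (2 *_) (m*n/n≡m (b ∸ a) 2))
  (trans (*-comm 2 (b ∸ a)) (sym e≡)))
  where
  e≡ : e ≡ (b ∸ a) * 2
  e≡ = begin
    e                   ≡⟨ m+n∸n≡m e (2 * a) ⟨
    e + 2 * a ∸ 2 * a   ≡⟨ cong (_∸ 2 * a) eq ⟩
    2 * b ∸ 2 * a       ≡⟨ *-distribˡ-∸ 2 b a ⟨
    2 * (b ∸ a)         ≡⟨ *-comm 2 (b ∸ a) ⟩
    (b ∸ a) * 2         ∎

⊖-below : ∀ i n → i < n → i ℤ.⊖ n ≡ -[1+ n ∸ suc i ]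
⊖-below i n i<n = begin
  i ℤ.⊖ n                       ≡⟨ cong₂ ℤ._⊖_ (+-identityʳ i) (trans (+-suc i c) (m+[n∸m]≡n i<n)) ⟨
  (i + 0) ℤ.⊖ (i + suc c)       ≡⟨ ℤ.+-cancelˡ-⊖ i 0 (suc c) ⟩
  -[1+ c ]                      ∎
  where
  c = n ∸ suc i

|N| |N²| : List ℕ → ℕ
|N| ns  = sumℕ (Ns ns)
|N²| ns = sumℕ (map sq (Ns ns))

odd-excluded : ∀ s m k → (((s + m + suc (2 * k) + m) % 2) ≡ᵇ (s % 2)) ≡ false
odd-excluded s m k = trans
  (cong (_≡ᵇ (s % 2)) (trans (cong (_% 2) (aux s m k)) ([m+kn]%n≡m%n (suc s) (m + k) 2)))
  (suc-parity s)
  where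
  aux : ∀ s m k → s + m + suc (2 * k) + m ≡ suc s + (m + k) * 2
  aux = solve-∀

-- If i ≥ |N| + m, the only obstruction is that i - |N| - m is odd, and then the congruence fails.
-- If i < |N| + m, the halved difference is negative, so the upper index of the Gaussian with lower
-- index 2n_ν is too small.
lhsSummand-zero : ∀ M i m ns x → (∀ k → |N| ns + (m + 2 * k) ≢ i) → lhsSummandValue M i m ns x ≡ 0
lhsSummand-zero M i m ns x ¬e with ((i + m) % 2) ≡ᵇ (|N| ns % 2) in par
... | false = refl
... | true with |N| ns + m ≤? i
...   | yes le with w , refl ← m≤n⇒n≡m+ le with evenOrOdd w
...     | k , inj₁ refl with () ← ¬e k (sym (+-assoc (|N| ns) m (2 * k)))
...     | k , inj₂ refl with () ← trans (sym par) (odd-excluded (|N| ns) m k)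
lhsSummand-zero M i m ns x ¬e | true | no ¬le = trans
  (cong (λ z → E * (a * (b * (z * P)))) vanish) (aux E a b P)
  where
  E = x ^ ((sq m + 3 * (sq i + |N²| ns)) / 2)
  a = Gℤ (x ^ 3) (⁺ M) (⁺ i)
  b = Gℤ x (⁺ (3 * lastℕ ns)) (⁺ m)
  P = prodValue i ns (x ^ 3)
  aux : ∀ e a b p → e * (a * (b * (0 * p))) ≡ 0
  aux = solve-∀
  lt : i < |N| ns + m
  lt = ≰⇒> ¬le
  c : ℕ
  c = |N| ns + m ∸ suc i
  difference : ⁺ i ℤ.- ⁺ |N| ns ℤ.- ⁺ m ≡ -[1+ c ]
  difference = begin
    ⁺ i ℤ.- ⁺ |N| ns ℤ.- ⁺ m          ≡⟨ aux₁ (⁺ i) (⁺ |N| ns) (⁺ m) ⟩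
    ⁺ i ℤ.- ⁺ (|N| ns + m)            ≡⟨ ℤ.m-n≡m⊖n i (|N| ns + m) ⟩
    i ℤ.⊖ (|N| ns + m)                ≡⟨ ⊖-below i (|N| ns + m) lt ⟩
    -[1+ c ]                          ∎
    where
    aux₁ : ∀ x y z → x ℤ.+ ℤ.- y ℤ.+ ℤ.- z ≡ x ℤ.+ ℤ.- (y ℤ.+ z)
    aux₁ = ℤSolver.solve-∀
  vanish : Gℤ (x ^ 3) (⁺ (2 * lastℕ ns) ℤ.+ ((⁺ i ℤ.- ⁺ |N| ns ℤ.- ⁺ m) /ℤ ⁺ 2)) (⁺ (2 * lastℕ ns)) ≡ 0
  vanish with d , e ← negative-half c = Gℤ-neg (x ^ 3)
    (⁺ (2 * lastℕ ns) ℤ.+ ((⁺ i ℤ.- ⁺ |N| ns ℤ.- ⁺ m) /ℤ ⁺ 2)) (⁺ (2 * lastℕ ns)) d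
    (trans (aux₁ (⁺ (2 * lastℕ ns)) ((⁺ i ℤ.- ⁺ |N| ns ℤ.- ⁺ m) /ℤ ⁺ 2)) (trans (cong (_/ℤ ⁺ 2) difference) e))
    where
    aux₁ : ∀ x y → x ℤ.+ y ℤ.+ ℤ.- x ≡ y
    aux₁ = ℤSolver.solve-∀

-- Evaluation of both sides at q = t²

module Values (t : ℕ) where
  open Seed t
  open Gaussian p
  open MultinomialSum (t ^ 3) using (multinomial-sum)

  -- With R = i - N₁ - ... - N_ν, the difference i - N₁ - ... - N_j is R + N_(j+1) + ... + N_ν. Read
  -- from the end of the list, the product therefore involves no subtraction.
  Prod : ℕ → List ℕ → ℕ
  Prod R []           = 1
  Prod R (x ∷ [])     = 1
  Prod R (x ∷ y ∷ ys) = G p (R + |N| (y ∷ ys) + x) x * Prod R (y ∷ ys)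

  prodValue-Prod : ∀ R x xs → prodValue (|N| (x ∷ xs) + R) (x ∷ xs) p ≡ Prod R (x ∷ xs)
  prodValue-Prod R x xs = trans
    (ΠL-upTo (length xs) (λ j → Gℤ p (⁺ (|N| (x ∷ xs) + R) ℤ.- ⁺ sumℕ (take j (Ns (x ∷ xs)))
      ℤ.+ ⁺ lookupℕ (x ∷ xs) (j ∸ 1)) (⁺ lookupℕ (x ∷ xs) (j ∸ 1))))
    (go x xs)
    where
    cancel : ∀ a b c → ⁺ (a + b) ℤ.- ⁺ (a + c) ≡ ⁺ b ℤ.- ⁺ c
    cancel a b c = aux (⁺ a) (⁺ b) (⁺ c)
      where
      aux : ∀ a b c → a ℤ.+ b ℤ.+ ℤ.- (a ℤ.+ c) ≡ b ℤ.+ ℤ.- c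
      aux = ℤSolver.solve-∀
    go : ∀ x xs → Π< (length xs) (λ k →
      Gℤ p (⁺ (|N| (x ∷ xs) + R) ℤ.- ⁺ sumℕ (take (suc k) (Ns (x ∷ xs))) ℤ.+ ⁺ lookupℕ (x ∷ xs) k)
           (⁺ lookupℕ (x ∷ xs) k)) ≡ Prod R (x ∷ xs)
    go x []       = refl
    go x (y ∷ ys) = cong₂ _*_
      (trans (cong (λ z → Gℤ p (z ℤ.+ ⁺ x) (⁺ x)) (trans (drop 0) (ℤ.+-identityʳ (⁺ (S + R)))))
             (trans (Gℤ-+ p (S + R + x) x) (cong (λ z → G p (z + x) x) (+-comm S R))))
      (trans (Π<-cong (length ys) λ k → cong (λ z → Gℤ p (z ℤ.+ ⁺ lookupℕ (y ∷ ys) k) (⁺ lookupℕ (y ∷ ys) k))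
               (drop (sumℕ (take (suc k) (Ns (y ∷ ys))))))
             (go y ys))
      where
      N = x + sumℕ (y ∷ ys)
      S = |N| (y ∷ ys)
      drop : ∀ s → ⁺ (N + S + R) ℤ.- ⁺ (N + s) ≡ ⁺ (S + R) ℤ.- ⁺ s
      drop s = trans (cong (λ z → ⁺ z ℤ.- ⁺ (N + s)) (+-assoc N S R)) (cancel N (S + R) s)

  lhsSummand-value : ∀ M m k x xs → let ns = x ∷ xs; i = |N| ns + (m + 2 * k) in
    lhsSummandValue M i m ns q
      ≡ t ^ (3 * (sq i + |N²| ns)) * (G p M i * (Prod (m + 2 * k) ns * seedTerm (lastℕ ns) m k))
  lhsSummand-value M m k x xs = begin
    lhsSummandValue M i m ns q
      ≡⟨ cong (λ b → if b then lhsTermValue M i m ns q else 0) par ⟩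
    lhsTermValue M i m ns q
      ≡⟨ cong₂ _*_ power (cong₂ _*_ (trans (Gℤ-+ (q ^ 3) M i) (cong (λ y → G y M i) q³≡p))
           (cong₂ _*_ (trans (Gℤ-+ q (3 * n) m) (cong (λ y → G q y m) (*-comm 3 n)))
             (cong₂ _*_ third (trans (cong (prodValue i ns) q³≡p) (prodValue-Prod (m + 2 * k) x xs))))) ⟩
    t ^ (m * m) * t ^ (3 * (sq i + |N²| ns)) * (G p M i * (G q (n * 3) m * (G p (2 * n + k) k * Prod (m + 2 * k) ns)))
      ≡⟨ aux (t ^ (m * m)) (t ^ (3 * (sq i + |N²| ns))) (G p M i) (G q (n * 3) m) (G p (2 * n + k) k) _ ⟩
    t ^ (3 * (sq i + |N²| ns)) * (G p M i * (Prod (m + 2 * k) ns * seedTerm n m k)) ∎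
    where
    ns = x ∷ xs
    S = |N| ns
    i = S + (m + 2 * k)
    n = lastℕ ns
    aux : ∀ a b c d e f → a * b * (c * (d * (e * f))) ≡ b * (c * (f * (a * (d * e))))
    aux = solve-∀
    par : (((i + m) % 2) ≡ᵇ (S % 2)) ≡ true
    par = trans (cong (λ z → (z % 2) ≡ᵇ (S % 2)) (e S m k))
      (trans (cong (_≡ᵇ (S % 2)) ([m+kn]%n≡m%n S (m + k) 2)) (≡ᵇ-true (S % 2)))
      where
      e : ∀ s m k → s + (m + 2 * k) + m ≡ s + (m + k) * 2
      e = solve-∀
    power : q ^ ((sq m + 3 * (sq i + |N²| ns)) / 2) ≡ t ^ (m * m) * t ^ (3 * (sq i + |N²| ns))
    power with y₁ , e₁ ← square-parity m | y₂ , e₂ ← square-parity i | y₃ , e₃ ← squares-parity (Ns ns) = begin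
      q ^ (E / 2)                                      ≡⟨ ^-*-assoc t 2 (E / 2) ⟩
      t ^ (2 * (E / 2))
        -- `E` is even: as i = S + m + 2k, adding twice `2 * m + 3 * S + 3 * k` turns every square
        -- in `E` into a product n² + n of consecutive numbers.
        ≡⟨ cong (t ^_) (even-difference E (2 * m + 3 * S + 3 * k) (y₁ + 3 * (y₂ + y₃)) even) ⟩
      t ^ E                                            ≡⟨ ^-distribˡ-+-* t (m * m) _ ⟩
      t ^ (m * m) * t ^ (3 * (sq i + |N²| ns))         ∎
      where
      E = sq m + 3 * (sq i + |N²| ns)
      a₁ : ∀ m s k x y → m * m + 3 * (x + y) + 2 * (2 * m + 3 * s + 3 * k)
        ≡ (m * m + m) + 3 * ((x + (s + (m + 2 * k))) + (y + s))
      a₁ = solve-∀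
      a₂ : ∀ x y z → 2 * x + 3 * (2 * y + 2 * z) ≡ 2 * (x + 3 * (y + z))
      a₂ = solve-∀
      even : E + 2 * (2 * m + 3 * S + 3 * k) ≡ 2 * (y₁ + 3 * (y₂ + y₃))
      even = begin
        E + 2 * (2 * m + 3 * S + 3 * k)                      ≡⟨ a₁ m S k (i * i) (|N²| ns) ⟩
        (m * m + m) + 3 * ((i * i + i) + (|N²| ns + S))      ≡⟨ cong₂ (λ u v → u + 3 * v) e₁ (cong₂ _+_ e₂ e₃) ⟩
        2 * y₁ + 3 * (2 * y₂ + 2 * y₃)                       ≡⟨ a₂ y₁ y₂ y₃ ⟩
        2 * (y₁ + 3 * (y₂ + y₃))                             ∎
    third : Gℤ (q ^ 3) (⁺ (2 * n) ℤ.+ ((⁺ i ℤ.- ⁺ S ℤ.- ⁺ m) /ℤ ⁺ 2)) (⁺ (2 * n)) ≡ G p (2 * n + k) k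
    third = begin
      Gℤ (q ^ 3) (⁺ (2 * n) ℤ.+ ((⁺ i ℤ.- ⁺ S ℤ.- ⁺ m) /ℤ ⁺ 2)) (⁺ (2 * n))
        ≡⟨ cong₂ (λ y z → Gℤ y (⁺ (2 * n) ℤ.+ z) (⁺ (2 * n))) q³≡p halved ⟩
      Gℤ p (⁺ (2 * n + k)) (⁺ (2 * n))
        ≡⟨ Gℤ-+ p (2 * n + k) (2 * n) ⟩
      G p (2 * n + k) (2 * n)
        ≡⟨ G-sym (2 * n) k ⟩
      G p (2 * n + k) k ∎
      where
      a₁ : ∀ s m y → s ℤ.+ (m ℤ.+ y) ℤ.+ ℤ.- s ℤ.+ ℤ.- m ≡ y
      a₁ = ℤSolver.solve-∀
      halved : (⁺ i ℤ.- ⁺ S ℤ.- ⁺ m) /ℤ ⁺ 2 ≡ ⁺ k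
      halved = begin
        (⁺ i ℤ.- ⁺ S ℤ.- ⁺ m) /ℤ ⁺ 2   ≡⟨ cong (_/ℤ ⁺ 2) (a₁ (⁺ S) (⁺ m) (⁺ (2 * k))) ⟩
        ⁺ (2 * k) /ℤ ⁺ 2               ≡⟨ ℤ.*-identityˡ (⁺ (2 * k / 2)) ⟩
        ⁺ (2 * k / 2)                  ≡⟨ cong ⁺_ (trans (cong (_/ 2) (*-comm 2 k)) (m*n/n≡m k 2)) ⟩
        ⁺ k                            ∎

  -- W L (n₁ ∷ … ∷ n_ν) is the part of the summand that depends on i only through L = i - N₁, summed over m.
  W : ℕ → List ℕ → ℕ
  W L []       = 0
  W L (x ∷ xs) = shift (|N| xs) L (λ R → t ^ (3 * |N²| xs) * (Prod R (x ∷ xs) * Σ² R (seedTerm (lastℕ (x ∷ xs)))))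

  h^ : ∀ e → t ^ (3 * e) ≡ h ^ e
  h^ e = sym (^-*-assoc t 3 e)

  -- Once i = |N| + R is fixed, m and k = (R - m)/2 occur only in `seedTerm`, so the sum over m is
  -- `Σ² R`. The shift by N₁ composed with the one inside `W` is a shift by |N|, which is zero when
  -- |N| > i, like every summand.
  sum-m : ∀ M B i x xs → i ≤ B → Σ< (suc B) (λ m → lhsSummandValue M i m (x ∷ xs) q)
    ≡ h ^ (i * i) * (G p M i * (h ^ ((x + sumℕ xs) * (x + sumℕ xs)) * shift (x + sumℕ xs) i (λ L → W L (x ∷ xs))))
  sum-m M B i x xs i≤B with |N| (x ∷ xs) ≤? i
  ... | no S≰i = trans
    (Σ<-zero (suc B) λ m _ → lhsSummand-zero M i m ns q λ k e → S≰i (subst (|N| ns ≤_) e (m≤m+n (|N| ns) _)))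
    (sym (trans (cong (λ z → h ^ (i * i) * (G p M i * (h ^ (N * N) * z)))
           (trans (shift-shift N (|N| xs) i _) (shift-zero (|N| ns) i _ (≰⇒> S≰i))))
         (aux (h ^ (i * i)) (G p M i) (h ^ (N * N)))))
    where
    ns = x ∷ xs
    N = x + sumℕ xs
    aux : ∀ a b c → a * (b * (c * 0)) ≡ 0
    aux = solve-∀
  ... | yes S≤i with R , refl ← m≤n⇒n≡m+ S≤i = begin
    Σ< (suc B) (λ m → lhsSummandValue M i m ns q)
      ≡⟨ Σ²-Σ< R B (λ m k → c * (g * (Prod R ns * seedTerm n m k))) _ (≤-trans (m≤n+m R (|N| ns)) i≤B)
           (λ { m k refl → lhsSummand-value M m k x xs })
           (λ m ¬e → lhsSummand-zero M i m ns q λ k e → ¬e k (+-cancelˡ-≡ (|N| ns) _ _ e)) ⟩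
    Σ² R (λ m k → c * (g * (Prod R ns * seedTerm n m k)))
      ≡⟨ trans (Σ²-* R c _) (cong (c *_) (trans (Σ²-* R g _) (cong (g *_) (Σ²-* R (Prod R ns) _)))) ⟩
    c * (g * (Prod R ns * Σ² R (seedTerm n)))
      ≡⟨ cong (_* (g * (Prod R ns * Σ² R (seedTerm n)))) powers ⟩
    h ^ (i * i) * (h ^ (N * N) * t ^ (3 * |N²| xs)) * (g * (Prod R ns * Σ² R (seedTerm n)))
      ≡⟨ aux (h ^ (i * i)) (h ^ (N * N)) (t ^ (3 * |N²| xs)) g _ ⟩
    h ^ (i * i) * (g * (h ^ (N * N) * (t ^ (3 * |N²| xs) * (Prod R ns * Σ² R (seedTerm n)))))
      ≡⟨ cong (λ z → h ^ (i * i) * (g * (h ^ (N * N) * z)))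
           (trans (shift-shift N (|N| xs) i F) (shift-eval (|N| ns) R F)) ⟨
    h ^ (i * i) * (g * (h ^ (N * N) * shift N i (λ L → W L ns))) ∎
    where
    ns = x ∷ xs
    N = x + sumℕ xs
    n = lastℕ ns
    c = t ^ (3 * (sq i + |N²| ns))
    g = G p M i
    F : ℕ → ℕ
    F R = t ^ (3 * |N²| xs) * (Prod R ns * Σ² R (seedTerm n))
    aux : ∀ a b c d e → a * (b * c) * (d * e) ≡ a * (d * (b * (c * e)))
    aux = solve-∀
    powers : c ≡ h ^ (i * i) * (h ^ (N * N) * t ^ (3 * |N²| xs))
    powers = begin
      t ^ (3 * (i * i + (N * N + |N²| xs)))
        ≡⟨ cong (t ^_) (e (i * i) (N * N) (|N²| xs)) ⟩
      t ^ (3 * (i * i) + (3 * (N * N) + 3 * |N²| xs))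
        ≡⟨ trans (^-distribˡ-+-* t (3 * (i * i)) _) (cong (t ^ (3 * (i * i)) *_) (^-distribˡ-+-* t (3 * (N * N)) _)) ⟩
      t ^ (3 * (i * i)) * (t ^ (3 * (N * N)) * t ^ (3 * |N²| xs))
        ≡⟨ cong₂ (λ u v → u * (v * t ^ (3 * |N²| xs))) (h^ (i * i)) (h^ (N * N)) ⟩
      h ^ (i * i) * (h ^ (N * N) * t ^ (3 * |N²| xs)) ∎
      where
      e : ∀ a b c → 3 * (a + (b + c)) ≡ 3 * a + (3 * b + 3 * c)
      e = solve-∀

  -- Every use of the invariance property with b = j contributes one factor `h ^ (j * j)`.
  weight : ℕ → ℕ → ℕ
  weight ν j = v j * h ^ (ν * (j * j))

  trinomialSum : ℕ → ℕ → ℕ → ℕ → ℕ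
  trinomialSum J ν L N = Σ< J (λ j → weight ν j * T L N (ν * j) j)

  weight-suc : ∀ ν j → weight ν j * h ^ (j * j) ≡ weight (suc ν) j
  weight-suc ν j = trans (*-assoc (v j) _ _) (cong (v j *_)
    (trans (*-comm (h ^ (ν * (j * j))) _) (sym (^-distribˡ-+-* h (j * j) (ν * (j * j))))))

  Σ⁺-linear : ∀ n J (w : ℕ → ℕ → ℕ) (c : ℕ → ℕ) (X : ℕ → ℕ → ℕ → ℕ) →
    Σ⁺ n (λ i l → w i l * Σ< J (λ j → c j * X j i l)) ≡ Σ< J (λ j → c j * Σ⁺ n (λ i l → w i l * X j i l))
  Σ⁺-linear n zero    w c X = Σ⁺-zero n λ i l _ → *-zeroʳ (w i l)
  Σ⁺-linear n (suc J) w c X = begin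
    Σ⁺ n (λ i l → w i l * (c 0 * X 0 i l + R i l))
      ≡⟨ Σ⁺-cong n (λ i l _ → aux (w i l) (c 0) (X 0 i l) (R i l)) ⟩
    Σ⁺ n (λ i l → c 0 * (w i l * X 0 i l) + w i l * R i l)
      ≡⟨ Σ⁺-+ n (λ i l → c 0 * (w i l * X 0 i l)) (λ i l → w i l * R i l) ⟩
    Σ⁺ n (λ i l → c 0 * (w i l * X 0 i l)) + Σ⁺ n (λ i l → w i l * R i l)
      ≡⟨ cong₂ _+_ (Σ⁺-* n (c 0) (λ i l → w i l * X 0 i l)) (Σ⁺-linear n J w (λ j → c (suc j)) (λ j → X (suc j))) ⟩
    Σ< (suc J) (λ j → c j * Σ⁺ n (λ i l → w i l * X j i l)) ∎
    where
    R : ℕ → ℕ → ℕ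
    R i l = Σ< J (λ j → c (suc j) * X (suc j) i l)
    aux : ∀ w c x r → w * (c * x + r) ≡ c * (w * x) + w * r
    aux = solve-∀

  Σ<-linear : ∀ n J (w : ℕ → ℕ) (c : ℕ → ℕ) (X : ℕ → ℕ → ℕ) →
    Σ< n (λ i → w i * Σ< J (λ j → c j * X j i)) ≡ Σ< J (λ j → c j * Σ< n (λ i → w i * X j i))
  Σ<-linear n zero    w c X = Σ<-zero n λ i _ → *-zeroʳ (w i)
  Σ<-linear n (suc J) w c X = begin
    Σ< n (λ i → w i * (c 0 * X 0 i + R i))
      ≡⟨ Σ<-cong n (λ i _ → aux (w i) (c 0) (X 0 i) (R i)) ⟩
    Σ< n (λ i → c 0 * (w i * X 0 i) + w i * R i)
      ≡⟨ Σ<-+ n (λ i → c 0 * (w i * X 0 i)) (λ i → w i * R i) ⟩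
    Σ< n (λ i → c 0 * (w i * X 0 i)) + Σ< n (λ i → w i * R i)
      ≡⟨ cong₂ _+_ (Σ<-* n (c 0) (λ i → w i * X 0 i)) (Σ<-linear n J w (λ j → c (suc j)) (λ j → X (suc j))) ⟩
    Σ< (suc J) (λ j → c j * Σ< n (λ i → w i * X j i)) ∎
    where
    R : ℕ → ℕ
    R i = Σ< J (λ j → c (suc j) * X (suc j) i)
    aux : ∀ w c x r → w * (c * x + r) ≡ c * (w * x) + w * r
    aux = solve-∀

  -- As L = i - N₁, the first factor of the product is [L + n₁, n₁]. What remains depends on i only
  -- through L - N₂, hence the shift by N = N₂.
  W-step : ∀ L x y ys → let N = y + sumℕ ys in
    W L (x ∷ y ∷ ys) ≡ shift N L (λ L′ → h ^ (N * N) * G p (L + x) x * W L′ (y ∷ ys))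
  W-step L x y ys = begin
    shift (N + S) L F
      ≡⟨ shift-shift N S L F ⟨
    shift N L (λ L′ → shift S L′ F)
      ≡⟨ shift-cong N L (λ L′ e → trans (shift-cong S L′ λ R e′ → factor L′ R e e′)
           (shift-* S L′ (h ^ (N * N) * G p (L + x) x) F′)) ⟩
    shift N L (λ L′ → h ^ (N * N) * G p (L + x) x * W L′ (y ∷ ys)) ∎
    where
    N = y + sumℕ ys
    S = |N| ys
    n = lastℕ (y ∷ ys)
    F F′ : ℕ → ℕ
    F R = t ^ (3 * (N * N + |N²| ys)) * (G p (R + (N + S) + x) x * Prod R (y ∷ ys) * Σ² R (seedTerm n))
    F′ R = t ^ (3 * |N²| ys) * (Prod R (y ∷ ys) * Σ² R (seedTerm n))
    factor : ∀ L′ R → N + L′ ≡ L → S + R ≡ L′ → F R ≡ h ^ (N * N) * G p (L + x) x * F′ R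
    factor L′ R refl refl = begin
      t ^ (3 * (N * N + |N²| ys)) * (G p (R + (N + S) + x) x * Prod R (y ∷ ys) * Σ² R (seedTerm n))
        ≡⟨ cong₂ (λ u w → u * (G p w x * Prod R (y ∷ ys) * Σ² R (seedTerm n)))
             (trans (cong (t ^_) (*-distribˡ-+ 3 (N * N) (|N²| ys))) (trans (^-distribˡ-+-* t (3 * (N * N)) _)
               (cong (_* t ^ (3 * |N²| ys)) (h^ (N * N)))))
             (cong (_+ x) (trans (+-comm R (N + S)) (+-assoc N S R))) ⟩
      h ^ (N * N) * t ^ (3 * |N²| ys) * (G p (L + x) x * Prod R (y ∷ ys) * Σ² R (seedTerm n))
        ≡⟨ aux (h ^ (N * N)) (t ^ (3 * |N²| ys)) (G p (L + x) x) (Prod R (y ∷ ys)) _ ⟩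
      h ^ (N * N) * G p (L + x) x * F′ R ∎
      where
      aux : ∀ a b c d e → a * b * (c * d * e) ≡ a * c * (b * (d * e))
      aux = solve-∀

  Σ⁺-reflect : ∀ N L (K : ℕ → ℕ → ℕ) →
    Σ⁺ N (λ x i → shift i L (λ l → h ^ (i * i) * G p (L + x) x * K l i))
      ≡ Σ⁺ L (λ i l → h ^ (i * i) * G p (l + N) L * K l i)
  Σ⁺-reflect N L K = begin
    Σ⁺ N (λ x i → shift i L (λ l → h ^ (i * i) * G p (L + x) x * K l i))
      ≡⟨ Σ⁺-swap N _ ⟩
    Σ⁺ N (λ i x → shift i L (λ l → h ^ (i * i) * G p (L + x) x * K l i))
      ≡⟨ Σ⁺-bounded N _ (suc (N + L)) (s≤s (m≤m+n N L)) ⟩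
    Σ< (suc (N + L)) (λ i → shift i N (λ x → shift i L (λ l → h ^ (i * i) * G p (L + x) x * K l i)))
      ≡⟨ Σ<-cong (suc (N + L)) (λ i _ → term i) ⟩
    Σ< (suc (N + L)) (λ i → shift i L (λ l → h ^ (i * i) * G p (l + N) L * K l i))
      ≡⟨ Σ⁺-bounded L (λ i l → h ^ (i * i) * G p (l + N) L * K l i) (suc (N + L)) (s≤s (m≤n+m L N)) ⟨
    Σ⁺ L (λ i l → h ^ (i * i) * G p (l + N) L * K l i) ∎
    where
    term : ∀ i → shift i N (λ x → shift i L (λ l → h ^ (i * i) * G p (L + x) x * K l i))
      ≡ shift i L (λ l → h ^ (i * i) * G p (l + N) L * K l i)
    term i with i ≤? N
    ... | yes i≤N with x , refl ← m≤n⇒n≡m+ i≤N = trans (shift-eval i x _)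
      (shift-cong i L λ { l refl → cong (λ g → h ^ (i * i) * g * K l i)
        (trans (sym (G-sym (i + l) x)) (cong (λ a → G p a (i + l)) (aux i l x))) })
      where
      aux : ∀ i l x → i + l + x ≡ l + (i + x)
      aux = solve-∀
    ... | no i≰N = trans (shift-zero i N _ (≰⇒> i≰N)) (sym (trans
      (shift-cong i L {g = λ l → 0 * K l i} λ { l refl → cong (_* K l i)
        (trans (cong (h ^ (i * i) *_) (G-zero (l + N) (i + l)
          (subst (_< i + l) (+-comm N l) (+-monoˡ-< l (≰⇒> i≰N))))) (*-zeroʳ (h ^ (i * i)))) })
      (shift-* i L 0 (λ l → K l i))))

  -- For fixed N₁ = N, choosing n₁ = x is the same as choosing N₂ = i = N - x. The step is thus a
  -- sum over N₂, to which `T-transform` applies for each j separately, replacing d = νj by j + νj;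
  -- the base case is `seed`.
  W-sum : ∀ ν L N J → L < J → Σᶜ ν N (W L) ≡ trinomialSum J ν L N
  W-sum zero    L N J L<J = begin
    1 * (1 * Σ² L (seedTerm N))
      ≡⟨ trans (*-identityˡ _) (*-identityˡ _) ⟩
    Σ² L (seedTerm N)
      ≡⟨ seed L N J L<J ⟩
    Σ< J (λ j → v j * T L N 0 j)
      ≡⟨ Σ<-cong J (λ j _ → cong (_* T L N 0 j) (sym (*-identityʳ (v j)))) ⟩
    trinomialSum J 0 L N ∎
  W-sum (suc ν) L N J L<J = begin
    Σ⁺ N (λ x N′ → Σᶜ ν N′ (λ xs → W L (x ∷ xs)))
      ≡⟨ Σ⁺-cong N (λ x N′ _ → inner x N′) ⟩
    Σ⁺ N (λ x i → shift i L (λ l → h ^ (i * i) * G p (L + x) x * trinomialSum J ν l i))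
      ≡⟨ Σ⁺-reflect N L (trinomialSum J ν) ⟩
    Σ⁺ L (λ i l → h ^ (i * i) * G p (l + N) L * trinomialSum J ν l i)
      ≡⟨ Σ⁺-linear L J (λ i l → h ^ (i * i) * G p (l + N) L) (weight ν) (λ j i l → T l i (ν * j) j) ⟩
    Σ< J (λ j → weight ν j * Σ⁺ L (λ i l → h ^ (i * i) * G p (l + N) L * T l i (ν * j) j))
      ≡⟨ Σ<-cong J (λ j _ → begin
           weight ν j * Σ⁺ L (λ i l → h ^ (i * i) * G p (l + N) L * T l i (ν * j) j)
             ≡⟨ cong (weight ν j *_) (trans (Σ⁺-cong L λ i l _ → *-assoc (h ^ (i * i)) _ _)
                  (T-transform L N (ν * j) j)) ⟩
           weight ν j * (h ^ (j * j) * T L N (j + ν * j) j)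
             ≡⟨ *-assoc (weight ν j) _ _ ⟨
           weight ν j * h ^ (j * j) * T L N (suc ν * j) j
             ≡⟨ cong (_* T L N (suc ν * j) j) (weight-suc ν j) ⟩
           weight (suc ν) j * T L N (suc ν * j) j ∎) ⟩
    trinomialSum J (suc ν) L N ∎
    where
    inner : ∀ x N′ → Σᶜ ν N′ (λ xs → W L (x ∷ xs))
      ≡ shift N′ L (λ l → h ^ (N′ * N′) * G p (L + x) x * trinomialSum J ν l N′)
    inner x N′ = begin
      Σᶜ ν N′ (λ xs → W L (x ∷ xs))
        ≡⟨ Σᶜ-cong ν N′ (λ { y ys refl → W-step L x y ys }) ⟩
      Σᶜ ν N′ (λ xs → shift N′ L (λ l → c * W l xs))
        ≡⟨ Σᶜ-shift ν N′ N′ L (λ xs l → c * W l xs) ⟩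
      shift N′ L (λ l → Σᶜ ν N′ (λ xs → c * W l xs))
        ≡⟨ shift-cong N′ L (λ l e → trans (Σᶜ-* ν N′ c (W l))
             (cong (c *_) (W-sum ν l N′ J (≤-trans (s≤s (subst (l ≤_) e (m≤n+m l N′))) L<J)))) ⟩
      shift N′ L (λ l → c * trinomialSum J ν l N′) ∎
      where
      c = h ^ (N′ * N′) * G p (L + x) x

  -- For fixed i the sum over N₁ has no Gaussian factor linking N₁ to i, which is why `T-transform∞`
  -- rather than `T-transform` applies to it. The sum over i follows by `multinomial-sum`, whose
  -- support i ≤ M is covered because M ≤ B. The index a is j times one more than the length `suc ν`
  -- of the tuple.
  lhs-sum : ∀ ν M B → M ≤ B → lhsValue (suc ν) M B q
    ≡ Σ< (suc B) (λ j → let a = j + ν * j + j in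
        weight (suc ν) j * (h ^ (a * a) * G p (2 * M) (M + a)))
  lhs-sum ν M B M≤B = begin
    lhsValue (suc ν) M B q
      ≡⟨ ΣL-upTo (suc B) _ ⟩
    Σ< (suc B) (λ i → ΣL (upTo (suc B)) (λ m → ΣL (boxes (suc ν) B) (λ ns → lhsSummandValue M i m ns q)))
      ≡⟨ Σ<-cong (suc B) (λ { i (s≤s i≤B) → row i i≤B }) ⟩
    Σ< (suc B) (λ i → h ^ (i * i) * G p M i * Σ< (suc B) (λ j → weight (suc ν) j * Y j i))
      ≡⟨ Σ<-linear (suc B) (suc B) (λ i → h ^ (i * i) * G p M i) (weight (suc ν)) Y ⟩
    Σ< (suc B) (λ j → weight (suc ν) j * Σ< (suc B) (λ i → h ^ (i * i) * G p M i * Y j i))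
      ≡⟨ Σ<-cong (suc B) (λ j _ → cong (weight (suc ν) j *_) (trans
           (Σ<-cong (suc B) λ i _ → *-assoc (h ^ (i * i)) (G p M i) (Y j i))
           (multinomial-sum B M (j + ν * j + j) M≤B))) ⟩
    Σ< (suc B) (λ j → let a = j + ν * j + j in weight (suc ν) j * (h ^ (a * a) * G p (2 * M) (M + a))) ∎
    where
    Y : ℕ → ℕ → ℕ
    Y j i = shift (j + ν * j + j) i (λ k → Σ² k (λ n r →
      h ^ (n * n) * (G p i r * G p (n + r + (j + ν * j + j)) n)))
    row : ∀ i → i ≤ B →
      ΣL (upTo (suc B)) (λ m → ΣL (boxes (suc ν) B) (λ ns → lhsSummandValue M i m ns q))
        ≡ h ^ (i * i) * G p M i * Σ< (suc B) (λ j → weight (suc ν) j * Y j i)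
    row i i≤B = begin
      ΣL (upTo (suc B)) (λ m → ΣL (boxes (suc ν) B) (λ ns → lhsSummandValue M i m ns q))
        ≡⟨ ΣL-upTo (suc B) _ ⟩
      Σ< (suc B) (λ m → ΣL (boxes (suc ν) B) (λ ns → lhsSummandValue M i m ns q))
        ≡⟨ ΣL-Σ< (boxes (suc ν) B) (suc B) (λ m ns → lhsSummandValue M i m ns q) ⟩
      ΣL (boxes (suc ν) B) F
        ≡⟨ ΣL-boxes ν B F F-zero ⟩
      Σ< (suc B) (λ N → Σᶜ ν N F)
        ≡⟨ Σ<-cong (suc B) (λ N _ → begin
             Σᶜ ν N F
               ≡⟨ Σᶜ-cong ν N (λ { x xs refl → trans (sum-m M B i x xs i≤B) (aux c₁ c₂ _ _) }) ⟩
             Σᶜ ν N (λ xs → c₁ * c₂ * h ^ (N * N) * shift N i (λ L → W L xs))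
               ≡⟨ Σᶜ-* ν N (c₁ * c₂ * h ^ (N * N)) _ ⟩
             c₁ * c₂ * h ^ (N * N) * Σᶜ ν N (λ xs → shift N i (λ L → W L xs))
               ≡⟨ cong (c₁ * c₂ * h ^ (N * N) *_) (trans (Σᶜ-shift ν N N i (λ xs L → W L xs))
                    (shift-cong N i λ L e → W-sum ν L N (suc B)
                      (s≤s (≤-trans (subst (L ≤_) e (m≤n+m L N)) i≤B)))) ⟩
             c₁ * c₂ * h ^ (N * N) * shift N i (λ L → trinomialSum (suc B) ν L N)
               ≡⟨ *-assoc (c₁ * c₂) (h ^ (N * N)) _ ⟩
             c₁ * c₂ * (h ^ (N * N) * shift N i (λ L → trinomialSum (suc B) ν L N))
               ≡⟨ cong (c₁ * c₂ *_) (shift-* N i (h ^ (N * N)) _) ⟨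
             c₁ * c₂ * shift N i (λ L → h ^ (N * N) * trinomialSum (suc B) ν L N) ∎) ⟩
      Σ< (suc B) (λ N → c₁ * c₂ * shift N i (λ L → h ^ (N * N) * trinomialSum (suc B) ν L N))
        ≡⟨ Σ<-* (suc B) (c₁ * c₂) (λ N → shift N i (λ L → h ^ (N * N) * trinomialSum (suc B) ν L N)) ⟩
      c₁ * c₂ * Σ< (suc B) (λ N → shift N i (λ L → h ^ (N * N) * trinomialSum (suc B) ν L N))
        ≡⟨ cong (c₁ * c₂ *_) (Σ⁺-bounded i (λ N L → h ^ (N * N) * trinomialSum (suc B) ν L N) (suc B) (s≤s i≤B)) ⟨
      c₁ * c₂ * Σ⁺ i (λ N L → h ^ (N * N) * trinomialSum (suc B) ν L N)
        ≡⟨ cong (c₁ * c₂ *_) (Σ⁺-linear i (suc B) (λ N _ → h ^ (N * N)) (weight ν) (λ j N L → T L N (ν * j) j)) ⟩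
      c₁ * c₂ * Σ< (suc B) (λ j → weight ν j * Σ⁺ i (λ N L → h ^ (N * N) * T L N (ν * j) j))
        ≡⟨ cong (c₁ * c₂ *_) (Σ<-cong (suc B) λ j _ → trans (cong (weight ν j *_) (T-transform∞ i (ν * j) j))
             (trans (sym (*-assoc (weight ν j) (h ^ (j * j)) (Y j i))) (cong (_* Y j i) (weight-suc ν j)))) ⟩
      c₁ * c₂ * Σ< (suc B) (λ j → weight (suc ν) j * Y j i) ∎
      where
      c₁ = h ^ (i * i)
      c₂ = G p M i
      aux : ∀ a b c d → a * (b * (c * d)) ≡ a * b * c * d
      aux = solve-∀
      F : List ℕ → ℕ
      F ns = Σ< (suc B) (λ m → lhsSummandValue M i m ns q)
      F-zero : ∀ ns → B < sumℕ ns → F ns ≡ 0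
      F-zero (x ∷ xs) lt = Σ<-zero (suc B) λ m _ → lhsSummand-zero M i m (x ∷ xs) q λ k e →
        <⇒≱ lt (≤-trans (subst (x + sumℕ xs ≤_) e (≤-trans (m≤m+n (x + sumℕ xs) (|N| xs))
          (m≤m+n (|N| (x ∷ xs)) (m + 2 * k)))) i≤B)

  -- With K = `suc ν`, the exponents agree because K + 1 + (K+1)² = (K+1)(K+2) is twice the binomial
  -- coefficient in the statement. The linear term ± j separates `d` from `u`.
  rhs-sum : ∀ ν M B c′ → 3 * ((suc ν + 2) C 2) ≡ suc c′ →
    ΣL (intRange B) (λ j → rhsTermValue (suc ν) M c′ j q)
      ≡ Σ< (suc B) (λ j → let a = j + ν * j + j in
          weight (suc ν) j * (h ^ (a * a) * G p (2 * M) (M + a)))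
  rhs-sum ν M B c′ c-eq = begin
    ΣL (intRange B) f
      ≡⟨ ΣL-++ (map ⁺_ (upTo (suc B))) (map -[1+_] (upTo B)) f ⟩
    ΣL (map ⁺_ (upTo (suc B))) f + ΣL (map -[1+_] (upTo B)) f
      ≡⟨ cong₂ _+_ (trans (ΣL-map ⁺_ (upTo (suc B)) f) (ΣL-upTo (suc B) (λ j → f (⁺ j))))
                   (trans (ΣL-map -[1+_] (upTo B) f) (ΣL-upTo B (λ k → f -[1+ k ]))) ⟩
    Σ< (suc B) (λ j → f (⁺ j)) + Σ< B (λ k → f -[1+ k ])
      -- The sum over k < B becomes one over j = k + 1 ≤ B; its additional term at j = 0 is zero by
      -- `ifPos`.
      ≡⟨ cong₂ _+_ (Σ<-cong (suc B) λ j _ → positive j) (Σ<-cong B λ k _ → negative k) ⟩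
    Σ< (suc B) (λ j → t ^ d j * D j) + Σ< (suc B) (λ j → ifPos j (t ^ u j) * D j)
      ≡⟨ Σ<-+ (suc B) (λ j → t ^ d j * D j) (λ j → ifPos j (t ^ u j) * D j) ⟨
    Σ< (suc B) (λ j → t ^ d j * D j + ifPos j (t ^ u j) * D j)
      ≡⟨ Σ<-cong (suc B) (λ j _ → trans (sym (*-distribʳ-+ (D j) (t ^ d j) (ifPos j (t ^ u j))))
           (sym (*-assoc (v j) (h ^ (suc ν * (j * j))) (h ^ (a# j * a# j) * G p (2 * M) (M + a# j))))) ⟩
    Σ< (suc B) (λ j → let a = j + ν * j + j in weight (suc ν) j * (h ^ (a * a) * G p (2 * M) (M + a))) ∎
    where
    f : ℤ → ℕ
    f j = rhsTermValue (suc ν) M c′ j q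
    a# : ℕ → ℕ
    a# j = j + ν * j + j
    e# : ℕ → ℕ
    e# j = suc ν * (j * j) + a# j * a# j
    D : ℕ → ℕ
    D j = h ^ (suc ν * (j * j)) * (h ^ (a# j * a# j) * G p (2 * M) (M + a# j))

    a-eq : ∀ ν j → (suc ν + 1) * j ≡ j + ν * j + j
    a-eq = solve-∀

    c-double : ∀ y → 2 * (suc c′ * y) ≡ 3 * (suc (suc ν + 1) * (suc ν + 1)) * y
    c-double y = trans (sym (*-assoc 2 (suc c′) y))
      (cong (_* y) (trans (cong (2 *_) (sym c-eq)) (binomial-triple (suc ν))))

    combine : ∀ e w j → 2 * e ≡ w + 3 * e# j → q ^ e * G p (2 * M) (M + a# j) ≡ t ^ w * D j
    combine e w j eq = begin
      q ^ e * g                                               ≡⟨ cong (_* g) (^-*-assoc t 2 e) ⟩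
      t ^ (2 * e) * g                                         ≡⟨ cong (λ z → t ^ z * g) eq ⟩
      t ^ (w + 3 * e# j) * g                                  ≡⟨ cong (_* g) (^-distribˡ-+-* t w _) ⟩
      t ^ w * t ^ (3 * e# j) * g                              ≡⟨ cong (λ z → t ^ w * z * g) (h^ (e# j)) ⟩
      t ^ w * h ^ e# j * g
        ≡⟨ cong (λ z → t ^ w * z * g) (^-distribˡ-+-* h (suc ν * (j * j)) _) ⟩
      t ^ w * (h ^ (suc ν * (j * j)) * h ^ (a# j * a# j)) * g ≡⟨ aux (t ^ w) (h ^ (suc ν * (j * j))) _ g ⟩
      t ^ w * D j                                             ∎
      where
      g = G p (2 * M) (M + a# j)
      aux : ∀ x y z w → x * (y * z) * w ≡ x * (y * (z * w))
      aux = solve-∀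

    positive : ∀ j → f (⁺ j) ≡ t ^ d j * D j
    positive j = trans (cong (q ^ exponent c′ (⁺ j) *_) value) (combine (exponent c′ (⁺ j)) (d j) j exps)
      where
      value : Gℤ (q ^ 3) (⁺ (2 * M)) (⁺ M ℤ.+ ⁺ (suc ν + 1) ℤ.* ⁺ j) ≡ G p (2 * M) (M + a# j)
      value = trans (cong₂ (λ y z → Gℤ y (⁺ (2 * M)) (⁺ M ℤ.+ z)) q³≡p
        (trans (sym (ℤ.pos-* (suc ν + 1) j)) (cong ⁺_ (a-eq ν j)))) (Gℤ-+ p (2 * M) (M + a# j))
      a₁ : ∀ ν j → 3 * (suc (suc ν + 1) * (suc ν + 1)) * (j * j) + 2 * j
        ≡ 3 * (j * j) + 2 * j + 3 * (suc ν * (j * j) + (j + ν * j + j) * (j + ν * j + j))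
      a₁ = solve-∀
      a₂ : ∀ c j → 2 * (c * j * j + j) ≡ 2 * (c * (j * j)) + 2 * j
      a₂ = solve-∀
      exps : 2 * exponent c′ (⁺ j) ≡ d j + 3 * e# j
      exps = trans (a₂ (suc c′) j) (trans (cong (_+ 2 * j) (c-double (j * j))) (a₁ ν j))

    negative : ∀ k → f -[1+ k ] ≡ t ^ u (suc k) * D (suc k)
    negative k = trans (cong (q ^ exponent c′ -[1+ k ] *_) value) (combine (exponent c′ -[1+ k ]) (u j) j exps)
      where
      j = suc k
      a = a# j
      index : ⁺ M ℤ.+ ⁺ (suc ν + 1) ℤ.* -[1+ k ] ≡ M ℤ.⊖ a
      index = begin
        ⁺ M ℤ.+ ⁺ (suc ν + 1) ℤ.* -[1+ k ]      ≡⟨ cong (λ z → ⁺ M ℤ.+ z) (ℤ.neg-distribʳ-* (⁺ (suc ν + 1)) (⁺ j)) ⟨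
        ⁺ M ℤ.- ⁺ (suc ν + 1) ℤ.* ⁺ j
          ≡⟨ cong (λ z → ⁺ M ℤ.- z) (trans (sym (ℤ.pos-* (suc ν + 1) j)) (cong ⁺_ (a-eq ν j))) ⟩
        ⁺ M ℤ.- ⁺ a                             ≡⟨ ℤ.m-n≡m⊖n M a ⟩
        M ℤ.⊖ a                                 ∎
      -- [2M, M - a] = [2M, M + a] by symmetry. For a > M the lower index is negative on one side
      -- and exceeds 2M on the other, so both are zero.
      value : Gℤ (q ^ 3) (⁺ (2 * M)) (⁺ M ℤ.+ ⁺ (suc ν + 1) ℤ.* -[1+ k ]) ≡ G p (2 * M) (M + a)
      value with a ≤? M
      ... | yes a≤M = begin
        Gℤ (q ^ 3) (⁺ (2 * M)) (⁺ M ℤ.+ ⁺ (suc ν + 1) ℤ.* -[1+ k ])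
          ≡⟨ cong₂ (λ y z → Gℤ y (⁺ (2 * M)) z) q³≡p (trans index (ℤ.⊖-≥ a≤M)) ⟩
        Gℤ p (⁺ (2 * M)) (⁺ (M ∸ a))
          ≡⟨ Gℤ-+ p (2 * M) (M ∸ a) ⟩
        G p (2 * M) (M ∸ a)
          ≡⟨ cong (λ z → G p z (M ∸ a)) split ⟩
        G p (M + a + (M ∸ a)) (M ∸ a)
          ≡⟨ G-sym (M + a) (M ∸ a) ⟨
        G p (M + a + (M ∸ a)) (M + a)
          ≡⟨ cong (λ z → G p z (M + a)) split ⟨
        G p (2 * M) (M + a) ∎
        where
        split : 2 * M ≡ M + a + (M ∸ a)
        split = trans (cong (M +_) (trans (+-identityʳ M) (sym (m+[n∸m]≡n a≤M)))) (sym (+-assoc M a (M ∸ a)))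
      ... | no a≰M = trans
        (cong₂ (λ y z → Gℤ y (⁺ (2 * M)) z) q³≡p (trans index below))
        (trans (Gℤ-bot p (⁺ (2 * M)) (a ∸ suc M))
          (sym (G-zero (2 * M) (M + a) (+-monoʳ-< M (subst (_< a) (sym (+-identityʳ M)) (≰⇒> a≰M))))))
        where
        below : M ℤ.⊖ a ≡ -[1+ a ∸ suc M ]
        below = ⊖-below M a (≰⇒> a≰M)
      a₁ : ∀ ν j → 3 * (suc (suc ν + 1) * (suc ν + 1)) * (j * j)
        ≡ 3 * (j * j) + 3 * (suc ν * (j * j) + (j + ν * j + j) * (j + ν * j + j))
      a₁ = solve-∀
      a₂ : ∀ c k → 2 * (suc k * (suc c * k + c)) + 2 * suc k ≡ 2 * (suc c * (suc k * suc k))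
      a₂ = solve-∀
      a₃ : ∀ x y z → x + 2 * y + z ≡ x + z + 2 * y
      a₃ = solve-∀
      exps : 2 * exponent c′ -[1+ k ] ≡ u j + 3 * e# j
      exps = +-cancelʳ-≡ (2 * j) _ _ (begin
        2 * exponent c′ -[1+ k ] + 2 * j      ≡⟨ a₂ c′ k ⟩
        2 * (suc c′ * (j * j))                ≡⟨ c-double (j * j) ⟩
        3 * (suc (suc ν + 1) * (suc ν + 1)) * (j * j) ≡⟨ a₁ ν j ⟩
        3 * (j * j) + 3 * e# j                ≡⟨ cong (_+ 3 * e# j) (u-spec j) ⟨
        u j + 2 * j + 3 * e# j                ≡⟨ a₃ (u j) j (3 * e# j) ⟩
        u j + 3 * e# j + 2 * j                ∎)

theorem6p5 : (ν : ℕ) → 1 ≤ ν → (M : ℕ) → (e : ℕ) →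
    ∃[ B₀ ] ((B : ℕ) → B₀ ≤ B → lhsPartial ν M B e ≡ rhsPartial ν M B e)
-- The bound M serves every coefficient e at once: for M ≤ B the two truncations have equal values
-- at all squares of positive numbers, hence are equal as series.
theorem6p5 (suc ν) _ M e = M , λ B M≤B → ⟼-unique (⟼-lhs (suc ν) M B) (⟼-rhs (suc ν) M c′ B c-eq)
  (λ t → trans (lhs-sum (suc t) ν M B M≤B) (sym (rhs-sum (suc t) ν M B c′ c-eq))) e
  where
  open Values
  c : ℕ
  c = 3 * ((suc ν + 2) C 2)
  c′ = c ∸ 1
  c-eq : c ≡ suc c′
  c-eq with c in eq
  ... | suc _ = refl
  -- Twice this constant is 3(ν+1)(ν+2) for the original ν, a positive number.
  ... | zero with () ← trans (cong (2 *_) (sym eq)) (binomial-triple (suc ν))
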